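{- Let $G$ be a valued abelian group with valuation $v:G\to\Gamma$ and infinite value set $\Gamma$. Then $G$ is minimal (as a valued group) if and only if the following hold: $\Gamma$ with its induced $\mathcal L_v$-structure is minimal and has order type $\omega^*$; the map $v$ has finite fibres; and either $G$ is elementary abelian, or, for some prime $p$, $G$ is a finite product of Prüfer $p$-groups and $f_p$ is eventually a well-defined $\mathcal L_v$-isomorphism acting by right shift.
   Context: A valued abelian group is an abelian group $G$ together with a surjective map $v:G\to\Gamma$, where $\Gamma$ is a linearly ordered set with maximum $\infty$, such that (1) $v(x)=\infty$ iff $x=0$, and (2) $v(x-y)\ge\min\{v(x),v(y)\}$. It is viewed as a structure with group sort $G$ and value sort $\Gamma$ in the language $\mathcal L_{vg}=\{+,0,v,\le,\infty\}$. It is minimal if $G$ is infinite and every subset of $G$ definable with parameters in this structure is finite or co-finite in $G$. In general an infinite first-order structure is minimal if every subset of it definable with parameters is finite or co-finite. $\omega^*$ denotes the reverse order of $\omega$. For $\gamma\in\Gamma\setminus\{\infty\}$ put $\bar B(\gamma)=\{x\in G:v(x)\ge\gamma\}$ and $B^o(\gamma)=\{x\in G:v(x)>\gamma\}$; these are subgroups of $G$. For $m\ge1$, $R_m$ is the unary relation on $\Gamma$ given by $R_m(\gamma)\Leftrightarrow|\bar B(\gamma)/B^o(\gamma)|>m$. For $n\ge 1$, the function $f_n:\Gamma\to\Gamma$ is given by $f_n(v(x))=v(nx)$ wherever this is well-defined, and takes the value $\infty$ at those $\gamma$ where it is not well-defined. $\mathcal L_v=\{\le,R_n,f_n:n\ge1\}$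 is the resulting language on $\Gamma$. "$f_p$ is eventually a well-defined $\mathcal L_v$-isomorphism acting by right shift" means: outside a finite set (i.e. on an initial segment of $\Gamma$ with finite complement) $f_p$ is well-defined, is given by $\gamma\mapsto$ the $\ell$-th successor of $\gamma$ in $\Gamma$ for some fixed $\ell$, and is an isomorphism onto its image for the $\mathcal L_v$-structure (in particular $R_m(\gamma)\Leftrightarrow R_m(f_p(\gamma))$ for all $m$). -}

module Defs where

open import Algebra.Bundles using (AbelianGroup)
import Algebra.Construct.NaturalChoice.Min as NaturalMin
import Algebra.Construct.Pointwise as Pointwise
import Algebra.Definitions.RawMonoid as Mult
open import Algebra.Morphism.Structures using (module GroupMorphisms)
import Algebra.Properties.AbelianGroup as AbelianGroupProperties
import Algebra.Properties.CommutativeSemigroup as CommutativeSemigroupProperties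
open import Axiom.ExcludedMiddle using (ExcludedMiddle)
open import Data.Empty using (⊥-elim)
open import Data.Fin.Base using (Fin)
open import Data.Integer.Base as ℤ using (ℤ; +_)
import Data.Integer.Properties as ℤ
open import Data.List.Base using (List; []; _∷_)
open import Data.List.Membership.Propositional using (_∈_)
import Data.List.Membership.Setoid as SetoidMembership
open import Data.List.Relation.Unary.All as All using (All; []; _∷_)
open import Data.List.Relation.Unary.Any using (here; there)
open import Data.Nat.Base as ℕ using (ℕ; zero; suc; NonZero)
import Data.Nat.Properties as ℕ
open import Data.Nat.Primality using (Prime)
open import Data.Product.Base using (Σ; ∃; ∃₂; _×_; _,_; proj₁; proj₂)
open import Data.Rational.Base as ℚ using (ℚ; _/_)
import Data.Rational.Properties as ℚ
open import Data.Rational.Unnormalised.Base as ℚᵘ using (mkℚᵘ; *≡*)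
import Data.Rational.Unnormalised.Properties as ℚᵘ
open import Data.Sum.Base using (_⊎_; inj₁; inj₂)
open import Data.Unit.Base using (⊤; tt)
open import Function.Base using (_∘_)
open import Function.Bundles using (Equivalence; Injection; _⇔_)
open import Function.Definitions using (Surjective)
open import Level using (Level; _⊔_; 0ℓ) renaming (suc to lsuc)
open import Relation.Binary.Bundles using (Setoid; TotalOrder)
open import Relation.Binary.Definitions using (Maximum)
open import Relation.Binary.Morphism.Structures using (IsOrderIsomorphism)
open import Relation.Binary.PropositionalEquality as ≡ using (_≡_; cong; cong₂)
import Relation.Binary.Construct.NonStrictToStrict as NonStrictToStrict
import Relation.Binary.Properties.TotalOrder as TotalOrderProperties
open import Relation.Nullary using (¬_; Dec; yes; no)
open import Relation.Unary using (Pred; ∁; U)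

private
  variable
    a c ℓ h n : Level

-- Equivalent, under excluded middle, to being enumerated exactly by a
-- finite list (up to the equality of the setoid).
Finite : (S : Setoid c ℓ) → Pred (Setoid.Carrier S) h → Set (c ⊔ ℓ ⊔ h)
Finite S P = ∃ λ xs → ∀ x → P x → x ∈ₛ xs
  where open SetoidMembership S renaming (_∈_ to _∈ₛ_)

Infinite : Setoid c ℓ → Set (c ⊔ ℓ)
Infinite S = ¬ Finite S U

MoreThan : ℕ → Setoid c ℓ → Set (c ⊔ ℓ)
MoreThan m S = Injection (≡.setoid (Fin (suc m))) S

record Language : Set₁ where
  field
    Sort : Set
    Fun  : List Sort → Sort → Set
    Rel  : List Sort → Set

module _ (L : Language) where
  open Language L

  data Term (Δ : List Sort) : Sort → Set where
    var : ∀ {s} → s ∈ Δ → Term Δ s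
    app : ∀ {Θ s} → Fun Θ s → All (Term Δ) Θ → Term Δ s

  -- The other connectives and ∀ are classically definable from these.
  data Formula (Δ : List Sort) : Set where
    _≐_  : ∀ {s} → Term Δ s → Term Δ s → Formula Δ
    atom : ∀ {Θ} → Rel Θ → All (Term Δ) Θ → Formula Δ
    neg  : Formula Δ → Formula Δ
    _∧_  : Formula Δ → Formula Δ → Formula Δ
    ex   : ∀ s → Formula (s ∷ Δ) → Formula Δ

  record Structure (a : Level) : Set (lsuc a) where
    field
      Dom : Sort → Setoid a a

    ∣_∣ : Sort → Set a
    ∣ s ∣ = Setoid.Carrier (Dom s)

    Env : List Sort → Set a
    Env = All ∣_∣

    _≋_ : ∀ {Δ} → Env Δ → Env Δ → Set a
    _≋_ {Δ} xs ys =
      ∀ {s} (i : s ∈ Δ) → Setoid._≈_ (Dom s) (All.lookup xs i) (All.lookup ys i)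

    field
      fun      : ∀ {Δ s} → Fun Δ s → Env Δ → ∣ s ∣
      fun-cong : ∀ {Δ s} (F : Fun Δ s) {xs ys : Env Δ} → xs ≋ ys →
                 Setoid._≈_ (Dom s) (fun F xs) (fun F ys)
      rel      : ∀ {Δ} → Rel Δ → Env Δ → Set a
      rel-resp : ∀ {Δ} (R : Rel Δ) {xs ys : Env Δ} → xs ≋ ys →
                 rel R xs → rel R ys

module _ {L : Language} (M : Structure L a) where
  open Language L
  open Structure M

  mutual
    eval : ∀ {Δ s} → Env Δ → Term L Δ s → ∣ s ∣
    eval ρ (var i)    = All.lookup ρ i
    eval ρ (app F ts) = fun F (evals ρ ts)

    evals : ∀ {Δ Θ} → Env Δ → All (Term L Δ) Θ → Env Θ
    evals ρ []       = []
    evals ρ (t ∷ ts) = eval ρ t ∷ evals ρ ts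

  infix 4 _⊨_
  _⊨_ : ∀ {Δ} → Env Δ → Formula L Δ → Set a
  ρ ⊨ (_≐_ {s} t u) = Setoid._≈_ (Dom s) (eval ρ t) (eval ρ u)
  ρ ⊨ atom R ts     = rel R (evals ρ ts)
  ρ ⊨ neg φ         = ¬ (ρ ⊨ φ)
  ρ ⊨ (φ ∧ ψ)       = (ρ ⊨ φ) × (ρ ⊨ ψ)
  ρ ⊨ ex s φ        = ∃ λ (x : ∣ s ∣) → (x ∷ ρ) ⊨ φ

  -- The parameters ρ may come from any sort.
  DefinedBy : ∀ {Δ s} → Formula L (s ∷ Δ) → Env Δ → Pred ∣ s ∣ a
  DefinedBy φ ρ x = (x ∷ ρ) ⊨ φ

  Minimal : Sort → Set a
  Minimal s = Infinite (Dom s) ×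
    (∀ {Δ} (φ : Formula L (s ∷ Δ)) (ρ : Env Δ) →
       Finite (Dom s) (DefinedBy φ ρ) ⊎ Finite (Dom s) (∁ (DefinedBy φ ρ)))

  -- The subset I need not be closed under the function symbols, so these
  -- are compared through their graphs on I, as one does for relations.
  record IsIsomorphismOntoImage (I : ∀ s → Pred ∣ s ∣ a)
                                (g : ∀ s → ∣ s ∣ → ∣ s ∣) : Set a where
    g* : ∀ {Δ} → Env Δ → Env Δ
    g* = All.map (λ {s} → g s)

    I* : ∀ {Δ} → Env Δ → Set a
    I* {Δ} xs = ∀ {s} (i : s ∈ Δ) → I s (All.lookup xs i)

    field
      ≈-⇔   : ∀ {s x y} → I s x → I s y → let open Setoid (Dom s) in
              x ≈ y ⇔ g s x ≈ g s y
      fun-⇔ : ∀ {Δ s} (F : Fun Δ s) {xs : Env Δ} {y} → I* xs → I s y →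
              let open Setoid (Dom s) in
              fun F xs ≈ y ⇔ fun F (g* xs) ≈ g s y
      rel-⇔ : ∀ {Δ} (R : Rel Δ) {xs : Env Δ} → I* xs →
              rel R xs ⇔ rel R (g* xs)

module _ (G : AbelianGroup c ℓ) where
  open AbelianGroup G

  record IsSubgroup (H : Pred Carrier h) : Set (c ⊔ ℓ ⊔ h) where
    field
      resp      : ∀ {x y} → x ≈ y → H x → H y
      ε-closed  : H ε
      -‿closed : ∀ {x y} → H x → H y → H (x - y)

    ⁻¹-closed : ∀ {x} → H x → H (x ⁻¹)
    ⁻¹-closed Hx = resp (identityˡ _) (-‿closed ε-closed Hx)

    ∙-closed : ∀ {x y} → H x → H y → H (x ∙ y)
    ∙-closed Hx Hy =
      resp (∙-congˡ (AbelianGroupProperties.⁻¹-involutive G _))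
           (-‿closed Hx (⁻¹-closed Hy))

  -- H / (H ∩ N)
  subquotient : {H : Pred Carrier h} {N : Pred Carrier n} →
                IsSubgroup H → IsSubgroup N → AbelianGroup (c ⊔ h) n
  subquotient {H = H} {N = N} H≤ N≤ = record
    { Carrier = Σ Carrier H
    ; _≈_     = λ x y → N (proj₁ x - proj₁ y)
    ; _∙_     = λ (x , Hx) (y , Hy) → x ∙ y , H≤.∙-closed Hx Hy
    ; ε       = ε , H≤.ε-closed
    ; _⁻¹     = λ (x , Hx) → x ⁻¹ , H≤.⁻¹-closed Hx
    ; isAbelianGroup = record
      { isGroup = record
        { isMonoid = record
          { isSemigroup = record
            { isMagma = record
              { isEquivalence = record
                { refl  = ≈⇒N refl
                ; sym   = λ x~y → N≤.resp (⁻¹-anti-homo‿- _ _) (N≤.⁻¹-closed x~y)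
                ; trans = λ x~y y~z → N≤.resp (telescope _ _ _) (N≤.∙-closed x~y y~z)
                }
              ; ∙-cong = λ x~y u~v → N≤.resp (exchange _ _ _ _) (N≤.∙-closed x~y u~v)
              }
            ; assoc = λ _ _ _ → ≈⇒N (assoc _ _ _)
            }
          ; identity = (λ _ → ≈⇒N (identityˡ _)) , (λ _ → ≈⇒N (identityʳ _))
          }
        ; inverse = (λ _ → ≈⇒N (inverseˡ _)) , (λ _ → ≈⇒N (inverseʳ _))
        ; ⁻¹-cong = λ x~y → N≤.resp (sym (⁻¹-∙-comm _ _)) (N≤.⁻¹-closed x~y)
        }
      ; comm = λ _ _ → ≈⇒N (comm _ _)
      }
    }
    where
    open AbelianGroupProperties G
    open CommutativeSemigroupProperties commutativeSemigroup using (interchange)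
    module H≤ = IsSubgroup H≤
    module N≤ = IsSubgroup N≤

    ≈⇒N : ∀ {x y} → x ≈ y → N (x - y)
    ≈⇒N x≈y = N≤.resp (sym (x≈y⇒x∙y⁻¹≈ε x≈y)) N≤.ε-closed

    telescope : ∀ x y z → (x - y) ∙ (y - z) ≈ x - z
    telescope x y z =
      trans (sym (assoc (x - y) y (z ⁻¹))) (∙-congʳ (//-rightDividesˡ y x))

    exchange : ∀ x y u v → (x - y) ∙ (u - v) ≈ (x ∙ u) - (y ∙ v)
    exchange x y u v =
      trans (interchange x (y ⁻¹) u (v ⁻¹)) (∙-congˡ (⁻¹-∙-comm y v))

IsElementaryAbelian : AbelianGroup c ℓ → Set (c ⊔ ℓ)
IsElementaryAbelian G = ∃ λ p → Prime p × (∀ x → p ×ᴳ x ≈ ε)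
  where
  open AbelianGroup G
  open Mult rawMonoid using () renaming (_×_ to _×ᴳ_)

fromℤ : ℤ → ℚ
fromℤ z = z / 1

fromℤ-homo-+ : ∀ y z → fromℤ (y ℤ.+ z) ≡ fromℤ y ℚ.+ fromℤ z
fromℤ-homo-+ y z = ℚ.toℚᵘ-injective (begin-equality
  ℚ.toℚᵘ (fromℤ (y ℤ.+ z))                 ≃⟨ ℚ.toℚᵘ-fromℚᵘ (mkℚᵘ (y ℤ.+ z) 0) ⟩
  mkℚᵘ (y ℤ.+ z) 0                         ≃⟨ *≡* (cong (ℤ._* + 1) (cong₂ ℤ._+_ (ℤ.*-identityʳ y) (ℤ.*-identityʳ z))) ⟨
  mkℚᵘ y 0 ℚᵘ.+ mkℚᵘ z 0                   ≃⟨ ℚᵘ.+-cong (ℚ.toℚᵘ-fromℚᵘ (mkℚᵘ y 0)) (ℚ.toℚᵘ-fromℚᵘ (mkℚᵘ z 0)) ⟨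
  ℚ.toℚᵘ (fromℤ y) ℚᵘ.+ ℚ.toℚᵘ (fromℤ z)   ≃⟨ ℚ.toℚᵘ-homo-+ (fromℤ y) (fromℤ z) ⟨
  ℚ.toℚᵘ (fromℤ y ℚ.+ fromℤ z)             ∎)
  where open ℚᵘ.≤-Reasoning

fromℤ-homo-* : ∀ y z → fromℤ (y ℤ.* z) ≡ fromℤ y ℚ.* fromℤ z
fromℤ-homo-* y z = ℚ.toℚᵘ-injective (begin-equality
  ℚ.toℚᵘ (fromℤ (y ℤ.* z))                 ≃⟨ ℚ.toℚᵘ-fromℚᵘ (mkℚᵘ (y ℤ.* z) 0) ⟩
  mkℚᵘ y 0 ℚᵘ.* mkℚᵘ z 0                   ≃⟨ ℚᵘ.*-cong (ℚ.toℚᵘ-fromℚᵘ (mkℚᵘ y 0)) (ℚ.toℚᵘ-fromℚᵘ (mkℚᵘ z 0)) ⟨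
  ℚ.toℚᵘ (fromℤ y) ℚᵘ.* ℚ.toℚᵘ (fromℤ z)   ≃⟨ ℚ.toℚᵘ-homo-* (fromℤ y) (fromℤ z) ⟨
  ℚ.toℚᵘ (fromℤ y ℚ.* fromℤ z)             ∎)
  where open ℚᵘ.≤-Reasoning

IsInteger : Pred ℚ 0ℓ
IsInteger q = ∃ λ z → q ≡ fromℤ z

fromℤ-homo-neg : ∀ z → fromℤ (ℤ.- z) ≡ ℚ.- fromℤ z
fromℤ-homo-neg z = inverseˡ-unique (fromℤ (ℤ.- z)) (fromℤ z)
  (≡.trans (≡.sym (fromℤ-homo-+ (ℤ.- z) z)) (cong fromℤ (ℤ.+-inverseˡ z)))
  where open AbelianGroupProperties ℚ.+-0-abelianGroup

integer-isSubgroup : IsSubgroup ℚ.+-0-abelianGroup IsInteger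
integer-isSubgroup = record
  { resp     = λ { ≡.refl q∈ℤ → q∈ℤ }
  ; ε-closed = + 0 , ≡.refl
  ; -‿closed = λ { (y , ≡.refl) (z , ≡.refl) →
      y ℤ.+ ℤ.- z ,
      ≡.sym (≡.trans (fromℤ-homo-+ y (ℤ.- z))
                     (cong (fromℤ y ℚ.+_) (fromℤ-homo-neg z))) }
  }

integer-* : ∀ {q r} → IsInteger q → IsInteger r → IsInteger (q ℚ.* r)
integer-* (y , ≡.refl) (z , ≡.refl) = y ℤ.* z , ≡.sym (fromℤ-homo-* y z)

HasPowerDenominator : ℕ → Pred ℚ 0ℓ
HasPowerDenominator p q = ∃ λ k → IsInteger (fromℤ (+ (p ℕ.^ k)) ℚ.* q)

powerDenominator-isSubgroup :
  ∀ p → IsSubgroup ℚ.+-0-abelianGroup (HasPowerDenominator p)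
powerDenominator-isSubgroup p = record
  { resp     = λ { ≡.refl Hq → Hq }
  ; ε-closed = 0 , + 0 , ≡.refl
  ; -‿closed = λ { {q} {r} (k , kq∈ℤ) (l , lr∈ℤ) → k ℕ.+ l ,
      ℤ≤.resp (≡.sym (clear k l q r))
        (ℤ≤.-‿closed (integer-* (+ (p ℕ.^ l) , ≡.refl) kq∈ℤ)
                     (integer-* (+ (p ℕ.^ k) , ≡.refl) lr∈ℤ)) }
  }
  where
  module ℤ≤ = IsSubgroup integer-isSubgroup
  open ≡.≡-Reasoning

  P : ℕ → ℚ
  P k = fromℤ (+ (p ℕ.^ k))

  P-+ : ∀ k l → P (k ℕ.+ l) ≡ P k ℚ.* P l
  P-+ k l = ≡.trans
    (cong fromℤ (≡.trans (cong +_ (ℕ.^-distribˡ-+-* p k l)) (ℤ.pos-* (p ℕ.^ k) (p ℕ.^ l))))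
    (fromℤ-homo-* (+ (p ℕ.^ k)) (+ (p ℕ.^ l)))

  clear : ∀ k l q r →
          P (k ℕ.+ l) ℚ.* (q ℚ.- r) ≡ P l ℚ.* (P k ℚ.* q) ℚ.- P k ℚ.* (P l ℚ.* r)
  clear k l q r = begin
    P (k ℕ.+ l) ℚ.* (q ℚ.- r)
      ≡⟨ ℚ.*-distribˡ-+ (P (k ℕ.+ l)) q (ℚ.- r) ⟩
    P (k ℕ.+ l) ℚ.* q ℚ.+ P (k ℕ.+ l) ℚ.* (ℚ.- r)
      ≡⟨ cong (P (k ℕ.+ l) ℚ.* q ℚ.+_) (ℚ.neg-distribʳ-* (P (k ℕ.+ l)) r) ⟨
    P (k ℕ.+ l) ℚ.* q ℚ.- P (k ℕ.+ l) ℚ.* r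
      ≡⟨ cong₂ (λ x y → x ℚ.* q ℚ.- y ℚ.* r)
               (≡.trans (P-+ k l) (ℚ.*-comm (P k) (P l))) (P-+ k l) ⟩
    P l ℚ.* P k ℚ.* q ℚ.- P k ℚ.* P l ℚ.* r
      ≡⟨ cong₂ ℚ._-_ (ℚ.*-assoc (P l) (P k) q) (ℚ.*-assoc (P k) (P l) r) ⟩
    P l ℚ.* (P k ℚ.* q) ℚ.- P k ℚ.* (P l ℚ.* r) ∎

-- ℤ[1/p] / ℤ
Prüfer : ℕ → AbelianGroup 0ℓ 0ℓ
Prüfer p = subquotient ℚ.+-0-abelianGroup
  (powerDenominator-isSubgroup p) integer-isSubgroup

_≅_ : AbelianGroup c ℓ → AbelianGroup a h → Set (c ⊔ ℓ ⊔ a ⊔ h)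
G ≅ H = ∃ λ g → GroupMorphisms.IsGroupIsomorphism G.rawGroup H.rawGroup g
  where
  module G = AbelianGroup G
  module H = AbelianGroup H

IsFiniteProductOfPrüfer : ℕ → AbelianGroup c ℓ → Set (c ⊔ ℓ)
IsFiniteProductOfPrüfer p G =
  ∃ λ k → G ≅ Pointwise.abelianGroup (Fin k) (Prüfer p)

record ValuedAbelianGroup (a : Level) : Set (lsuc a) where
  field
    G : AbelianGroup a a
    Γ : TotalOrder a a a

  module G = AbelianGroup G
  module Γ = TotalOrder Γ
  open NaturalMin Γ using (_⊓_)

  field
    ∞          : Γ.Carrier
    ∞-maximum  : Maximum Γ._≤_ ∞
    v          : G.Carrier → Γ.Carrier
    v-cong     : ∀ {x y} → x G.≈ y → v x Γ.≈ v y
    surjective : Surjective G._≈_ Γ._≈_ v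
    v≈∞⇔≈0     : ∀ x → v x Γ.≈ ∞ ⇔ x G.≈ G.ε
    v-minus    : ∀ x y → (v x ⊓ v y) Γ.≤ v (x G.- y)

  valueSetoid : Setoid a a
  valueSetoid = Γ.Eq.setoid

data VgSort : Set where
  group value : VgSort

data VgFun : List VgSort → VgSort → Set where
  plus     : VgFun (group ∷ group ∷ []) group
  zero     : VgFun [] group
  val      : VgFun (group ∷ []) value
  infinity : VgFun [] value

data VgRel : List VgSort → Set where
  leq : VgRel (value ∷ value ∷ [])

𝓛vg : Language
𝓛vg = record { Sort = VgSort ; Fun = VgFun ; Rel = VgRel }

data VFun : List ⊤ → ⊤ → Set where
  f : (n : ℕ) .{{_ : NonZero n}} → VFun (tt ∷ []) tt

data VRel : List ⊤ → Set where
  leq : VRel (tt ∷ tt ∷ [])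
  R   : (m : ℕ) .{{_ : NonZero m}} → VRel (tt ∷ [])

𝓛v : Language
𝓛v = record { Sort = ⊤ ; Fun = VFun ; Rel = VRel }

module _ (V : ValuedAbelianGroup a) where
  open ValuedAbelianGroup V
  open Γ using (_≈_; _≉_; _≤_; module Eq)
  open TotalOrderProperties Γ using (_<_; <-respʳ-≈; <-respˡ-≈)
  open Mult G.rawMonoid using () renaming (_×_ to _·_)

  valuedGroupStructure : Structure 𝓛vg a
  valuedGroupStructure = record
    { Dom      = dom
    ; fun      = fun
    ; fun-cong = fun-cong
    ; rel      = λ { leq (γ ∷ δ ∷ []) → γ ≤ δ }
    ; rel-resp = λ { leq {_ ∷ _ ∷ []} {_ ∷ _ ∷ []} eq →
        Γ.≤-respˡ-≈ (eq (here ≡.refl)) ∘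
        Γ.≤-respʳ-≈ (eq (there (here ≡.refl))) }
    }
    where
    dom : VgSort → Setoid a a
    dom group = G.setoid
    dom value = valueSetoid

    fun : ∀ {Δ s} → VgFun Δ s → All (Setoid.Carrier ∘ dom) Δ → Setoid.Carrier (dom s)
    fun plus     (x ∷ y ∷ []) = x G.∙ y
    fun zero     []           = G.ε
    fun val      (x ∷ [])     = v x
    fun infinity []           = ∞

    fun-cong : ∀ {Δ s} (F : VgFun Δ s) {xs ys : All (Setoid.Carrier ∘ dom) Δ} →
      (∀ {t} (i : t ∈ Δ) → Setoid._≈_ (dom t) (All.lookup xs i) (All.lookup ys i)) →
      Setoid._≈_ (dom s) (fun F xs) (fun F ys)
    fun-cong plus {_ ∷ _ ∷ []} {_ ∷ _ ∷ []} eq =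
      G.∙-cong (eq (here ≡.refl)) (eq (there (here ≡.refl)))
    fun-cong zero {[]} {[]} eq = G.refl
    fun-cong val {_ ∷ []} {_ ∷ []} eq = v-cong (eq (here ≡.refl))
    fun-cong infinity {[]} {[]} eq = Eq.refl

  IsMinimalValuedGroup : Set a
  IsMinimalValuedGroup = Minimal valuedGroupStructure group

  HasFiniteFibres : Set a
  HasFiniteFibres = ∀ γ → Finite G.setoid (λ x → v x ≈ γ)

  HasOrderTypeω* : Set a
  HasOrderTypeω* = ∃ λ (g : ℕ → Γ.Carrier) → IsOrderIsomorphism _≡_ _≈_ ℕ._≥_ _≤_ g

  ClosedBall OpenBall : Γ.Carrier → Pred G.Carrier a
  ClosedBall γ x = γ ≤ v x
  OpenBall   γ x = γ < v x

  v-ε : v G.ε ≈ ∞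
  v-ε = Equivalence.from (v≈∞⇔≈0 G.ε) G.refl

  closedBall-isSubgroup : ∀ γ → IsSubgroup G (ClosedBall γ)
  closedBall-isSubgroup γ = record
    { resp     = λ x≈y → Γ.≤-respʳ-≈ (v-cong x≈y)
    ; ε-closed = Γ.≤-respʳ-≈ (Eq.sym v-ε) (∞-maximum γ)
    ; -‿closed = λ γ≤vx γ≤vy → Γ.trans (⊓-glb γ≤vx γ≤vy) (v-minus _ _)
    }
    where open NaturalMin Γ using (⊓-glb)

  openBall-isSubgroup : ∀ {γ} → γ ≉ ∞ → IsSubgroup G (OpenBall γ)
  openBall-isSubgroup {γ} γ≉∞ = record
    { resp     = λ x≈y → <-respʳ-≈ (v-cong x≈y)
    ; ε-closed = <-respʳ-≈ (Eq.sym v-ε) (∞-maximum γ , γ≉∞)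
    ; -‿closed = λ {x} {y} γ<vx γ<vy → <-≤-trans (γ<⊓ γ<vx γ<vy) (v-minus x y)
    }
    where
    open NaturalMin Γ using (_⊓_; ⊓-sel)
    module ToStrict = NonStrictToStrict _≈_ _≤_

    <-≤-trans : ∀ {γ δ ε} → γ < δ → δ ≤ ε → γ < ε
    <-≤-trans = ToStrict.<-≤-trans Eq.sym Γ.trans Γ.antisym Γ.≤-respʳ-≈

    γ<⊓ : ∀ {δ ε} → γ < δ → γ < ε → γ < δ ⊓ ε
    γ<⊓ {δ} {ε} γ<δ γ<ε with ⊓-sel δ ε
    ... | inj₁ ≈δ = <-respʳ-≈ (Eq.sym ≈δ) γ<δ
    ... | inj₂ ≈ε = <-respʳ-≈ (Eq.sym ≈ε) γ<ε

  ballQuotient : ∀ γ → γ ≉ ∞ → AbelianGroup a a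
  ballQuotient γ γ≉∞ =
    subquotient G (closedBall-isSubgroup γ) (openBall-isSubgroup γ≉∞)

  -- OpenBall ∞ is empty, so the quotient only makes sense below ∞, and R m is
  -- taken to be false at ∞.
  LargeQuotient : ℕ → Pred Γ.Carrier a
  LargeQuotient m γ =
    ∃ λ (γ≉∞ : γ ≉ ∞) → MoreThan m (AbelianGroup.setoid (ballQuotient γ γ≉∞))

  largeQuotient-resp : ∀ m {γ δ} → γ ≈ δ → LargeQuotient m γ → LargeQuotient m δ
  largeQuotient-resp m γ≈δ (γ≉∞ , inj) = (λ δ≈∞ → γ≉∞ (Eq.trans γ≈δ δ≈∞)) , record
    { to        = λ i → proj₁ (to i) , Γ.≤-respˡ-≈ γ≈δ (proj₂ (to i))
    ; cong      = λ i≡j → <-respˡ-≈ γ≈δ (Injection.cong inj i≡j)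
    ; injective = λ i~j → injective (<-respˡ-≈ (Eq.sym γ≈δ) i~j)
    }
    where open Injection inj using (to; injective)

  WellDefinedAt : ℕ → Γ.Carrier → Set a
  WellDefinedAt n γ = ∃ λ δ → ∀ x → v x ≈ γ → v (n · x) ≈ δ

  IsSuccessor : Γ.Carrier → Γ.Carrier → Set a
  IsSuccessor γ δ = γ < δ × (∀ ε → γ < ε → δ ≤ ε)

  IsIteratedSuccessor : ℕ → Γ.Carrier → Γ.Carrier → Set a
  IsIteratedSuccessor zero    γ δ = γ ≈ δ
  IsIteratedSuccessor (suc k) γ δ =
    ∃ λ ε → IsSuccessor γ ε × IsIteratedSuccessor k ε δ

  -- Excluded middle decides well-definedness, which makes fₙ a total function.
  module _ (em : ExcludedMiddle a) where

    f⟨_⟩ : ℕ → Γ.Carrier → Γ.Carrier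
    f⟨ n ⟩ γ with em {P = WellDefinedAt n γ}
    ... | yes (δ , _) = δ
    ... | no  _       = ∞

    f-cong : ∀ n {γ γ′} → γ ≈ γ′ → f⟨ n ⟩ γ ≈ f⟨ n ⟩ γ′
    f-cong n {γ} {γ′} γ≈γ′
      with em {P = WellDefinedAt n γ} | em {P = WellDefinedAt n γ′}
    ... | no _ | no _ = Eq.refl
    ... | no ¬w | yes (δ , w) =
      ⊥-elim (¬w (δ , λ x vx≈γ → w x (Eq.trans vx≈γ γ≈γ′)))
    ... | yes (δ , w) | no ¬w =
      ⊥-elim (¬w (δ , λ x vx≈γ′ → w x (Eq.trans vx≈γ′ (Eq.sym γ≈γ′))))
    ... | yes (δ , w) | yes (δ′ , w′) =
      Eq.trans (Eq.sym (w x vx≈γ)) (w′ x (Eq.trans vx≈γ γ≈γ′))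
      where
      x    = proj₁ (surjective γ)
      vx≈γ = proj₂ (surjective γ) G.refl

    valueStructure : Structure 𝓛v a
    valueStructure = record
      { Dom      = λ _ → valueSetoid
      ; fun      = λ { (f n) (γ ∷ []) → f⟨ n ⟩ γ }
      ; fun-cong = λ { (f n) {_ ∷ []} {_ ∷ []} eq → f-cong n (eq (here ≡.refl)) }
      ; rel      = λ { leq   (γ ∷ δ ∷ []) → γ ≤ δ
                     ; (R m) (γ ∷ [])     → LargeQuotient m γ }
      ; rel-resp = λ { leq {_ ∷ _ ∷ []} {_ ∷ _ ∷ []} eq →
                         Γ.≤-respˡ-≈ (eq (here ≡.refl)) ∘
                         Γ.≤-respʳ-≈ (eq (there (here ≡.refl)))
                     ; (R m) {_ ∷ []} {_ ∷ []} eq →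
                         largeQuotient-resp m (eq (here ≡.refl)) }
      }

    IsMinimalValueSet : Set a
    IsMinimalValueSet = Minimal valueStructure tt

    record IsEventuallyRightShift (p : ℕ) : Set (lsuc a) where
      field
        I           : Pred Γ.Carrier a
        initial     : ∀ {γ δ} → γ ≤ δ → I δ → I γ
        cofinite    : Finite valueSetoid (∁ I)
        wellDefined : ∀ {γ} → I γ → WellDefinedAt p γ
        steps       : ℕ
        steps≥1     : 1 ℕ.≤ steps
        shift       : ∀ {γ} → I γ → IsIteratedSuccessor steps γ (f⟨ p ⟩ γ)
        isomorphism : IsIsomorphismOntoImage valueStructure (λ _ → I) (λ _ → f⟨ p ⟩)

-- If Γ has order type ω* and v has finite fibres, the position of v x in Γ is
-- a norm on G with values in ℕ, finite balls and ‖ x - y ‖ ≤ ‖ x ‖ ⊔ ‖ y ‖.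
-- Both directions go through a condition on this norm: for each m the relation
-- R m is eventually constant, and each integer either kills G or is onto and
-- lowers large norms by a constant.
--
-- Under this condition G and Γ are minimal by a back-and-forth argument. Two
-- tuples of G are related when corresponding bounded integer combinations of
-- them (together with fixed small elements) have norms at the same distances
-- up to truncation. Given a further y, let w be a best approximation of y by
-- combinations. If slightly deeper combinations come closer to y, then y
-- looks like such a combination. Otherwise y - w is independent of the
-- combinations, and a matching independent element exists on the other side
-- since R m counts residues.
--
-- Conversely let G be minimal. A definable subgroup is finite or G, since the
-- cosets of a proper subgroup lie in its complement; hence balls are finite
-- and Γ is ω*. If G is not elementary abelian it is divisible with finite
-- n-torsion. If it has p-torsion, then ‖ p x ‖ < ‖ x ‖ for all x of large
-- norm, whereas ‖ p x ‖ = ‖ x ‖ when qᵏ x = 0 for a prime q ≠ p; so G is a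
-- p-group, and is exhausted by one Prüfer group after another. The set of x
-- at which ‖ p x ‖ is monotone in ‖ x ‖ is definable and infinite, hence
-- cofinite, so that ‖ x ‖ - ‖ p x ‖ is eventually a non-increasing function
-- of ‖ x ‖, hence constant.
module Submission where

open import Defs
open import Algebra.Bundles using (AbelianGroup)
import Algebra.Construct.NaturalChoice.Min as NaturalMin
import Algebra.Construct.Pointwise as Pointwise
open import Algebra.Morphism.Structures using (module GroupMorphisms)
import Algebra.Properties.AbelianGroup as AbelianGroupProperties
import Algebra.Properties.CommutativeMonoid.Mult as CommutativeMonoidMult
import Algebra.Properties.CommutativeSemigroup as CommutativeSemigroupProperties
import Algebra.Solver.CommutativeMonoid.Normal as CommutativeMonoidNormal
open import Axiom.ExcludedMiddle using (ExcludedMiddle)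
open import Data.Empty using (⊥; ⊥-elim)
open import Data.Fin.Base as Fin using (Fin)
import Data.Fin.Properties as Fin
open import Data.Integer.Base as ℤ using (ℤ; +_)
open import Data.Integer.DivMod using (_%ℕ_; _/ℕ_; a≡a%ℕn+[a/ℕn]*n)
import Data.Integer.Properties as ℤ
open import Data.List.Base using (List; []; _∷_; _++_; cartesianProductWith; length; lookup; map)
open import Data.List.Membership.Propositional using (_∈_; find)
open import Data.List.Membership.Propositional.Properties using (∈-map⁺; ∈-map⁻)
import Data.List.Membership.Setoid.Properties as ∈ₛ
open import Data.List.Properties using (length-map)
open import Data.List.Relation.Unary.Any as Any using (Any; here; there; index)
import Data.List.Relation.Unary.Any.Properties as Any
open import Data.List.Relation.Unary.Any.Properties using (++⁺ˡ; ++⁺ʳ; lookup-index)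
open import Data.Nat.Base
open import Data.Nat.Coprimality using (Coprime; coprime-Bézout)
open import Data.Nat.Divisibility using (_∣_; _∣?_; divides; ∣1⇒≡1; ∣⇒≤)
open import Data.Nat.GCD using (module Bézout)
open import Data.Nat.ListAction using (product)
open import Data.Nat.Primality using (Prime; euclidsLemma; prime⇒irreducible; prime⇒nonTrivial; prime⇒nonZero; ¬prime[1])
open import Data.Nat.Primality.Factorisation using (factorise)
open import Data.Nat.Properties
open import Data.Nat.Tactic.RingSolver using (solve-∀) renaming (solve to solveℕ)
open import Data.Product.Base using (Σ; ∃; ∃₂; _×_; _,_; proj₁; proj₂; swap)
open import Data.Rational.Base as ℚ using (ℚ)
import Data.Rational.Properties as ℚ
open import Data.Rational.Unnormalised.Base as ℚᵘ using (mkℚᵘ; *≡*)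
import Data.Rational.Unnormalised.Properties as ℚᵘ
open import Data.Sum.Base using (_⊎_; inj₁; inj₂; [_,_]′)
open import Data.Unit.Base using (⊤; tt)
open import Function.Base using (_∘_; _$_; _|>_)
open import Function.Bundles using (Equivalence; Injection; _⇔_; mk⇔)
import Level
open import Relation.Binary.Bundles using (Setoid)
open import Relation.Binary.Morphism.Structures using (IsOrderIsomorphism)
open import Relation.Binary.PropositionalEquality as ≡ using (_≡_; _≢_; cong; cong₂; subst)
import Relation.Binary.Properties.TotalOrder as TotalOrderProperties
import Relation.Binary.Reasoning.Setoid as SetoidReasoning
open import Relation.Nullary using (¬_; Dec; yes; no)
open import Relation.Unary using (∁)

-- The relation on tuples must survive any number of further moves, yet hold for any two elements of
-- large norm. It is therefore graded: each move lowers the depth of the combinations, the size of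
-- the constants and the precision of the comparison. Two difficulties shape the bounds. Secondly, a
-- new element `y` occurs with coefficients other than one, but only its translates are under
-- control. The older elements are therefore kept divisible by a common multiple `K` of the
-- coefficients `m` that do not kill G: if `K = m c`, then `m y + K u = m (y + c u)`, and the outer
-- multiplication by `m` merely lowers large norms by a constant. This is why moves are divided in
-- advance by the multipliers of all rounds to come.

-- A linear inequality follows from a single instance A ≤ B, the sum of its
-- premises, and a semiring identity.
linear : ∀ k {m n A B} → A ≤ B → n + A ≡ m + B + k → m ≤ n
linear k {m} {n} {A} {B} A≤B eq = +-cancelʳ-≤ A m n (begin
  m + A     ≤⟨ +-monoʳ-≤ m A≤B ⟩
  m + B     ≤⟨ m≤m+n (m + B) k ⟩
  m + B + k ≡⟨ eq ⟨
  n + A     ∎)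
  where open ≤-Reasoning

infixl 6 _⊕_
_⊕_ : ∀ {a b c d} → a ≤ b → c ≤ d → a + c ≤ b + d
_⊕_ = +-mono-≤

-- Comparison of integers up to truncation

-- The integers a - b and a′ - b′ agree after truncation to [-S , S].
data Agree (S a a′ b b′ : ℕ) : Set where
  near  : a + b′ ≡ a′ + b → Agree S a a′ b b′
  above : b + S ≤ a → b′ + S ≤ a′ → Agree S a a′ b b′
  below : a + S ≤ b → a′ + S ≤ b′ → Agree S a a′ b b′

agree-refl : ∀ {S a b} → Agree S a a b b
agree-refl = near ≡.refl

agree-self : ∀ {S a a′} → Agree S a a′ a a′
agree-self {a = a} {a′} = near (+-comm a a′)

agree-swap : ∀ {S a a′ b b′} → Agree S a a′ b b′ → Agree S b b′ a a′
agree-swap {a = a} {a′} {b} {b′} (near eq) =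
  near (≡.trans (+-comm b a′) (≡.trans (≡.sym eq) (+-comm a b′)))
agree-swap (above p q) = below p q
agree-swap (below p q) = above p q

agree-flip : ∀ {S a a′ b b′} → Agree S a a′ b b′ → Agree S a′ a b′ b
agree-flip (near eq)   = near (≡.sym eq)
agree-flip (above p q) = above q p
agree-flip (below p q) = below q p

agree-mono : ∀ {S T a a′ b b′} → S ≤ T → Agree T a a′ b b′ → Agree S a a′ b b′
agree-mono S≤T (near eq)   = near eq
agree-mono S≤T (above p q) = above (≤-trans (+-monoʳ-≤ _ S≤T) p) (≤-trans (+-monoʳ-≤ _ S≤T) q)
agree-mono S≤T (below p q) = below (≤-trans (+-monoʳ-≤ _ S≤T) p) (≤-trans (+-monoʳ-≤ _ S≤T) q)

agree-≤ : ∀ {S a a′ b b′} → 1 ≤ S → Agree S a a′ b b′ → a ≤ b → a′ ≤ b′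
agree-≤ {S} {a} {a′} {b} {b′} S≥1 (near eq) a≤b =
  linear 0 (a≤b ⊕ ≤-reflexive (≡.sym eq)) (solveℕ (a ∷ a′ ∷ b ∷ b′ ∷ []))
agree-≤ {S} {a} {a′} {b} {b′} S≥1 (above p q) a≤b =
  ⊥-elim (n≮n b (linear 0 (S≥1 ⊕ p ⊕ a≤b) (solveℕ (S ∷ a ∷ b ∷ []))))
agree-≤ {S} {a} {a′} {b} {b′} S≥1 (below p q) a≤b = m+n≤o⇒m≤o a′ q

agree-≡ : ∀ {S a a′ b b′} → 1 ≤ S → Agree S a a′ b b′ → a ≡ b → a′ ≡ b′
agree-≡ S≥1 ag ≡.refl =
  ≤-antisym (agree-≤ S≥1 ag ≤-refl) (agree-≤ S≥1 (agree-swap ag) ≤-refl)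

agree-small : ∀ {S a a′} → Agree S a a′ 0 0 → a < S → a ≡ a′
agree-small {a = a} {a′} (near eq) _ = ≡.trans (≡.sym (+-identityʳ a)) (≡.trans eq (+-identityʳ a′))
agree-small (above p q) a<S = ⊥-elim (<⇒≱ a<S p)
agree-small {S} {a} (below p q) a<S = ⊥-elim (<⇒≱ a<S (≤-trans (m≤n+m S a) (≤-trans p z≤n)))

agree-large : ∀ {S n a a′} → n ≤ S → Agree S a a′ 0 0 → n ≤ a → n ≤ a′
agree-large {n = n} {a} {a′} n≤S (near eq) n≤a =
  subst (n ≤_) (≡.trans (≡.sym (+-identityʳ a)) (≡.trans eq (+-identityʳ a′))) n≤a
agree-large n≤S (above p q) n≤a = ≤-trans n≤S q
agree-large {S} n≤S (below p q) n≤a = ≤-trans n≤S (≤-trans (m≤n+m S _) (≤-trans q z≤n))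

agree-resp : ∀ {S a a′ b b′ c c′ d d′} → a ≡ b → a′ ≡ b′ → c ≡ d → c′ ≡ d′ →
             Agree S b b′ d d′ → Agree S a a′ c c′
agree-resp ≡.refl ≡.refl ≡.refl ≡.refl ag = ag

agree-⊔ : ∀ {S a a′ b b′ c c′} → 1 ≤ S → Agree S a a′ b b′ →
          Agree S a a′ c c′ → Agree S b b′ c c′ → Agree S (a ⊔ b) (a′ ⊔ b′) c c′
agree-⊔ {a = a} {a′} {b} {b′} S≥1 ab ac bc with ≤-total a b
... | inj₁ a≤b rewrite m≤n⇒m⊔n≡n a≤b | m≤n⇒m⊔n≡n (agree-≤ S≥1 ab a≤b) = bc
... | inj₂ b≤a rewrite m≥n⇒m⊔n≡m b≤a | m≥n⇒m⊔n≡m (agree-≤ S≥1 (agree-swap ab) b≤a) = ac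

-- m and m′ are a and a′ displaced by j - o, and n and n′ are b and b′
-- displaced by l - q.
agree-shift : ∀ {S O a a′ b b′} {m m′ n n′} o j q l →
  m + o ≡ a + j → m′ + o ≡ a′ + j → n + q ≡ b + l → n′ + q ≡ b′ + l →
  o ≤ O → j ≤ O → q ≤ O → l ≤ O →
  Agree (S + (O + O)) a a′ b b′ → Agree S m m′ n n′
agree-shift {S} {O} {a} {a′} {b} {b′} {m} {m′} {n} {n′} o j q l e₁ e₂ e₃ e₄ o≤ j≤ q≤ l≤ = λ
  { (near eq)   → near (≤-antisym
      (linear 0 (≤-reflexive e₁ ⊕ ≤-reflexive (≡.sym e₂) ⊕ ≤-reflexive (≡.sym e₃) ⊕ ≤-reflexive e₄ ⊕
          ≤-reflexive eq)
        (solveℕ (a ∷ a′ ∷ b ∷ b′ ∷ m ∷ m′ ∷ n ∷ n′ ∷ o ∷ j ∷ q ∷ l ∷ [])))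
      (linear 0 (≤-reflexive (≡.sym e₁) ⊕ ≤-reflexive e₂ ⊕ ≤-reflexive e₃ ⊕ ≤-reflexive (≡.sym e₄) ⊕
          ≤-reflexive (≡.sym eq))
        (solveℕ (a ∷ a′ ∷ b ∷ b′ ∷ m ∷ m′ ∷ n ∷ n′ ∷ o ∷ j ∷ q ∷ l ∷ []))))
  ; (above p p′) → above (apart e₁ e₃ p) (apart e₂ e₄ p′)
  ; (below p p′) → below (apart′ e₁ e₃ p) (apart′ e₂ e₄ p′)
  }
  where
  apart : ∀ {a b m n} → m + o ≡ a + j → n + q ≡ b + l → b + (S + (O + O)) ≤ a → n + S ≤ m
  apart {a} {b} {m} {n} e₁ e₃ p =
    linear (j + q) (≤-reflexive (≡.sym e₁) ⊕ ≤-reflexive e₃ ⊕ p ⊕ o≤ ⊕ l≤)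
      (solveℕ (a ∷ b ∷ m ∷ n ∷ o ∷ j ∷ q ∷ l ∷ S ∷ O ∷ []))
  apart′ : ∀ {a b m n} → m + o ≡ a + j → n + q ≡ b + l → a + (S + (O + O)) ≤ b → m + S ≤ n
  apart′ {a} {b} {m} {n} e₁ e₃ p =
    linear (l + o) (≤-reflexive e₁ ⊕ ≤-reflexive (≡.sym e₃) ⊕ p ⊕ q≤ ⊕ j≤)
      (solveℕ (a ∷ b ∷ m ∷ n ∷ o ∷ j ∷ q ∷ l ∷ S ∷ O ∷ []))

-- Multiplication by a scalar moves large norms by a constant, and small norms are displaced from 0,
-- so what has to be compared are common displacements of entries already known to agree. Comparing
-- two of them costs `O + O` of precision.
data Displaced {ℓ} (O : ℕ) (P : ℕ → ℕ → Set ℓ) (m m′ : ℕ) : Set ℓ where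
  displaced : ∀ {e e′} o j → P e e′ → m + o ≡ e + j → m′ + o ≡ e′ + j → o ≤ O → j ≤ O →
              Displaced O P m m′

displaced-agree : ∀ {ℓ O S} {P : ℕ → ℕ → Set ℓ} →
  (∀ {b b′ c c′} → P b b′ → P c c′ → Agree (S + (O + O)) b b′ c c′) →
  ∀ {m m′ n n′} → Displaced O P m m′ → Displaced O P n n′ → Agree S m m′ n n′
displaced-agree ag (displaced o j p e₁ e₂ o≤ j≤) (displaced q l p′ e₃ e₄ q≤ l≤) =
  agree-shift o j q l e₁ e₂ e₃ e₄ o≤ j≤ q≤ l≤ (ag p p′)

displaced-mono : ∀ {ℓ O O′} {P : ℕ → ℕ → Set ℓ} {m m′} → O ≤ O′ → Displaced O P m m′ →
    Displaced O′ P m m′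
displaced-mono O≤ (displaced o j p e₁ e₂ o≤ j≤) = displaced o j p e₁ e₂ (≤-trans o≤ O≤)
    (≤-trans j≤ O≤)

module _ (em : ∀ {ℓ} → ExcludedMiddle ℓ) where

  least : ∀ {ℓ} (P : ℕ → Set ℓ) → ∃ P → ∃ λ n → P n × (∀ m → P m → n ≤ m)
  least P (n , Pn) = go n 0 (+-identityʳ n) (λ _ _ → z≤n)
    where
    go : ∀ k i → k + i ≡ n → (∀ m → P m → i ≤ m) → ∃ λ n → P n × (∀ m → P m → n ≤ m)
    go zero    i ≡.refl lb = i , Pn , lb
    go (suc k) i eq   lb with em {P = P i}
    ... | yes Pi = i , Pi , lb
    ... | no ¬Pi = go k (suc i) (≡.trans (+-suc k i) eq)
      (λ m Pm → ≤∧≢⇒< (lb m Pm) (λ { ≡.refl → ¬Pi Pm }))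

  greatest : ∀ {ℓ} (P : ℕ → Set ℓ) b → (∀ m → P m → m ≤ b) → ∃ P →
             ∃ λ n → P n × (∀ m → P m → m ≤ n)
  greatest P b bound (n , Pn)
    with j , (j≤b , Pb∸j) , min ← least (λ j → j ≤ b × P (b ∸ j))
           (b ∸ n , m∸n≤m b n , subst P (≡.sym (m∸[m∸n]≡n (bound n Pn))) Pn)
    = b ∸ j , Pb∸j , λ m Pm →
      linear 0 (min (b ∸ m) (m∸n≤m b m , subst P (≡.sym (m∸[m∸n]≡n (bound m Pm))) Pm)
                ⊕ ≤-reflexive (≡.sym (m+[n∸m]≡n j≤b)) ⊕ ≤-reflexive (m+[n∸m]≡n (bound m Pm)))
             (identity (b ∸ j) (b ∸ m) m j b)
    where
    identity : ∀ u w m j b → u + (j + b + (m + w)) ≡ m + (w + (j + u) + b) + 0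
    identity u w m j b = solveℕ (u ∷ w ∷ m ∷ j ∷ b ∷ [])

  -- The back-and-forth property of discrete linear orders with a first element.
  agree-extend : ∀ {ℓ} (P : ℕ → ℕ → Set ℓ) S → 1 ≤ S → P 0 0 →
    (∀ {b b′ c c′} → P b b′ → P c c′ → Agree (S + (S + S)) b b′ c c′) →
    ∀ e → ∃ λ e′ → ∀ {c c′} → P c c′ → Agree S e e′ c c′
  agree-extend P S S≥1 P00 ag e with em {P = ∃₂ λ b b′ → P b b′ × b ≤ e × e ≤ b + S}
  ... | yes (b , b′ , Pb , b≤e , e≤b+S) = b′ + (e ∸ b) , λ {c} {c′} Pc →
    agree-shift 0 (e ∸ b) 0 0 (≡.trans (+-identityʳ e) (≡.sym (m+[n∸m]≡n b≤e)))
      (+-identityʳ _) ≡.refl ≡.refl z≤n (m≤n+o⇒m∸n≤o e b e≤b+S) z≤n z≤n (ag Pb Pc)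
  ... | no ¬below with em {P = ∃₂ λ b b′ → P b b′ × e ≤ b × b ≤ e + S}
  ...   | yes (b , b′ , Pb , e≤b , b≤e+S) = b′ ∸ (b ∸ e) , λ {c} {c′} Pc →
    agree-shift (b ∸ e) 0 0 0 (≡.trans (m+[n∸m]≡n e≤b) (≡.sym (+-identityʳ b)))
      (≡.trans (m∸n+n≡m (agree-large (≤-trans x≤S (m≤m+n S _)) (ag Pb P00) (m∸n≤m b e)))
             (≡.sym (+-identityʳ b′)))
      ≡.refl ≡.refl x≤S z≤n z≤n z≤n (ag Pb Pc)
    where
    x≤S : b ∸ e ≤ S
    x≤S = m≤n+o⇒m∸n≤o b e b≤e+S
  ...   | no ¬above with greatest (λ b → (∃ λ b′ → P b b′) × b ≤ e) e (λ _ → proj₂) (0 , (0 , P00) ,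
      z≤n)
  -- Here `e` is more than `S` away from every entry, so its exact place in the gap is irrelevant.
  -- The gap from `b` to any later entry exceeds `S + S`, and the precision `S + (S + S)` shows that
  -- the gap on the other side is at least `S + S`, which leaves room for `b′ + S`.
  ...     | b , ((b′ , Pb) , b≤e) , max = b′ + S , λ {c} {c′} Pc → far Pc (ag Pb Pc)
    where
    b+S<e : b + S < e
    b+S<e = ≰⇒> (λ e≤b+S → ¬below (b , b′ , Pb , b≤e , e≤b+S))

    far : ∀ {c c′} → P c c′ → Agree (S + (S + S)) b b′ c c′ → Agree S e (b′ + S) c c′
    far {c} {c′} Pc bc with ≤-total c e
    ... | inj₁ c≤e = above
      (≤-trans (+-monoˡ-≤ S (max c ((c′ , Pc) , c≤e))) (<⇒≤ b+S<e))
      (+-monoˡ-≤ S (agree-≤ (≤-trans S≥1 (m≤m+n S _)) (agree-swap bc) (max c ((c′ , Pc) , c≤e))))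
    ... | inj₂ e≤c = below (<⇒≤ e+S<c) (gap bc)
      where
      e+S<c : e + S < c
      e+S<c = ≰⇒> (λ c≤e+S → ¬above (c , c′ , Pc , e≤c , c≤e+S))
      gap : ∀ {b′ c′} → Agree (S + (S + S)) b b′ c c′ → b′ + S + S ≤ c′
      gap {b′} {c′} (near eq) = linear 2 (≤-reflexive (≡.sym eq) ⊕ b+S<e ⊕ e+S<c)
        (solveℕ (b ∷ b′ ∷ c ∷ c′ ∷ S ∷ e ∷ []))
      gap (above p _) = ⊥-elim (n≮n c (linear (1 + (S + S) + (S + (S + S))) (p ⊕ b+S<e ⊕ e+S<c)
        (solveℕ (b ∷ c ∷ S ∷ e ∷ []))))
      gap {b′} {c′} (below _ q) = linear S q (solveℕ (b′ ∷ c′ ∷ S ∷ []))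

open import Data.List.Relation.Unary.All as All using (All; []; _∷_)
open import Data.Vec.Base as Vec using (Vec; []; _∷_)

-- Identities in abelian groups and multiples by natural numbers

module AbelianGroupSolver {c ℓ} (G : AbelianGroup c ℓ) where
  open AbelianGroup G
  open AbelianGroupProperties G
  open CommutativeSemigroupProperties commutativeSemigroup using (interchange)
  private module CM = CommutativeMonoidNormal commutativeMonoid
  open SetoidReasoning setoid

  infixl 6 _⊞_ _⊟_
  infix  8 ⊖_

  data Expr (n : ℕ) : Set where
    var : Fin n → Expr n
    0ᵉ  : Expr n
    _⊞_ : Expr n → Expr n → Expr n
    ⊖_  : Expr n → Expr n

  _⊟_ : ∀ {n} → Expr n → Expr n → Expr n
  e ⊟ h = e ⊞ (⊖ h)

  x₀ : ∀ {n} → Expr (1 + n)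
  x₀ = var Fin.zero
  x₁ : ∀ {n} → Expr (2 + n)
  x₁ = var (Fin.suc Fin.zero)
  x₂ : ∀ {n} → Expr (3 + n)
  x₂ = var (Fin.suc (Fin.suc Fin.zero))
  x₃ : ∀ {n} → Expr (4 + n)
  x₃ = var (Fin.suc (Fin.suc (Fin.suc Fin.zero)))

  ⟦_⟧ : ∀ {n} → Expr n → Vec Carrier n → Carrier
  ⟦ var i ⟧ ρ = Vec.lookup ρ i
  ⟦ 0ᵉ ⟧    ρ = ε
  ⟦ e ⊞ h ⟧ ρ = ⟦ e ⟧ ρ ∙ ⟦ h ⟧ ρ
  ⟦ ⊖ e ⟧   ρ = ⟦ e ⟧ ρ ⁻¹

  positive negative : ∀ {n} → Expr n → CM.Expr n
  positive (var i) = CM.var i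
  positive 0ᵉ      = CM.id
  positive (e ⊞ h) = positive e CM.⊕ positive h
  positive (⊖ e)   = negative e
  negative (var i) = CM.id
  negative 0ᵉ      = CM.id
  negative (e ⊞ h) = negative e CM.⊕ negative h
  negative (⊖ e)   = positive e

  split : ∀ {n} (e : Expr n) ρ → ⟦ e ⟧ ρ ∙ CM.⟦ negative e ⟧ ρ ≈ CM.⟦ positive e ⟧ ρ
  split (var i) ρ = identityʳ _
  split 0ᵉ      ρ = identityʳ _
  split (e ⊞ h) ρ = trans (interchange _ _ _ _) (∙-cong (split e ρ) (split h ρ))
  split (⊖ e)   ρ = begin
    ⟦ e ⟧ ρ ⁻¹ ∙ CM.⟦ positive e ⟧ ρ               ≈⟨ ∙-congˡ (split e ρ) ⟨
    ⟦ e ⟧ ρ ⁻¹ ∙ (⟦ e ⟧ ρ ∙ CM.⟦ negative e ⟧ ρ)   ≈⟨ \\-leftDividesʳ _ _ ⟩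
    CM.⟦ negative e ⟧ ρ                            ∎

  -- Moving all inverted terms to the other side turns an identity between differences into one
  -- between sums, which the normal form for commutative monoids decides.
  solve : ∀ {n} ρ (e h : Expr n) →
          CM.normalise (positive e CM.⊕ negative h) ≡ CM.normalise (positive h CM.⊕ negative e) →
          ⟦ e ⟧ ρ ≈ ⟦ h ⟧ ρ
  solve ρ e h eq = ∙-cancelʳ (CM.⟦ negative e ⟧ ρ ∙ CM.⟦ negative h ⟧ ρ) _ _ (begin
    ⟦ e ⟧ ρ ∙ (CM.⟦ negative e ⟧ ρ ∙ CM.⟦ negative h ⟧ ρ)  ≈⟨ assoc _ _ _ ⟨
    ⟦ e ⟧ ρ ∙ CM.⟦ negative e ⟧ ρ ∙ CM.⟦ negative h ⟧ ρ    ≈⟨ ∙-congʳ (split e ρ) ⟩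
    CM.⟦ positive e CM.⊕ negative h ⟧ ρ                    ≈⟨
        CM.correct (positive e CM.⊕ negative h) ρ ⟨
    CM.⟦ CM.normalise (positive e CM.⊕ negative h) ⟧⇓ ρ    ≡⟨ ≡.cong (λ v → CM.⟦ v ⟧⇓ ρ) eq ⟩
    CM.⟦ CM.normalise (positive h CM.⊕ negative e) ⟧⇓ ρ    ≈⟨
        CM.correct (positive h CM.⊕ negative e) ρ ⟩
    CM.⟦ positive h CM.⊕ negative e ⟧ ρ                    ≈⟨ ∙-congʳ (split h ρ) ⟨
    ⟦ h ⟧ ρ ∙ CM.⟦ negative h ⟧ ρ ∙ CM.⟦ negative e ⟧ ρ    ≈⟨ assoc _ _ _ ⟩
    ⟦ h ⟧ ρ ∙ (CM.⟦ negative h ⟧ ρ ∙ CM.⟦ negative e ⟧ ρ)  ≈⟨ ∙-congˡ (comm _ _) ⟩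
    ⟦ h ⟧ ρ ∙ (CM.⟦ negative e ⟧ ρ ∙ CM.⟦ negative h ⟧ ρ)  ∎)

module Multiples {c ℓ} (G : AbelianGroup c ℓ) where
  open AbelianGroup G
  open AbelianGroupProperties G
  open CommutativeMonoidMult commutativeMonoid public renaming (_×_ to _·_)
  open AbelianGroupSolver G
  open SetoidReasoning setoid

  ×-ε : ∀ n → n · ε ≈ ε
  ×-ε zero    = refl
  ×-ε (suc n) = trans (identityˡ _) (×-ε n)

  ×-⁻¹ : ∀ n x → n · (x ⁻¹) ≈ (n · x) ⁻¹
  ×-⁻¹ n x = inverseˡ-unique _ _ (begin
    n · (x ⁻¹) ∙ n · x ≈⟨ ×-distrib-+ (x ⁻¹) x n ⟨
    n · (x ⁻¹ ∙ x)     ≈⟨ ×-congʳ n (inverseˡ x) ⟩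
    n · ε              ≈⟨ ×-ε n ⟩
    ε                  ∎)

  ×-distrib-- : ∀ n x y → n · (x - y) ≈ n · x - n · y
  ×-distrib-- n x y = trans (×-distrib-+ x (y ⁻¹) n) (∙-congˡ (×-⁻¹ n y))

  ×-comm : ∀ m n x → m · (n · x) ≈ n · (m · x)
  ×-comm m n x = begin
    m · (n · x)   ≈⟨ ×-assocˡ x m n ⟩
    (m * n) · x   ≡⟨ ≡.cong (_· x) (*-comm m n) ⟩
    (n * m) · x   ≈⟨ ×-assocˡ x n m ⟨
    n · (m · x)   ∎

  Kills Onto : ℕ → Set (c Level.⊔ ℓ)
  Kills n = ∀ x → n · x ≈ ε
  Onto n  = ∀ x → ∃ λ y → n · y ≈ x

  onto-* : ∀ {b c} → Onto b → Onto c → Onto (b * c)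
  onto-* {b} {c} bG cG x with y , by≈x ← bG x | z , cz≈y ← cG (proj₁ (bG x)) =
    z , trans (sym (×-assocˡ z b c)) (trans (×-congʳ b cz≈y) by≈x)

  onto-1 : Onto 1
  onto-1 x = x , ×-homo-1 x

-- Ultranorms and approximation by combinations

record UltraNorm {a} (G : AbelianGroup a a) : Set a where
  open AbelianGroup G
  field
    ‖_‖        : Carrier → ℕ
    ‖‖-cong    : ∀ {x y} → x ≈ y → ‖ x ‖ ≡ ‖ y ‖
    ‖ε‖        : ‖ ε ‖ ≡ 0
    ‖‖≡0       : ∀ {x} → ‖ x ‖ ≡ 0 → x ≈ ε
    ‖‖-minus   : ∀ x y → ‖ x - y ‖ ≤ ‖ x ‖ ⊔ ‖ y ‖
    surjective : ∀ n → ∃ λ x → ‖ x ‖ ≡ n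
    balls      : ∀ n → Finite setoid (λ x → ‖ x ‖ ≤ n)

module UltraNormProperties {a} {G : AbelianGroup a a} (U : UltraNorm G) where
  open AbelianGroup G
  open UltraNorm U
  open AbelianGroupProperties G
  open AbelianGroupSolver G
  open Multiples G

  ‖⁻¹‖≤ : ∀ x → ‖ x ⁻¹ ‖ ≤ ‖ x ‖
  ‖⁻¹‖≤ x = subst₂′ (‖‖-cong (identityˡ _)) (≡.cong (_⊔ ‖ x ‖) ‖ε‖) (‖‖-minus ε x)
    where
    subst₂′ : ∀ {m n k l} → m ≡ n → k ≡ l → m ≤ k → n ≤ l
    subst₂′ ≡.refl ≡.refl p = p

  ‖⁻¹‖ : ∀ x → ‖ x ⁻¹ ‖ ≡ ‖ x ‖
  ‖⁻¹‖ x = ≤-antisym (‖⁻¹‖≤ x)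
    (subst (_≤ ‖ x ⁻¹ ‖) (‖‖-cong (⁻¹-involutive x)) (‖⁻¹‖≤ (x ⁻¹)))

  ‖‖-plus : ∀ x y → ‖ x ∙ y ‖ ≤ ‖ x ‖ ⊔ ‖ y ‖
  ‖‖-plus x y = ≤-trans (≤-reflexive (‖‖-cong (∙-congˡ (sym (⁻¹-involutive y)))))
    (≤-trans (‖‖-minus x (y ⁻¹)) (≤-reflexive (cong (‖ x ‖ ⊔_) (‖⁻¹‖ y))))

  ‖‖-minus-≤ : ∀ {n x y} → ‖ x ‖ ≤ n → ‖ y ‖ ≤ n → ‖ x - y ‖ ≤ n
  ‖‖-minus-≤ p q = ≤-trans (‖‖-minus _ _) (⊔-lub p q)

  ‖‖-minus-< : ∀ {n x y} → ‖ x ‖ < n → ‖ y ‖ < n → ‖ x - y ‖ < n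
  ‖‖-minus-< p q = ≤-<-trans (‖‖-minus _ _) (⊔-lub p q)

  ‖‖-plus-≤ : ∀ {n x y} → ‖ x ‖ ≤ n → ‖ y ‖ ≤ n → ‖ x ∙ y ‖ ≤ n
  ‖‖-plus-≤ p q = ≤-trans (‖‖-plus _ _) (⊔-lub p q)

  ‖‖-· : ∀ c x → ‖ c · x ‖ ≤ ‖ x ‖
  ‖‖-· zero    x = subst (_≤ ‖ x ‖) (≡.sym ‖ε‖) z≤n
  ‖‖-· (suc c) x = ‖‖-plus-≤ ≤-refl (‖‖-· c x)

  -- Of the three norms `‖ x ‖`, `‖ y ‖`, `‖ x - y ‖` the greatest is attained at least twice.
  ‖‖-dominant : ∀ {x y} → ‖ x - y ‖ < ‖ x ‖ → ‖ y ‖ ≡ ‖ x ‖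
  ‖‖-dominant {x} {y} x-y<x = ≤-antisym
    (subst (_≤ ‖ x ‖) (‖‖-cong (solve (x ∷ y ∷ []) (x₀ ⊟ (x₀ ⊟ x₁)) x₁ ≡.refl))
      (‖‖-minus-≤ ≤-refl (<⇒≤ x-y<x)))
    (≮⇒≥ λ y<x → n≮n _ (subst (_< ‖ x ‖)
      (‖‖-cong (solve (x ∷ y ∷ []) (x₀ ⊟ x₁ ⊟ (⊖ x₁)) x₀ ≡.refl))
      (‖‖-minus-< x-y<x (subst (_< ‖ x ‖) (≡.sym (‖⁻¹‖ y)) y<x))))

  absorb : ∀ {x y} → ‖ y ‖ < ‖ x ‖ → ‖ x ∙ y ‖ ≡ ‖ x ‖
  absorb {x} {y} y<x = ‖‖-dominant (subst (_< ‖ x ‖) (≡.trans (≡.sym (‖⁻¹‖ y))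
    (‖‖-cong (solve (x ∷ y ∷ []) (⊖ x₁) (x₀ ⊟ (x₀ ⊞ x₁)) ≡.refl))) y<x)

  -- Since `u` is `z ∙ u` minus `z`, a norm of `z ∙ u` that does not fall below `‖ z ‖` also bounds
  -- `‖ u ‖`.
  ‖‖-independent : ∀ {z u} → ‖ z ‖ ≤ ‖ z ∙ u ‖ → ‖ z ∙ u ‖ ≡ ‖ z ‖ ⊔ ‖ u ‖
  ‖‖-independent {z} {u} z≤zu = ≤-antisym (‖‖-plus z u) (⊔-lub z≤zu
    (subst (_≤ ‖ z ∙ u ‖) (‖‖-cong (solve (z ∷ u ∷ []) (x₀ ⊞ x₁ ⊟ x₀) x₁ ≡.refl))
      (‖‖-minus-≤ ≤-refl z≤zu)))

  -- Counterpart of R m; unlike R m it also holds at n = 0, i.e. at ∞.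
  Wide : ℕ → ℕ → Set a
  Wide m n = ∃ λ (F : Fin (suc m) → Carrier) →
    (∀ i → ‖ F i ‖ ≤ n) × (∀ {i j} → i ≢ j → n ≤ ‖ F i - F j ‖)

  WideStable : Set a
  WideStable = ∀ m → ∃ λ N → ∀ {n n′} → N ≤ n → N ≤ n′ → Wide m n → Wide m n′

module Approximation (em : ∀ {ℓ} → ExcludedMiddle ℓ) {a} {G : AbelianGroup a a} (U : UltraNorm G) where
  open AbelianGroup G
  open UltraNorm U
  open UltraNormProperties U
  open AbelianGroupProperties G
  open AbelianGroupSolver G
  open Multiples G

  Pairs : Set a
  Pairs = List (Carrier × Carrier)

  -- Pairs of corresponding combinations of depth ≤ i of the entries of X and
  -- of constants of norm ≤ M.
  data W (X : Pairs) (M : ℕ) : ℕ → Carrier → Carrier → Set a where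
    gen  : ∀ {i x x′} → (x , x′) ∈ X → W X M i x x′
    con  : ∀ {i h} → ‖ h ‖ ≤ M → W X M i h h
    sub  : ∀ {i x x′ y y′} → W X M i x x′ → W X M i y y′ → W X M (suc i) (x - y) (x′ - y′)
    resp : ∀ {i x x′ y y′} → x ≈ y → x′ ≈ y′ → W X M i x x′ → W X M i y y′

  W-mono : ∀ {X M N i j x x′} → M ≤ N → i ≤ j → W X M i x x′ → W X N j x x′
  W-mono M≤N i≤j (gen x∈X)       = gen x∈X
  W-mono M≤N i≤j (con h≤M)       = con (≤-trans h≤M M≤N)
  W-mono M≤N (s≤s i≤j) (sub p q) = sub (W-mono M≤N i≤j p) (W-mono M≤N i≤j q)
  W-mono M≤N i≤j (resp e e′ p)   = resp e e′ (W-mono M≤N i≤j p)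

  W-lift : ∀ {X M i j x x′} → i ≤ j → W X M i x x′ → W X M j x x′
  W-lift = W-mono ≤-refl

  W-flip : ∀ {X M i x x′} → W X M i x x′ → W (map swap X) M i x′ x
  W-flip (gen x∈X)     = gen (∈-map⁺ swap x∈X)
  W-flip (con h≤M)     = con h≤M
  W-flip (sub p q)     = sub (W-flip p) (W-flip q)
  W-flip (resp e e′ p) = resp e′ e (W-flip p)

  W-ε : ∀ {X M i} → W X M i ε ε
  W-ε = con (subst (_≤ _) (≡.sym ‖ε‖) z≤n)

  W-⁻¹ : ∀ {X M i x x′} → W X M i x x′ → W X M (suc i) (x ⁻¹) (x′ ⁻¹)
  W-⁻¹ p = resp (identityˡ _) (identityˡ _) (sub W-ε p)

  W-∙ : ∀ {X M i x x′ y y′} → W X M i x x′ → W X M i y y′ → W X M (2 + i) (x ∙ y) (x′ ∙ y′)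
  W-∙ {i = i} p q = resp (∙-congˡ (⁻¹-involutive _)) (∙-congˡ (⁻¹-involutive _))
    (sub (W-lift (n≤1+n i) p) (W-⁻¹ q))

  W-· : ∀ {X M i x x′} c → W X M i x x′ → W X M (c * 2 + i) (c · x) (c · x′)
  W-· zero            p = W-ε
  W-· {i = i} (suc c) p = W-∙ (W-lift (m≤n+m i (c * 2)) p) (W-· c p)

  -- Counts the representatives in `cover`: at depth 0 the entries and `ε`, which stands for all
  -- constants; at each further depth also the differences of the earlier ones.
  size : ℕ → ℕ → ℕ
  size k zero    = suc k
  size k (suc i) = size k i + size k i * size k i

  -- The number of combinations modulo the constants does not depend on M.
  cover : ∀ X M i → Σ (Fin (size (length X) i) → Carrier) λ c →
          ∀ {x x′} → W X M i x x′ → ∃ λ j → ‖ x - c j ‖ ≤ M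
  cover X M zero = c , bound
    where
    c : Fin (suc (length X)) → Carrier
    c Fin.zero    = ε
    c (Fin.suc j) = proj₁ (lookup X j)
    bound : ∀ {x x′} → W X M 0 x x′ → ∃ λ j → ‖ x - c j ‖ ≤ M
    bound (gen {x = x} x∈X) = Fin.suc (index x∈X) ,
      subst (_≤ M) (≡.trans (≡.sym ‖ε‖) (‖‖-cong (sym (trans
        (∙-congˡ (⁻¹-cong (reflexive (cong proj₁ (≡.sym (lookup-index x∈X)))))) (inverseʳ x))))) z≤n
    bound (con {h = h} h≤M) = Fin.zero ,
      subst (_≤ M) (‖‖-cong (solve (h ∷ []) x₀ (x₀ ⊟ 0ᵉ) ≡.refl)) h≤M
    bound (resp e _ p) with j , b ← bound p =
      j , subst (_≤ M) (‖‖-cong (∙-congʳ e)) b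
  cover X M (suc i) with c , bound ← cover X M i = c′ , bound′
    where
    s = size (length X) i
    c″ : Fin s ⊎ Fin (s * s) → Carrier
    c″ (inj₁ j) = c j
    c″ (inj₂ l) = c (proj₁ (Fin.remQuot {s} s l)) - c (proj₂ (Fin.remQuot {s} s l))
    c′ : Fin (s + s * s) → Carrier
    c′ j = c″ (Fin.splitAt s j)
    old : ∀ {x x′} → W X M i x x′ → ∃ λ j → ‖ x - c′ j ‖ ≤ M
    old p with j , b ← bound p =
      j Fin.↑ˡ (s * s) , subst (λ z → ‖ _ - c″ z ‖ ≤ M) (≡.sym (Fin.splitAt-↑ˡ s j (s * s))) b
    bound′ : ∀ {x x′} → W X M (suc i) x x′ → ∃ λ j → ‖ x - c′ j ‖ ≤ M
    bound′ (gen x∈X) = old (gen x∈X)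
    bound′ (con h≤M) = old (con h≤M)
    bound′ (resp e _ p) with j , b ← bound′ p = j , subst (_≤ M) (‖‖-cong (∙-congʳ e)) b
    bound′ (sub {x = x} {y = y} p q) with j , b ← bound p | l , b′ ← bound q =
      s Fin.↑ʳ Fin.combine j l ,
      subst (λ z → ‖ (x - y) - c″ z ‖ ≤ M) (≡.sym (Fin.splitAt-↑ʳ s (s * s) (Fin.combine j l)))
      (subst (λ z → ‖ (x - y) - (c (proj₁ z) - c (proj₂ z)) ‖ ≤ M)
          (≡.sym (Fin.remQuot-combine {s} {s} j l))
      (subst (_≤ M) (‖‖-cong (solve (x ∷ y ∷ c j ∷ c l ∷ [])
        ((x₀ ⊟ x₂) ⊟ (x₁ ⊟ x₃)) ((x₀ ⊟ x₁) ⊟ (x₂ ⊟ x₃)) ≡.refl))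
      (‖‖-minus-≤ b b′)))

  AgreeOn : ∀ {ℓ} → ℕ → (Carrier → Carrier → Set ℓ) → Set (a Level.⊔ ℓ)
  AgreeOn S T = ∀ {x x′ y y′} → T x x′ → T y y′ → Agree S (‖ x ‖) (‖ x′ ‖) (‖ y ‖) (‖ y′ ‖)

  -- One number bounds the depth, the constants and the precision at once, so that a single
  -- threshold describes a position; by `W-mono` and `agree-mono` a larger number gives a stronger
  -- condition.
  Good : ℕ → Pairs → Set a
  Good n X = AgreeOn n (W X n n)

  good-flip : ∀ {n X} → Good n X → Good n (map swap X)
  good-flip {n} {X} good p q = agree-flip (good (flip p) (flip q))
    where
    swap² : ∀ Y → map swap (map swap Y) ≡ Y
    swap² []      = ≡.refl
    swap² (_ ∷ Y) = cong (_ ∷_) (swap² Y)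
    flip : ∀ {x x′} → W (map swap X) n n x x′ → W X n n x′ x
    flip p = subst (λ Y → W Y n n _ _) (swap² X) (W-flip p)

  -- Only the coefficients 0 and 1 of `y` are considered here; the others are reduced to these in
  -- `extension`, at the price of a displacement.
  data Translate (X : Pairs) (n : ℕ) (y y′ : Carrier) : Carrier → Carrier → Set a where
    old : ∀ {x x′} → W X n n x x′ → Translate X n y y′ x x′
    new : ∀ {x x′ u u′} → W X n n u u′ → x ≈ y ∙ u → x′ ≈ y′ ∙ u′ → Translate X n y y′ x x′

  module _ (stable : WideStable) where

    stableFrom : ∀ B → ∃ λ N → ∀ {m n n′} → m ≤ B → N ≤ n → N ≤ n′ → Wide m n → Wide m n′
    stableFrom zero with N , st ← stable 0 = N , λ { z≤n → st }
    stableFrom (suc B) with N , st ← stableFrom B | N′ , st′ ← stable (suc B) =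
      N ⊔ N′ , λ {m} m≤ N≤n N≤n′ → case m m≤ N≤n N≤n′
      where
      case : ∀ {n n′} m → m ≤ suc B → N ⊔ N′ ≤ n → N ⊔ N′ ≤ n′ → Wide m n → Wide m n′
      case m m≤ N≤n N≤n′ with m≤n⇒m<n∨m≡n m≤
      ... | inj₁ (s≤s m≤B) = st m≤B (m⊔n≤o⇒m≤o N N′ N≤n) (m⊔n≤o⇒m≤o N N′ N≤n′)
      ... | inj₂ ≡.refl    = st′ (m⊔n≤o⇒n≤o N N′ N≤n) (m⊔n≤o⇒n≤o N N′ N≤n′)

    -- Representatives, among the combinations, of `m` different classes of the ball of radius `δ`
    -- modulo the elements of smaller norm.
    Family : Pairs → ℕ → ℕ → ℕ → ℕ → Set a
    Family X M j δ m = ∃₂ λ (F F′ : Fin m → Carrier) → (∀ i → W X M j (F i) (F′ i)) ×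
      (∀ i → ‖ F i ‖ ≤ δ) × (∀ {i l} → i ≢ l → δ ≤ ‖ F i - F l ‖)

    -- Two members with the same representative from `cover` differ by an element of norm at most
    -- `M`, hence below `δ`, against their separation.
    family-size : ∀ {X M j δ} → M < δ → ¬ Family X M j δ (suc (size (length X) j))
    family-size {X} {M} {j} {δ} M<δ (F , F′ , WF , _ , sep)
      with c , bound ← cover X M j
      with i , l , i<l , eq ← Fin.pigeonhole ≤-refl (λ i → proj₁ (bound (WF i)))
      = <⇒≱ M<δ (≤-trans (sep (λ i≡l → Fin.<⇒≢ i<l i≡l))
          (subst (_≤ M) (‖‖-cong (solve (F i ∷ F l ∷ c _ ∷ [])
             ((x₀ ⊟ x₂) ⊟ (x₁ ⊟ x₂)) (x₀ ⊟ x₁) ≡.refl))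
           (‖‖-minus-≤ (proj₂ (bound (WF i)))
             (subst (λ b → ‖ F l - c b ‖ ≤ M) (≡.sym eq) (proj₂ (bound (WF l)))))))

    -- If the residues of W at δ′ were exhausted by W, they would correspond to
    -- residues at δ which together with z are too many.
    residue : ∀ {X M j δ δ′} z → M < δ → M < δ′ → (∀ {m} → m ≤ size (length X) j → Wide m δ →
        Wide m δ′) →
      ‖ z ‖ ≤ δ → (∀ {u u′} → W X M j u u′ → δ ≤ ‖ z ∙ u ‖) →
      (∀ {u u′} → W X M (suc j) u u′ → δ′ ≤ ‖ u′ ‖ → δ ≤ ‖ u ‖) →
      (∀ {u u′} → W X M (suc j) u u′ → ‖ u′ ‖ ≤ δ′ → ‖ u ‖ ≤ δ) →
      ∃ λ z′ → ‖ z′ ‖ ≤ δ′ × (∀ {u u′} → W X M j u u′ → δ′ ≤ ‖ z′ ∙ u′ ‖)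
    residue {X} {M} {j} {δ} {δ′} z M<δ M<δ′ wide z≤δ indep reflect≥ reflect≤
      with em {P = ∃ λ z′ → ‖ z′ ‖ ≤ δ′ × (∀ {u u′} → W X M j u u′ → δ′ ≤ ‖ z′ ∙ u′ ‖)}
    ... | yes found = found
    ... | no exhausted = ⊥-elim (family-size M<δ (families (suc (size (length X) j)) ≤-refl))
      where
      covered : ∀ z′ → ‖ z′ ‖ ≤ δ′ → ∃₂ λ u u′ → W X M j u u′ × ‖ z′ ∙ u′ ‖ < δ′
      covered z′ z′≤δ′ with em {P = ∃₂ λ u u′ → W X M j u u′ × ‖ z′ ∙ u′ ‖ < δ′}
      ... | yes c = c
      ... | no ¬c = ⊥-elim (exhausted (z′ , z′≤δ′ , λ {u} {u′} p → ≮⇒≥ λ q → ¬c (u , u′ , p , q)))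

      -- A family of `m` combinations together with `z ⁻¹` witnesses `Wide m`, which is about
      -- `suc m` elements. Carried to `δ′` and covered there by combinations, it comes back to `δ`
      -- as a family one larger. Separation is pulled back along differences, hence the hypotheses
      -- at depth `suc j`.
      families : ∀ m → m ≤ suc (size (length X) j) → Family X M j δ m
      families zero    _ = (λ ()) , (λ ()) , (λ ()) , (λ ()) , λ { {()} }
      families (suc m) (s≤s m≤) with F , F′ , WF , F≤ , sep ← families m (m≤n⇒m≤1+n m≤) =
        transfer (wide m≤ (E , E≤ , Esep))
        where
        E : Fin (suc m) → Carrier
        E Fin.zero    = z ⁻¹
        E (Fin.suc i) = F i
        E≤ : ∀ i → ‖ E i ‖ ≤ δ
        E≤ Fin.zero    = subst (_≤ δ) (≡.sym (‖⁻¹‖ z)) z≤δ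
        E≤ (Fin.suc i) = F≤ i
        Esep : ∀ {i l} → i ≢ l → δ ≤ ‖ E i - E l ‖
        Esep {Fin.zero}  {Fin.zero}  i≢l = ⊥-elim (i≢l ≡.refl)
        Esep {Fin.zero}  {Fin.suc l} i≢l = subst (δ ≤_)
          (≡.trans (≡.sym (‖⁻¹‖ _)) (‖‖-cong (⁻¹-∙-comm z (F l) |> sym))) (indep (WF l))
          where open import Function.Base using (_|>_)
        Esep {Fin.suc i} {Fin.zero}  i≢l = subst (δ ≤_)
          (‖‖-cong (solve (z ∷ F i ∷ []) (x₀ ⊞ x₁) (x₁ ⊟ (⊖ x₀)) ≡.refl)) (indep (WF i))
        Esep {Fin.suc i} {Fin.suc l} i≢l = sep (i≢l ∘ cong Fin.suc)

        transfer : Wide m δ′ → Family X M j δ (suc m)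
        transfer (Z , Z≤ , Zsep) = u , u′ , Wu ,
          (λ i → reflect≤ (W-lift (n≤1+n j) (Wu i)) (u′≤ i)) ,
          (λ {i} {l} i≢l → reflect≥ (sub (Wu i) (Wu l)) (u′sep i≢l))
          where
          u  = λ i → proj₁ (covered (Z i) (Z≤ i))
          u′ = λ i → proj₁ (proj₂ (covered (Z i) (Z≤ i)))
          Wu : ∀ i → W X M j (u i) (u′ i)
          Wu i = proj₁ (proj₂ (proj₂ (covered (Z i) (Z≤ i))))
          close : ∀ i → ‖ Z i ∙ u′ i ‖ < δ′
          close i = proj₂ (proj₂ (proj₂ (covered (Z i) (Z≤ i))))
          u′≤ : ∀ i → ‖ u′ i ‖ ≤ δ′
          u′≤ i = subst (_≤ δ′) (‖‖-cong (solve (Z i ∷ u′ i ∷ []) (x₀ ⊞ x₁ ⊟ x₀) x₁ ≡.refl))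
            (‖‖-minus-≤ (<⇒≤ (close i)) (Z≤ i))
          u′sep : ∀ {i l} → i ≢ l → δ′ ≤ ‖ u′ i - u′ l ‖
          u′sep {i} {l} i≢l = ≮⇒≥ λ lt → <⇒≱ (subst (_< δ′)
            (‖‖-cong (solve (Z i ∷ Z l ∷ u′ i ∷ u′ l ∷ [])
              (((x₀ ⊞ x₂) ⊟ (x₁ ⊞ x₃)) ⊟ (x₂ ⊟ x₃)) (x₀ ⊟ x₁) ≡.refl))
            (‖‖-minus-< (‖‖-minus-< (close i) (close l)) lt)) (Zsep i≢l)

module Extension (em : ∀ {ℓ} → ExcludedMiddle ℓ) {a} {G : AbelianGroup a a} (U : UltraNorm G)
                 (stable : UltraNormProperties.WideStable U) where
  open AbelianGroup G
  open UltraNorm U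
  open UltraNormProperties U
  open AbelianGroupProperties G
  open AbelianGroupSolver G
  open Multiples G
  open Approximation em U

  abstract
    -- All bounds depend only on `n` and the number `k` of entries: `size k j` limits the residues
    -- to be counted, `N` makes their number stable, and `S = suc M` lets agreement with 0 detect
    -- norms above `M`.
    approximate : ∀ n k → ∃ λ n′ → ∀ X → length X ≡ k → Good n′ X →
                  ∀ y → ∃ λ y′ → AgreeOn n (Translate X n y y′)
    approximate n k = n′ , extend
      where
      i₀ j i₁ N M S n′ : ℕ
      -- Depth `i₀` has room for `u ⁻¹` with `u` of depth `n`, depth `j` for `w ∙ u` with `w` of
      -- depth `i₀`, depth `i₁` for differences of two combinations of depth `j`, and depth `2 + i₁`
      -- for `v ∙ u` with `v` of depth `i₁`.
      i₀ = 2 + n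
      j  = 2 + i₀
      i₁ = suc j
      N  = proj₁ (stableFrom stable (size k j))
      M  = N ⊔ n
      S  = suc M
      n′ = (2 + i₁) + (S + (S + S))

      n≤M : n ≤ M
      n≤M = m≤n⊔m N n
      n≤S : n ≤ S
      n≤S = m≤n⇒m≤1+n n≤M
      S≤n′ : S + (S + S) ≤ n′
      S≤n′ = m≤n+m _ (2 + i₁)
      n≤i₀ : n ≤ i₀
      n≤i₀ = m≤n+m n 2

      extend : ∀ X → length X ≡ k → Good n′ X → ∀ y → ∃ λ y′ → AgreeOn n (Translate X n y y′)
      extend X ≡.refl good y = result (least em (λ m → ∃₂ λ w w′ → W X M i₀ w w′ × ‖ y - w ‖ ≡ m)
                                        (‖ y - ε ‖ , ε , ε , W-ε , ≡.refl))
        where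
        agree : AgreeOn (S + (S + S)) (W X M (2 + i₁))
        agree p q = agree-mono S≤n′ (good (enlarge p) (enlarge q))
          where
          enlarge : ∀ {x x′} → W X M (2 + i₁) x x′ → W X n′ n′ x x′
          enlarge = W-mono (≤-trans (n≤1+n M) (≤-trans (m≤m+n S _) S≤n′)) (m≤m+n (2 + i₁) _)

        agreeₙ : AgreeOn n (W X M (2 + i₁))
        agreeₙ p q = agree-mono (≤-trans n≤S (m≤m+n S _)) (agree p q)

        result : (∃ λ δ → (∃₂ λ w w′ → W X M i₀ w w′ × ‖ y - w ‖ ≡ δ) ×
                   (∀ m → (∃₂ λ w w′ → W X M i₀ w w′ × ‖ y - w ‖ ≡ m) → δ ≤ m)) →
                 ∃ λ y′ → AgreeOn n (Translate X n y y′)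
        result (δ , (w , w′ , Ww , y-w≡δ) , min)
          -- Distance 0 counts as closer even when `δ` is 0. If `δ ≤ M`, then `y - w` is itself one
          -- of the constants and distance 0 is attained; so the remaining case has `M < δ`.
          with em {P = ∃₂ λ v v′ → W X M i₁ v v′ × (‖ y - v ‖ < δ ⊎ ‖ y - v ‖ ≡ 0)}
        -- Either a deeper combination is so close to y that it can replace y ...
        ... | yes (v , v′ , Wv , closer) = v′ , λ p q → replace (represent p) (represent q)
          where
          Represented : Carrier → Carrier → Set a
          Represented x x′ = ∃₂ λ u u′ → W X M (2 + i₁) u u′ × ‖ x ‖ ≡ ‖ u ‖ × ‖ x′ ‖ ≡ ‖ u′ ‖

          δ≤y∙u : ∀ {u u′} → W X n n u u′ → δ ≤ ‖ y ∙ u ‖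
          δ≤y∙u {u} Wu = subst (δ ≤_) (‖‖-cong (∙-congˡ (⁻¹-involutive u)))
            (min _ (_ , _ , W-lift (n≤1+n (suc n)) (W-⁻¹ (W-mono n≤M ≤-refl Wu)) , ≡.refl))

          -- By the choice of `δ` no such `y ∙ u` has norm below `δ`, so changing `y` to the closer
          -- `v` does not affect the norm.
          same : ∀ {u u′} → W X n n u u′ → ‖ y ∙ u ‖ ≡ ‖ v ∙ u ‖
          same {u} Wu = case closer
            where
            y-v : ‖ y ∙ u - v ∙ u ‖ ≡ ‖ y - v ‖
            y-v = ‖‖-cong (solve (y ∷ u ∷ v ∷ []) ((x₀ ⊞ x₁) ⊟ (x₂ ⊞ x₁)) (x₀ ⊟ x₂) ≡.refl)
            case : ‖ y - v ‖ < δ ⊎ ‖ y - v ‖ ≡ 0 → ‖ y ∙ u ‖ ≡ ‖ v ∙ u ‖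
            case (inj₁ y-v<δ) = ≡.sym (‖‖-dominant
                (subst (_< ‖ y ∙ u ‖) (≡.sym y-v) (<-≤-trans y-v<δ (δ≤y∙u Wu))))
            case (inj₂ y-v≡0) = ‖‖-cong (∙-congʳ (x∙y⁻¹≈ε⇒x≈y y v (‖‖≡0 y-v≡0)))

          represent : ∀ {x x′} → Translate X n y v′ x x′ → Represented x x′
          represent (old Wx) = _ , _ , W-mono n≤M (m≤n⇒m≤o+n 7 ≤-refl) Wx , ≡.refl , ≡.refl
          represent (new {u = u} {u′} Wu x≈ x′≈) = v ∙ u , v′ ∙ u′ ,
            W-∙ Wv (W-mono n≤M (m≤n⇒m≤o+n 5 ≤-refl) Wu) ,
            ≡.trans (‖‖-cong x≈) (same Wu) , ‖‖-cong x′≈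

          replace : ∀ {x x′ z z′} → Represented x x′ → Represented z z′ →
                    Agree n (‖ x ‖) (‖ x′ ‖) (‖ z ‖) (‖ z′ ‖)
          replace (u , u′ , Wu , e₁ , e₂) (t , t′ , Wt , e₃ , e₄) =
            agree-resp e₁ e₂ e₃ e₄ (agreeₙ Wu Wt)
        -- ... or the remainder z of y is independent of W.
        ... | no ¬closer = w′ ∙ z′ , λ p q → agree-mono n≤S (comparable (represent p) (represent q))
          where
          z : Carrier
          z = y - w

          δ≤ : ∀ {u u′} → W X M i₁ u u′ → δ ≤ ‖ y - u ‖
          δ≤ Wu = ≮⇒≥ λ lt → ¬closer (_ , _ , Wu , inj₁ lt)

          M<δ : M < δ
          M<δ = ≰⇒> λ δ≤M → ¬closer (w ∙ z , w′ ∙ z ,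
            W-lift (n≤1+n _) (W-∙ Ww (con (subst (_≤ M) (≡.sym y-w≡δ) δ≤M))) ,
            inj₂ (≡.trans (‖‖-cong (solve (y ∷ w ∷ []) (x₀ ⊟ (x₁ ⊞ (x₀ ⊟ x₁))) 0ᵉ ≡.refl)) ‖ε‖))

          indep : ∀ {u u′} → W X M j u u′ → δ ≤ ‖ z ∙ u ‖
          indep {u} Wu = subst (δ ≤_) (‖‖-cong (solve (y ∷ w ∷ u ∷ [])
              (x₀ ⊟ (x₁ ⊟ x₂)) (x₀ ⊟ x₁ ⊞ x₂) ≡.refl))
            (δ≤ (sub (W-lift (m≤n+m i₀ 2) Ww) Wu))

          Norms : ℕ → ℕ → Set a
          Norms m m′ = ∃₂ λ x x′ → W X M i₁ x x′ × ‖ x ‖ ≡ m × ‖ x′ ‖ ≡ m′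

          radius : ∃ λ δ′ → ∀ {c c′} → Norms c c′ → Agree S δ δ′ c c′
          radius = agree-extend em Norms S (s≤s z≤n) (ε , ε , W-ε , ‖ε‖ , ‖ε‖)
            (λ { (_ , _ , Wx , ≡.refl , ≡.refl) (_ , _ , Wy , ≡.refl , ≡.refl) →
                 agree (W-lift (m≤n+m i₁ 2) Wx) (W-lift (m≤n+m i₁ 2) Wy) }) δ
          δ′ : ℕ
          δ′ = proj₁ radius

          agree-δ : ∀ {u u′} → W X M i₁ u u′ → Agree S δ δ′ (‖ u ‖) (‖ u′ ‖)
          agree-δ Wu = proj₂ radius (_ , _ , Wu , ≡.refl , ≡.refl)

          M<δ′ : M < δ′
          M<δ′ = agree-large ≤-refl (subst (λ m → Agree S δ δ′ m m) ‖ε‖ (agree-δ W-ε)) M<δ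

          N≤ : ∀ {m} → M < m → N ≤ m
          N≤ M<m = ≤-trans (m≤m⊔n N n) (<⇒≤ M<m)

          residue′ : ∃ λ z′ → ‖ z′ ‖ ≤ δ′ × (∀ {u u′} → W X M j u u′ → δ′ ≤ ‖ z′ ∙ u′ ‖)
          residue′ = residue stable z M<δ M<δ′
            (λ m≤ → proj₂ (stableFrom stable (size k j)) m≤ (N≤ M<δ) (N≤ M<δ′))
            (≤-reflexive y-w≡δ) indep
            (λ Wu → agree-≤ (s≤s z≤n) (agree-flip (agree-δ Wu)))
            (λ Wu → agree-≤ (s≤s z≤n) (agree-swap (agree-flip (agree-δ Wu))))
          z′ : Carrier
          z′ = proj₁ residue′

          -- Independence turns each norm that involves `y` into a maximum of `δ` and the norm of a
          -- combination, so the comparison reduces by `agree-⊔` to comparisons between `δ` and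
          -- combinations.
          Represented : Carrier → Carrier → Set a
          Represented x x′ = ∃₂ λ u u′ → W X M j u u′ ×
            ((‖ x ‖ ≡ ‖ u ‖ × ‖ x′ ‖ ≡ ‖ u′ ‖) ⊎ (‖ x ‖ ≡ δ ⊔ ‖ u ‖ × ‖ x′ ‖ ≡ δ′ ⊔ ‖ u′ ‖))

          independent : ∀ {δ z u} → ‖ z ‖ ≤ δ → δ ≤ ‖ z ∙ ε ‖ → δ ≤ ‖ z ∙ u ‖ →
              ‖ z ∙ u ‖ ≡ δ ⊔ ‖ u ‖
          independent {δ} {z} {u} z≤ ≤z ≤zu = ≡.trans (‖‖-independent (≤-trans z≤ ≤zu))
            (cong (_⊔ ‖ u ‖) (≤-antisym z≤ (subst (δ ≤_) (‖‖-cong (identityʳ z)) ≤z)))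

          represent : ∀ {x x′} → Translate X n y (w′ ∙ z′) x x′ → Represented x x′
          represent (old Wx) = _ , _ , W-mono n≤M (m≤n⇒m≤o+n 4 ≤-refl) Wx , inj₁ (≡.refl , ≡.refl)
          represent (new {u = u} {u′} Wu x≈ x′≈) = w ∙ u , w′ ∙ u′ , Wwu , inj₂
            ( ≡.trans (‖‖-cong (trans x≈ (solve (y ∷ w ∷ u ∷ [])
                (x₀ ⊞ x₂) ((x₀ ⊟ x₁) ⊞ (x₁ ⊞ x₂)) ≡.refl)))
                (independent (≤-reflexive y-w≡δ) (indep W-ε) (indep Wwu))
            , ≡.trans (‖‖-cong (trans x′≈ (solve (w′ ∷ z′ ∷ u′ ∷ [])
                ((x₀ ⊞ x₁) ⊞ x₂) (x₁ ⊞ (x₀ ⊞ x₂)) ≡.refl)))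
                (independent (proj₁ (proj₂ residue′)) (proj₂ (proj₂ residue′) W-ε)
                    (proj₂ (proj₂ residue′) Wwu)))
            where
            Wwu : W X M j (w ∙ u) (w′ ∙ u′)
            Wwu = W-∙ Ww (W-mono n≤M n≤i₀ Wu)

          comparable : ∀ {x x′ t t′} → Represented x x′ → Represented t t′ →
                    Agree S (‖ x ‖) (‖ x′ ‖) (‖ t ‖) (‖ t′ ‖)
          comparable {x} {x′} {t} {t′} (u , u′ , Wu , r) (s , s′ , Ws , r′) = cases r r′
            where
            us : Agree S (‖ u ‖) (‖ u′ ‖) (‖ s ‖) (‖ s′ ‖)
            us = agree-mono (m≤m+n S _) (agree (W-lift (m≤n+m j 3) Wu) (W-lift (m≤n+m j 3) Ws))
            δu : Agree S δ δ′ (‖ u ‖) (‖ u′ ‖)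
            δu = agree-δ (W-lift (n≤1+n j) Wu)
            δs : Agree S δ δ′ (‖ s ‖) (‖ s′ ‖)
            δs = agree-δ (W-lift (n≤1+n j) Ws)
            1≤S : 1 ≤ S
            1≤S = s≤s z≤n
            cases : (‖ x ‖ ≡ ‖ u ‖ × ‖ x′ ‖ ≡ ‖ u′ ‖) ⊎ (‖ x ‖ ≡ δ ⊔ ‖ u ‖ × ‖ x′ ‖ ≡ δ′ ⊔ ‖ u′ ‖) →
                    (‖ t ‖ ≡ ‖ s ‖ × ‖ t′ ‖ ≡ ‖ s′ ‖) ⊎ (‖ t ‖ ≡ δ ⊔ ‖ s ‖ × ‖ t′ ‖ ≡ δ′ ⊔ ‖ s′ ‖) →
                    Agree S (‖ x ‖) (‖ x′ ‖) (‖ t ‖) (‖ t′ ‖)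
            cases (inj₁ (e₁ , e₂)) (inj₁ (e₃ , e₄)) = agree-resp e₁ e₂ e₃ e₄ us
            cases (inj₁ (e₁ , e₂)) (inj₂ (e₃ , e₄)) = agree-resp e₁ e₂ e₃ e₄ $
              agree-swap (agree-⊔ 1≤S δs δu (agree-swap us))
            cases (inj₂ (e₁ , e₂)) (inj₁ (e₃ , e₄)) = agree-resp e₁ e₂ e₃ e₄ $
              agree-⊔ 1≤S δu δs us
            cases (inj₂ (e₁ , e₂)) (inj₂ (e₃ , e₄)) = agree-resp e₁ e₂ e₃ e₄ $
              agree-⊔ 1≤S δu (agree-swap (agree-⊔ 1≤S δs agree-self (agree-swap δs)))
                (agree-swap (agree-⊔ 1≤S δs δu (agree-swap us)))

-- Scalars and the back-and-forth game on G

module Scalars {a} {G : AbelianGroup a a} (U : UltraNorm G) where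
  open AbelianGroup G
  open UltraNorm U
  open Multiples G

  ShiftsBy : ℕ → ℕ → ℕ → Set a
  ShiftsBy c o N = ∀ x → N ≤ ‖ x ‖ → ‖ c · x ‖ + o ≡ ‖ x ‖

  Scalars : Set a
  Scalars = ∀ c → Kills c ⊎ (Onto c × ∃₂ (ShiftsBy c))

  -- The second case allows `m · y ∙ K · u` to be written as `m · (y ∙ c · u)`. The bound `O`
  -- collects the cofactor, the shift and the norm from which the shift is valid.
  Scalar : ℕ → ℕ → ℕ → Set a
  Scalar K O m = Kills m ⊎ ∃ λ c → ∃₂ λ o N →
    m * c ≡ K × c ≤ O × o ≤ O × N ≤ O × ShiftsBy m o N

  record CommonMultiple (b : ℕ) : Set a where
    field
      K O     : ℕ
      K≤O     : K ≤ O
      onto    : Onto K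
      scalar  : ∀ {m} → m ≤ b → Scalar K O m

  abstract
    commonMultiple : Scalars → ∀ b → CommonMultiple b
    commonMultiple scalars zero = record
      { K = 1 ; O = 1 ; K≤O = ≤-refl ; onto = onto-1 ; scalar = λ { z≤n → inj₁ λ _ → refl } }
    commonMultiple scalars (suc b) with commonMultiple scalars b | scalars (suc b)
    ... | C | inj₁ kills = record
      { K = K ; O = O ; K≤O = K≤O ; onto = onto ; scalar = λ m≤ → case (m≤n⇒m<n∨m≡n m≤) }
      where
      open CommonMultiple C
      case : ∀ {m} → m < suc b ⊎ m ≡ suc b → Scalar K O m
      case (inj₁ (s≤s m≤b)) = scalar m≤b
      case (inj₂ ≡.refl)    = inj₁ kills
    ... | C | inj₂ (surj , o , N , shift) = record
      { K = suc b * K ; O = suc b * O + (o + N)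
      ; K≤O = ≤-trans (*-monoʳ-≤ (suc b) K≤O) (m≤m+n _ _)
      ; onto = onto-* {suc b} {K} surj onto ; scalar = λ m≤ → case (m≤n⇒m<n∨m≡n m≤) }
      where
      open CommonMultiple C
      O≤ : O ≤ suc b * O + (o + N)
      O≤ = ≤-trans (m≤n*m O (suc b)) (m≤m+n _ _)
      case : ∀ {m} → m < suc b ⊎ m ≡ suc b → Scalar (suc b * K) (suc b * O + (o + N)) m
      case {m} (inj₁ (s≤s m≤b)) with scalar m≤b
      ... | inj₁ k = inj₁ k
      ... | inj₂ (c , o′ , N′ , mc≡K , c≤O , o′≤O , N′≤O , sh) = inj₂
        ( suc b * c , o′ , N′ , ≡.trans (x∙yz≈y∙xz m (suc b) c) (cong (suc b *_) mc≡K)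
        , ≤-trans (*-monoʳ-≤ (suc b) c≤O) (m≤m+n _ _) , ≤-trans o′≤O O≤ , ≤-trans N′≤O O≤ , sh )
        where open CommutativeSemigroupProperties *-commutativeSemigroup using (x∙yz≈y∙xz)
      case (inj₂ ≡.refl) = inj₂ (K , o , N , ≡.refl , ≤-trans K≤O O≤ ,
        ≤-trans (m≤m+n o N) (m≤n+m _ (suc b * O)) , ≤-trans (m≤n+m N o) (m≤n+m _ (suc b * O)) ,
            shift)

module Bounds {c ℓ h} (S : Setoid c ℓ) {P : Setoid.Carrier S → Set h} where
  open Setoid S

  -- The weight need not respect `≈` (it may be the norm of a chosen root), so only some
  -- representative of `x` has bounded weight.
  bounded : Finite S P → (w : Carrier → ℕ) → ∃ λ b → ∀ x → P x → ∃ λ y → x ≈ y × w y ≤ b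
  bounded (xs , cover) w = proj₁ (go xs) , λ x Px → proj₂ (go xs) (cover x Px)
    where
    go : ∀ xs → ∃ λ b → ∀ {x} → Any (x ≈_) xs → ∃ λ y → x ≈ y × w y ≤ b
    go []       = 0 , λ ()
    go (y ∷ xs) with b , bound ← go xs = w y ⊔ b , λ
      { (here x≈y)   → y , x≈y , m≤m⊔n (w y) b
      ; (there x∈xs) → let z , x≈z , wz≤b = bound x∈xs in z , x≈z , m≤n⇒m≤o⊔n (w y) wz≤b }

module Games (em : ∀ {ℓ} → ExcludedMiddle ℓ) {a} {G : AbelianGroup a a} (U : UltraNorm G)
             (stable : UltraNormProperties.WideStable U) (scalars : Scalars.Scalars U) where
  open AbelianGroup G
  open UltraNorm U
  open UltraNormProperties U
  open AbelianGroupProperties G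
  open AbelianGroupSolver G
  open Multiples G
  open Approximation em U
  open Extension em U stable
  open Scalars U

  multiples : ℕ → Pairs → Pairs
  multiples K = map (λ (x , x′) → K · x , K · x′)

  -- With these roots the constants of the new position become `K`-multiples of constants of the old
  -- one, like all older entries.
  smallRoots : ∀ {K} → Onto K → ∀ n → ∃ λ M → ∀ h → ‖ h ‖ ≤ n → ∃ λ r → K · r ≈ h × ‖ r ‖ ≤ M
  smallRoots onto n with M , bound ← Bounds.bounded setoid (balls n) (λ h → ‖ proj₁ (onto h) ‖) =
    M , λ h h≤n → let y , h≈y , r≤M = bound h h≤n in
      proj₁ (onto y) , trans (proj₂ (onto y)) (sym h≈y) , r≤M

  -- Multiples are by natural numbers, so the integer coefficient of `y` is kept as a difference
  -- `c - e`. Each subtraction at most doubles the bound on `c + e`, whence `2 ^ i` in `decompose`.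
  record Decomposition (X : Pairs) (K M b i : ℕ) (y y′ x x′ : Carrier) : Set a where
    field
      c e    : ℕ
      u u′   : Carrier
      Wu     : W X M i u u′
      c+e≤b  : c + e ≤ b
      x≈     : x ≈ (c · y - e · y) ∙ K · u
      x′≈    : x′ ≈ (c · y′ - e · y′) ∙ K · u′

  decompose : ∀ {X K n M y y′} → (∀ h → ‖ h ‖ ≤ n → ∃ λ r → K · r ≈ h × ‖ r ‖ ≤ M) →
    ∀ {i x x′} → W ((y , y′) ∷ multiples K X) n i x x′ → Decomposition X K M (2 ^ i) i y y′ x x′
  decompose {X} {K} {n} {M} {y} {y′} roots = go
    where
    first : ∀ z → z ≈ (1 · z - 0 · z) ∙ K · ε
    first z = sym (trans (∙-congˡ (×-ε K)) (solve (z ∷ []) (x₀ ⊞ 0ᵉ ⊟ 0ᵉ ⊞ 0ᵉ) x₀ ≡.refl))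

    none : ∀ z {u x} → K · u ≈ x → x ≈ (0 · z - 0 · z) ∙ K · u
    none z {x = x} eq = sym (trans (∙-congˡ eq) (solve (x ∷ []) (0ᵉ ⊟ 0ᵉ ⊞ x₀) x₀ ≡.refl))

    difference : ∀ c e c′ e′ z u v → ((c · z - e · z) ∙ K · u) - ((c′ · z - e′ · z) ∙ K · v) ≈
                 ((c + e′) · z - (e + c′) · z) ∙ K · (u - v)
    difference c e c′ e′ z u v = trans
      (solve (c · z ∷ e · z ∷ c′ · z ∷ e′ · z ∷ K · u ∷ K · v ∷ [])
        ((x₀ ⊟ x₁ ⊞ x₄) ⊟ (x₂ ⊟ x₃ ⊞ x₅)) ((x₀ ⊞ x₃) ⊟ (x₁ ⊞ x₂) ⊞ (x₄ ⊟ x₅)) ≡.refl)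
      (sym (∙-cong (∙-cong (×-homo-+ z c e′) (⁻¹-cong (×-homo-+ z e c′))) (×-distrib-- K u v)))
      where
      x₄ x₅ : Expr 6
      x₄ = var (Fin.suc (Fin.suc (Fin.suc (Fin.suc Fin.zero))))
      x₅ = var (Fin.suc (Fin.suc (Fin.suc (Fin.suc (Fin.suc Fin.zero)))))

    go : ∀ {i x x′} → W ((y , y′) ∷ multiples K X) n i x x′ → Decomposition X K M (2 ^ i) i y y′ x
        x′
    go {i} (gen (here ≡.refl)) = record
      { c = 1 ; e = 0 ; u = ε ; u′ = ε ; Wu = W-ε ; c+e≤b = m^n>0 2 i ; x≈ = first y ; x′≈ =
          first y′ }
    go {i} (gen (there x∈)) with (u , u′) , u∈ , ≡.refl ← ∈-map⁻ _ x∈ = record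
      { c = 0 ; e = 0 ; u = u ; u′ = u′ ; Wu = gen u∈ ; c+e≤b = z≤n ; x≈ = none y refl ; x′≈ =
          none y′ refl }
    go {i} (con h≤n) with r , Kr≈h , r≤M ← roots _ h≤n = record
      { c = 0 ; e = 0 ; u = r ; u′ = r ; Wu = con r≤M ; c+e≤b = z≤n ; x≈ = none y Kr≈h ; x′≈ =
          none y′ Kr≈h }
    go (resp eq eq′ p) with go p
    ... | d = record { Decomposition d ; x≈ = trans (sym eq) x≈ ; x′≈ = trans (sym eq′) x′≈ }
      where open Decomposition d
    go {suc i} (sub p q) with go p | go q
    ... | d | d′ = record
      { c = D.c + D′.e ; e = D.e + D′.c ; u = D.u - D′.u ; u′ = D.u′ - D′.u′
      ; Wu = sub D.Wu D′.Wu
      ; c+e≤b = linear 0 (D.c+e≤b ⊕ D′.c+e≤b) (sums D.c D.e D′.c D′.e (2 ^ i))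
      ; x≈ = trans (∙-cong D.x≈ (⁻¹-cong D′.x≈)) (difference D.c D.e D′.c D′.e y D.u D′.u)
      ; x′≈ = trans (∙-cong D.x′≈ (⁻¹-cong D′.x′≈)) (difference D.c D.e D′.c D′.e y′ D.u′ D′.u′)
      }
      where
      module D = Decomposition d
      module D′ = Decomposition d′
      sums : ∀ c e c′ e′ t → 2 * t + ((c + e) + (c′ + e′)) ≡ ((c + e′) + (e + c′)) + (t + t) + 0
      sums = solve-∀

  record Normalised (X : Pairs) (K M b i : ℕ) (y y′ x x′ : Carrier) : Set a where
    field
      m      : ℕ
      u u′   : Carrier
      Wu     : W X M i u u′
      m≤b    : m ≤ b
      x≡     : ‖ x ‖ ≡ ‖ m · y ∙ K · u ‖
      x′≡    : ‖ x′ ‖ ≡ ‖ m · y′ ∙ K · u′ ‖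

  -- A negative coefficient becomes positive on inverting the combination. This preserves the norm,
  -- which is all that is recorded, and adds one to the depth.
  normalise : ∀ {X K M b i y y′ x x′} → Decomposition X K M b i y y′ x x′ →
              Normalised X K M b (suc i) y y′ x x′
  normalise {K = K} {i = i} {y} {y′} d = case (≤-total e c)
    where
    open Decomposition d
    cancel : ∀ m z v → ((e + m) · z - e · z) ∙ v ≈ m · z ∙ v
    cancel m z v = trans (∙-congʳ (∙-congʳ (×-homo-+ z e m)))
      (solve (e · z ∷ m · z ∷ v ∷ []) (x₀ ⊞ x₁ ⊟ x₀ ⊞ x₂) (x₁ ⊞ x₂) ≡.refl)
    cancel′ : ∀ m z v → ((c · z - (c + m) · z) ∙ K · v) ⁻¹ ≈ m · z ∙ K · (v ⁻¹)
    cancel′ m z v = trans (⁻¹-cong (∙-congʳ (∙-congˡ (⁻¹-cong (×-homo-+ z c m)))))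
      (trans (solve (c · z ∷ m · z ∷ K · v ∷ [])
                (⊖ (x₀ ⊟ (x₀ ⊞ x₁) ⊞ x₂)) (x₁ ⊟ x₂) ≡.refl)
        (∙-congˡ (sym (×-⁻¹ K v))))
    case : e ≤ c ⊎ c ≤ e → Normalised _ _ _ _ _ _ _ _ _
    case (inj₁ e≤c) with m , ≡.refl ← m≤n⇒∃[o]m+o≡n e≤c = record
      { m = m ; Wu = W-lift (n≤1+n i) Wu
      ; m≤b = ≤-trans (m≤n+m m e) (≤-trans (m≤m+n (e + m) e) c+e≤b)
      ; x≡ = ‖‖-cong (trans x≈ (cancel m y _)) ; x′≡ = ‖‖-cong (trans x′≈ (cancel m y′ _)) }
    case (inj₂ c≤e) with m , ≡.refl ← m≤n⇒∃[o]m+o≡n c≤e = record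
      { m = m ; Wu = W-⁻¹ Wu
      ; m≤b = ≤-trans (m≤n+m m c) (≤-trans (m≤n+m (c + m) c) c+e≤b)
      ; x≡ = ≡.trans (‖‖-cong x≈) (≡.trans (≡.sym (‖⁻¹‖ _)) (‖‖-cong (cancel′ m y u)))
      ; x′≡ = ≡.trans (‖‖-cong x′≈) (≡.trans (≡.sym (‖⁻¹‖ _)) (‖‖-cong (cancel′ m y′ u′))) }

  abstract
    extension : ∀ n k → ∃₂ λ n′ K → Onto K × (∀ X → length X ≡ k → Good n′ X →
                ∀ y → ∃ λ y′ → Good n ((y , y′) ∷ multiples K X))
    extension n k = proj₁ (approximate n₁ k) , K , onto , extend
      where
      open CommonMultiple (commonMultiple scalars (2 ^ n))
      M D n₁ : ℕ
      -- `M` bounds the roots of the constants of norm at most `n`, and `D` bounds the depth of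
      -- `c · u` for `c ≤ O`; one more level is left for subtracting a constant. Displacements by up
      -- to `O` account for `O + O`.
      M = proj₁ (smallRoots {K} onto n)
      D = O * 2 + suc n
      n₁ = (suc D + M) + (n + (O + O))
      gap≤n₁ : n + (O + O) ≤ n₁
      gap≤n₁ = m≤n+m _ (suc D + M)
      D<n₁ : suc D ≤ n₁
      D<n₁ = ≤-trans (m≤m+n (suc D) M) (m≤m+n _ _)
      M≤n₁ : M ≤ n₁
      M≤n₁ = ≤-trans (m≤n+m M (suc D)) (m≤m+n _ _)
      O≤n₁ : O ≤ n₁
      O≤n₁ = ≤-trans (≤-trans (m≤m+n O O) (m≤n+m (O + O) n)) gap≤n₁

      extend : ∀ X → length X ≡ k → Good (proj₁ (approximate n₁ k)) X →
               ∀ y → ∃ λ y′ → Good n ((y , y′) ∷ multiples K X)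
      extend X len good y with y′ , agree ← proj₂ (approximate n₁ k) X len good y =
        y′ , λ p q → displaced-agree {P = Norms}
          (λ { (_ , _ , Tt , ≡.refl , ≡.refl) (_ , _ , Ts , ≡.refl , ≡.refl) →
               agree-mono gap≤n₁ (agree Tt Ts) })
          (displace p) (displace q)
        where
        Norms : ℕ → ℕ → Set a
        Norms e e′ = ∃₂ λ t t′ → Translate X n₁ y y′ t t′ × ‖ t ‖ ≡ e × ‖ t′ ‖ ≡ e′

        zero-norms : Norms 0 0
        zero-norms = ε , ε , old W-ε , ‖ε‖ , ‖ε‖

        agree-0 : ∀ {t t′} → Translate X n₁ y y′ t t′ → Agree n₁ (‖ t ‖) (‖ t′ ‖) 0 0
        agree-0 {t} {t′} Tt = ≡.subst (λ z → Agree n₁ (‖ t ‖) (‖ t′ ‖) z z) ‖ε‖ (agree Tt (old W-ε))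

        deepen : ∀ {i u u′} → i ≤ suc D → W X M i u u′ → W X n₁ n₁ u u′
        deepen i≤ Wu = W-mono M≤n₁ (≤-trans i≤ D<n₁) Wu

        displace : ∀ {x x′} → W ((y , y′) ∷ multiples K X) n n x x′ →
            Displaced O Norms (‖ x ‖) (‖ x′ ‖)
        displace {x} {x′} p = cases (scalar m≤b)
          where
          open Normalised (normalise (decompose {K = K} (proj₂ (smallRoots {K} onto n)) p))

          cases : Scalar K O m → Displaced O Norms (‖ x ‖) (‖ x′ ‖)
          cases (inj₁ kills) = displaced 0 0
            (K · u , K · u′ , old (deepen (m≤n⇒m≤1+n (+-monoˡ-≤ (suc n) (*-monoˡ-≤ 2 K≤O)))
                (W-· K Wu)) ,
             ≡.refl , ≡.refl)
            (cong (_+ 0) (≡.trans x≡ (‖‖-cong (trans (∙-congʳ (kills y)) (identityˡ _)))))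
            (cong (_+ 0) (≡.trans x′≡ (‖‖-cong (trans (∙-congʳ (kills y′)) (identityˡ _)))))
            z≤n z≤n
          cases (inj₂ (c , o , N , mc≡K , c≤O , o≤O , N≤O , shift)) = byNorm (N ≤? ‖ t ‖)
            where
            t t′ : Carrier
            t  = y ∙ c · u
            t′ = y′ ∙ c · u′
            Wcu : W X M D (c · u) (c · u′)
            Wcu = W-lift (+-monoˡ-≤ (suc n) (*-monoˡ-≤ 2 c≤O)) (W-· c Wu)
            Tt : Translate X n₁ y y′ t t′
            Tt = new (deepen (n≤1+n D) Wcu) refl refl

            factor-out : ∀ z v → m · z ∙ K · v ≈ m · (z ∙ c · v)
            factor-out z v = sym (trans (×-distrib-+ z (c · v) m)
              (∙-congˡ (trans (×-assocˡ v m c) (×-congˡ mc≡K))))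
            ‖x‖ : ‖ x ‖ ≡ ‖ m · t ‖
            ‖x‖ = ≡.trans x≡ (‖‖-cong (factor-out y u))
            ‖x′‖ : ‖ x′ ‖ ≡ ‖ m · t′ ‖
            ‖x′‖ = ≡.trans x′≡ (‖‖-cong (factor-out y′ u′))

            byNorm : Dec (N ≤ ‖ t ‖) → Displaced O Norms (‖ x ‖) (‖ x′ ‖)
            byNorm (yes N≤t) = displaced o 0 (t , t′ , Tt , ≡.refl , ≡.refl)
              (≡.trans (cong (_+ o) ‖x‖) (≡.trans (shift t N≤t) (≡.sym (+-identityʳ _))))
              (≡.trans (cong (_+ o) ‖x′‖) (≡.trans
                (shift t′ (agree-large (≤-trans N≤O O≤n₁) (agree-0 Tt) N≤t))
                    (≡.sym (+-identityʳ _))))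
              o≤O z≤n
            byNorm (no N≰t) = displaced 0 (‖ x ‖) zero-norms (+-identityʳ _)
              (≡.trans (+-identityʳ _) (≡.trans ‖x′‖
                  (≡.trans (‖‖-cong (×-congʳ m t′≈t)) (≡.sym ‖x‖))))
              z≤n (≤-trans (≤-reflexive ‖x‖) (≤-trans (‖‖-· m t) t≤O))
              where
              t≤O : ‖ t ‖ ≤ O
              t≤O = ≤-trans (<⇒≤ (≰⇒> N≰t)) N≤O
              cancels : ∀ z v w → z ∙ (v - w) ≈ (z ∙ v) - w
              cancels z v w = sym (assoc z v (w ⁻¹))
              t′≈t : t′ ≈ t
              t′≈t = x∙y⁻¹≈ε⇒x≈y t′ t (‖‖≡0 (agree-≡ (≤-trans (s≤s z≤n) D<n₁)
                (agree-0 (new (sub (W-mono M≤n₁ (s≤s⁻¹ D<n₁) Wcu) (con (≤-trans t≤O O≤n₁)))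
                              (sym (cancels y (c · u) t)) (sym (cancels y′ (c · u′) t))))
                (≡.trans (‖‖-cong (inverseʳ t)) ‖ε‖)))

  -- Both are computed backwards from the end of the game, where goodness `q` is wanted; a round
  -- leaves one entry more and one round fewer. The factor collects the multipliers of the rounds
  -- still to be played.
  threshold factor : ℕ → ℕ → ℕ → ℕ
  threshold q zero    k = q
  threshold q (suc r) k = proj₁ (extension (threshold q r (suc k)) k)
  factor q zero    k = 1
  factor q (suc r) k = factor q r (suc k) * proj₁ (proj₂ (extension (threshold q r (suc k)) k))

  factor-onto : ∀ q r k → Onto (factor q r k)
  factor-onto q zero    k = onto-1
  factor-onto q (suc r) k =
    onto-* {factor q r (suc k)} {proj₁ (proj₂ (extension (threshold q r (suc k)) k))}
      (factor-onto q r (suc k)) (proj₁ (proj₂ (proj₂ (extension (threshold q r (suc k)) k))))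

  -- A position of the game with r rounds to play. An entry y of X stands for
  -- its multiple by the factor, so that y can be divided in later rounds.
  record State (q r : ℕ) : Set a where
    field
      k    : ℕ
      X    : Pairs
      len  : length X ≡ k
      good : Good (threshold q r k) X

    Corresponds : Carrier → Carrier → Set a
    Corresponds x x′ = ∃₂ λ y y′ → (y , y′) ∈ X × x ≈ factor q r k · y × x′ ≈ factor q r k · y′

  open State using (Corresponds)

  flip : ∀ {q r} → State q r → State q r
  flip S = record { k = k ; X = map swap X ; len = ≡.trans (length-map swap X) len ; good =
      good-flip good }
    where open State S

  flip-corresponds : ∀ {q r} (S : State q r) {x x′} → Corresponds S x x′ → Corresponds (flip S) x′ x
  flip-corresponds S (y , y′ , y∈X , e , e′) = y′ , y , ∈-map⁺ swap y∈X , e′ , e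

  _⊑_ : ∀ {q r s} → State q r → State q s → Set a
  S ⊑ T = ∀ {z z′} → Corresponds S z z′ → Corresponds T z z′

  -- The move is divided by the factor of the rounds that remain, while the old entries absorb the
  -- multiplier `K` by which the factor shrinks; so the elements they stand for do not change.
  forth : ∀ {q r} (S : State q (suc r)) x → ∃₂ λ x′ (T : State q r) → Corresponds T x x′ × S ⊑ T
  forth {q} {r} S x with y , κy≈x ← factor-onto q r (suc (State.k S)) x
    with y′ , good′ ← proj₂ (proj₂ (proj₂ (extension (threshold q r (suc (State.k S)))
        (State.k S))))
                        (State.X S) (State.len S) (State.good S) y =
    factor q r (suc k) · y′ , T , (y , y′ , here ≡.refl , sym κy≈x , refl) , keep
    where
    open State S
    K = proj₁ (proj₂ (extension (threshold q r (suc k)) k))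
    T : State q r
    T = record { k = suc k ; X = (y , y′) ∷ multiples K X
               ; len = cong suc (≡.trans (length-map _ X) len) ; good = good′ }
    keep : S ⊑ T
    keep (v , v′ , v∈X , e , e′) = K · v , K · v′ , there (∈-map⁺ _ v∈X) ,
      trans e (sym (×-assocˡ v (factor q r (suc k)) K)) ,
          trans e′ (sym (×-assocˡ v′ (factor q r (suc k)) K))

  final : ∀ {q} (S : State q 0) {i x x′} → Corresponds S x x′ → W (State.X S) q i x x′
  final S (y , y′ , y∈X , e , e′) = resp (trans (sym (×-homo-1 y)) (sym e))
      (trans (sym (×-homo-1 y′)) (sym e′)) (gen y∈X)

  -- Over fixed parameters any two deep elements can be exchanged: in a combination `m · y ∙ u` the
  -- part `u` is bounded, so either `m` kills G and only `u` remains, or `u` is absorbed and the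
  -- norm is `‖ y ‖` less a constant.
  module Start (q r : ℕ) (params : List Carrier) where
    k = suc (length params)
    n κ : ℕ
    n = threshold q r k
    κ = factor q r k
    root : Carrier → Carrier
    root p = proj₁ (factor-onto q r k p)
    κ-root : ∀ p → κ · root p ≈ p
    κ-root p = proj₂ (factor-onto q r k p)

    diagonal : Pairs
    diagonal = map (λ p → root p , root p) params

    private
      open CommonMultiple (commonMultiple scalars (2 ^ n))

      bound : ∃ λ b → ∀ {p} → p ∈ params → ‖ root p ‖ ≤ b
      bound = go params
        where
        go : ∀ ps → ∃ λ b → ∀ {p} → p ∈ ps → ‖ root p ‖ ≤ b
        go []       = 0 , λ ()
        go (p ∷ ps) with b , bd ← go ps = ‖ root p ‖ ⊔ b , λ
          { (here ≡.refl) → m≤m⊔n _ b ; (there p∈) → m≤n⇒m≤o⊔n _ (bd p∈) }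

      B = proj₁ bound ⊔ n

      diagonal-bound : ∀ {i u u′} → W diagonal n i u u′ → u ≈ u′ × ‖ u ‖ ≤ B
      diagonal-bound (gen u∈) with p , p∈ , ≡.refl ← ∈-map⁻ _ u∈ =
        refl , ≤-trans (proj₂ bound p∈) (m≤m⊔n _ n)
      diagonal-bound (con h≤n) = refl , ≤-trans h≤n (m≤n⊔m _ n)
      diagonal-bound (sub p q) with e , b ← diagonal-bound p | e′ , b′ ← diagonal-bound q =
        ∙-cong e (⁻¹-cong e′) , ‖‖-minus-≤ b b′
      diagonal-bound (resp e e′ p) with e″ , b ← diagonal-bound p =
        trans (sym e) (trans e″ e′) , subst (_≤ B) (‖‖-cong e) b

      O′ = O + B

    -- Past this norm `y` is further from 0 than the precision plus twice the possible displacement,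
    -- and `m · y` still dominates the bounded part.
    depth : ℕ
    depth = suc (n + (O′ + O′))

    private
      good : ∀ {y y′} → depth ≤ ‖ y ‖ → depth ≤ ‖ y′ ‖ → Good n ((y , y′) ∷ multiples 1 diagonal)
      good {y} {y′} y≥ y′≥ p q = displaced-agree {P = Norms} agree (displace p) (displace q)
        where
        data Norms : ℕ → ℕ → Set where
          none : Norms 0 0
          deep : Norms (‖ y ‖) (‖ y′ ‖)

        agree : ∀ {b b′ c c′} → Norms b b′ → Norms c c′ → Agree (n + (O′ + O′)) b b′ c c′
        agree none none = agree-self
        agree none deep = below (<⇒≤ y≥) (<⇒≤ y′≥)
        agree deep none = above (<⇒≤ y≥) (<⇒≤ y′≥)
        agree deep deep = agree-self

        displace : ∀ {x x′} → W ((y , y′) ∷ multiples 1 diagonal) n n x x′ →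
                   Displaced O′ Norms (‖ x ‖) (‖ x′ ‖)
        displace {x} {x′} p = cases (scalar m≤b)
          where
          open Normalised (normalise (decompose {K = 1} {M = n} (λ h h≤n → h , ×-homo-1 h , h≤n) p))
          u≈u′ = proj₁ (diagonal-bound Wu)
          1·u≤B : ‖ 1 · u ‖ ≤ B
          1·u≤B = ≤-trans (‖‖-· 1 u) (proj₂ (diagonal-bound Wu))
          1·u′≤B : ‖ 1 · u′ ‖ ≤ B
          1·u′≤B = subst (_≤ B) (‖‖-cong (×-congʳ 1 u≈u′)) 1·u≤B

          cases : Scalar K O m → Displaced O′ Norms (‖ x ‖) (‖ x′ ‖)
          cases (inj₁ kills) = displaced 0 (‖ 1 · u ‖) none
            (≡.trans (+-identityʳ _) (≡.trans x≡
                (‖‖-cong (trans (∙-congʳ (kills y)) (identityˡ _)))))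
            (≡.trans (+-identityʳ _) (≡.trans x′≡ (‖‖-cong (trans (∙-congʳ (kills y′))
              (trans (identityˡ _) (×-congʳ 1 (sym u≈u′)))))))
            z≤n (≤-trans 1·u≤B (m≤n+m B O))
          cases (inj₂ (c , o , N , _ , _ , o≤O , N≤O , shift)) = displaced o 0 deep
            (moved y≥ 1·u≤B x≡) (moved y′≥ 1·u′≤B x′≡) (≤-trans o≤O (m≤m+n O B)) z≤n
            where
            moved : ∀ {y u x} → depth ≤ ‖ y ‖ → ‖ u ‖ ≤ B → ‖ x ‖ ≡ ‖ m · y ∙ u ‖ →
                ‖ x ‖ + o ≡ ‖ y ‖ + 0
            moved {y} {u} {x} y≥ u≤ eq = ≡.trans (cong (_+ o) (≡.trans eq (absorb u<my)))
              (≡.trans shifted (≡.sym (+-identityʳ _)))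
              where
              shifted : ‖ m · y ‖ + o ≡ ‖ y ‖
              shifted = shift y (≤-trans (≤-trans N≤O (≤-trans (m≤m+n O B)
                (≤-trans (m≤m+n O′ O′) (m≤n+m (O′ + O′) (suc n))))) y≥)
              u<my : ‖ u ‖ < ‖ m · y ‖
              u<my = linear (n + (O + B)) (u≤ ⊕ y≥ ⊕ ≤-reflexive (≡.sym shifted) ⊕ o≤O)
                (arith (‖ u ‖) (‖ m · y ‖) (‖ y ‖) n O B o)
                where
                arith : ∀ u w y n O B o → w + (u + suc (n + ((O + B) + (O + B))) + y + o) ≡
                                             suc u + (B + y + (w + o) + O) + (n + (O + B))
                arith = solve-∀

    state : ∀ {x x′} → depth ≤ ‖ x ‖ → depth ≤ ‖ x′ ‖ →
            Σ (State q r) λ S → Corresponds S x x′ × (∀ {p} → p ∈ params → Corresponds S p p)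
    state {x} {x′} x≥ x′≥ = S , (root x , root x′ , here ≡.refl , sym (κ-root x) , sym (κ-root x′))
        ,
      λ {p} p∈ → 1 · root p , 1 · root p , there (∈-map⁺ _ (∈-map⁺ _ p∈)) , fixed p , fixed p
      where
      root≥ : ∀ {x} → depth ≤ ‖ x ‖ → depth ≤ ‖ root x ‖
      root≥ {x} x≥ = ≤-trans x≥ (≤-trans (≤-reflexive (‖‖-cong (sym (κ-root x)))) (‖‖-· κ (root x)))
      S : State q r
      S = record { k = k ; X = (root x , root x′) ∷ multiples 1 diagonal
                 ; len = cong suc (≡.trans (length-map _ diagonal) (length-map _ params))
                 ; good = good (root≥ x≥) (root≥ x′≥) }
      fixed : ∀ p → p ≈ κ · (1 · root p)
      fixed p = trans (sym (κ-root p)) (×-congʳ κ (sym (×-homo-1 (root p))))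

-- The norm of a valued group and minimality of G

module Depth {a} (V : ValuedAbelianGroup a) (ω* : HasOrderTypeω* V) (fibres : HasFiniteFibres V) where
  open ValuedAbelianGroup V
  open Γ using (module Eq)
  open NaturalMin Γ using (_⊓_) renaming (⊓-sel to ⊓ᵛ-sel)

  g : ℕ → Γ.Carrier
  g = proj₁ ω*
  open IsOrderIsomorphism (proj₂ ω*) renaming (surjective to g-surjective) using
      (cong; mono; cancel; injective)

  δ : Γ.Carrier → ℕ
  δ γ = proj₁ (g-surjective γ)

  gδ : ∀ γ → g (δ γ) Γ.≈ γ
  gδ γ = proj₂ (g-surjective γ) ≡.refl

  δ-anti : ∀ {γ γ′} → γ Γ.≤ γ′ → δ γ′ ≤ δ γ
  δ-anti {γ} {γ′} γ≤γ′ = cancel (Γ.≤-respˡ-≈ (Eq.sym (gδ γ)) (Γ.≤-respʳ-≈ (Eq.sym (gδ γ′)) γ≤γ′))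

  δ-cancel : ∀ {γ γ′} → δ γ′ ≤ δ γ → γ Γ.≤ γ′
  δ-cancel {γ} {γ′} le = Γ.≤-respˡ-≈ (gδ γ) (Γ.≤-respʳ-≈ (gδ γ′) (mono le))

  δ-cong : ∀ {γ γ′} → γ Γ.≈ γ′ → δ γ ≡ δ γ′
  δ-cong e = ≤-antisym (δ-anti (Γ.reflexive (Eq.sym e))) (δ-anti (Γ.reflexive e))

  δ-injective : ∀ {γ γ′} → δ γ ≡ δ γ′ → γ Γ.≈ γ′
  δ-injective e = Γ.antisym (δ-cancel (≤-reflexive (≡.sym e))) (δ-cancel (≤-reflexive e))

  δg : ∀ n → δ (g n) ≡ n
  δg n = injective (gδ (g n))

  δ∞ : δ ∞ ≡ 0
  δ∞ = n≤0⇒n≡0 (≤-trans (δ-anti (∞-maximum (g 0))) (≤-reflexive (δg 0)))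

  depth : G.Carrier → ℕ
  depth x = δ (v x)

  depth≡0 : ∀ {x} → depth x ≡ 0 → x G.≈ G.ε
  depth≡0 {x} e = Equivalence.to (v≈∞⇔≈0 x) (δ-injective (≡.trans e (≡.sym δ∞)))

  ofDepth : ∀ n → ∃ λ x → depth x ≡ n
  ofDepth n with x , vx≈ ← surjective (g n) = x , ≡.trans (δ-cong (vx≈ G.refl)) (δg n)

  depth-minus : ∀ x y → depth (x G.- y) ≤ depth x ⊔ depth y
  depth-minus x y with ⊓ᵛ-sel (v x) (v y)
  ... | inj₁ e = ≤-trans (δ-anti (v-minus x y)) (≤-trans (≤-reflexive (δ-cong e)) (m≤m⊔n _ _))
  ... | inj₂ e = ≤-trans (δ-anti (v-minus x y)) (≤-trans (≤-reflexive (δ-cong e)) (m≤n⊔m _ _))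

  depth-balls : ∀ n → Finite G.setoid (λ x → depth x ≤ n)
  depth-balls zero with xs , cover ← fibres (g 0) =
    xs , λ x x≤0 → cover x (δ-injective (≡.trans (n≤0⇒n≡0 x≤0) (≡.sym (δg 0))))
  depth-balls (suc n) with xs , cover ← fibres (g (suc n)) | ys , cover′ ← depth-balls n =
    xs ++ ys , λ x x≤ → split x (m≤n⇒m<n∨m≡n x≤)
    where
    split : ∀ x → depth x < suc n ⊎ depth x ≡ suc n → Any (x G.≈_) (xs ++ ys)
    split x (inj₁ (s≤s x≤n)) = ++⁺ʳ xs (cover′ x x≤n)
    split x (inj₂ x≡)        = ++⁺ˡ (cover x (δ-injective (≡.trans x≡ (≡.sym (δg (suc n))))))

  upset : ∀ n → Finite valueSetoid (λ γ → δ γ ≤ n)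
  upset zero    = g 0 ∷ [] , λ γ ≤0 → here (δ-injective (≡.trans (n≤0⇒n≡0 ≤0) (≡.sym (δg 0))))
  upset (suc n) with ys , cover ← upset n = g (suc n) ∷ ys , λ γ ≤n → split γ (m≤n⇒m<n∨m≡n ≤n)
    where
    split : ∀ γ → δ γ < suc n ⊎ δ γ ≡ suc n → Any (γ Γ.≈_) (g (suc n) ∷ ys)
    split γ (inj₁ (s≤s γ≤n)) = there (cover γ γ≤n)
    split γ (inj₂ γ≡)        = here (δ-injective (≡.trans γ≡ (≡.sym (δg (suc n)))))

  value-bounded : ∀ {P : Γ.Carrier → Set a} → Finite valueSetoid P → ∃ λ b → ∀ γ → P γ → δ γ ≤ b
  value-bounded finite with b , bound ← Bounds.bounded valueSetoid finite δ =
    b , λ γ Pγ → let η , γ≈η , η≤b = bound γ Pγ in subst (_≤ b) (≡.sym (δ-cong γ≈η)) η≤b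

  ultraNorm : UltraNorm G
  ultraNorm = record
    { ‖_‖ = depth ; ‖‖-cong = λ x≈y → δ-cong (v-cong x≈y) ; ‖ε‖ = ≡.trans (δ-cong (v-ε V)) δ∞
    ; ‖‖≡0 = depth≡0 ; ‖‖-minus = depth-minus ; surjective = ofDepth ; balls = depth-balls }

  infinite : Infinite G.setoid
  infinite whole = unbounded (Bounds.bounded G.setoid whole depth)
    where
    unbounded : ¬ (∃ λ b → ∀ x → ⊤ → ∃ λ y → x G.≈ y × depth y ≤ b)
    unbounded (b , bound) with x , x≡ ← ofDepth (suc b) with y , x≈y , y≤b ← bound x tt =
      n≮n b (subst (_≤ b) (≡.trans (≡.sym (δ-cong (v-cong x≈y))) x≡) y≤b)

module GroupMinimality (em : ∀ {ℓ} → ExcludedMiddle ℓ) {a} (V : ValuedAbelianGroup a)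
  (ω* : HasOrderTypeω* V) (fibres : HasFiniteFibres V)
  (stable : UltraNormProperties.WideStable (Depth.ultraNorm V ω* fibres))
  (scalars : Scalars.Scalars (Depth.ultraNorm V ω* fibres)) where
  open ValuedAbelianGroup V hiding (surjective)
  open Γ using (module Eq)
  open AbelianGroup G hiding (group)
  open AbelianGroupProperties G
  open Depth V ω* fibres
  open UltraNorm ultraNorm using (‖_‖; ‖‖-cong; ‖ε‖; ‖‖≡0)
  open Approximation em ultraNorm
  open Games em ultraNorm stable scalars
  open State using (Corresponds)

  private
    𝓜 : Structure 𝓛vg a
    𝓜 = valuedGroupStructure V
    open Structure 𝓜 using (Dom; Env) renaming (∣_∣ to Sort⟦_⟧)

    -- Depth 3 suffices for a combination that detects x ∙ y ≈ z.
    St : ℕ → Set a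
    St = State 3

  -- A value is represented by an element having it, so that the game needs moves in G only.
  Matches : ∀ {r} → St r → ∀ s → Sort⟦ s ⟧ → Sort⟦ s ⟧ → Set a
  Matches S group x x′ = Corresponds S x x′
  Matches S value γ γ′ = ∃₂ λ x x′ → Corresponds S x x′ × γ Γ.≈ v x × γ′ Γ.≈ v x′

  matches-⊑ : ∀ {r r′} {S : St r} {T : St r′} → S ⊑ T → ∀ {s x x′} → Matches S s x x′ →
      Matches T s x x′
  matches-⊑ S⊑T {group} c = S⊑T c
  matches-⊑ S⊑T {value} (x , x′ , c , e , e′) = x , x′ , S⊑T c , e , e′

  matches-flip : ∀ {r} (S : St r) {s x x′} → Matches S s x x′ → Matches (flip S) s x′ x
  matches-flip S {group} c = flip-corresponds S c
  matches-flip S {value} (x , x′ , c , e , e′) = x′ , x , flip-corresponds S c , e′ , e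

  corresponds-resp : ∀ {r} (S : St r) {x x′ y y′} → x ≈ y → x′ ≈ y′ → Corresponds S x x′ →
      Corresponds S y y′
  corresponds-resp S e e′ (z , z′ , z∈ , p , p′) = z , z′ , z∈ , trans (sym e) p , trans (sym e′) p′

  -- Surplus rounds are used up by playing `ε`.
  drop : ∀ {r r′} → r ≤ r′ → (S : St r′) → Σ (St r) λ T → S ⊑ T
  drop {r} {r′} r≤r′ S with m≤n⇒m<n∨m≡n r≤r′
  ... | inj₂ ≡.refl = S , λ c → c
  drop {r} {suc r′} _ S | inj₁ (s≤s r≤r′) with _ , S′ , _ , S⊑S′ ← forth S ε
    with T , S′⊑T ← drop r≤r′ S′ = T , λ c → S′⊑T (S⊑S′ c)

  corresponds-agree : ∀ {r} (S : St r) {x x′ y y′} → Corresponds S x x′ → Corresponds S y y′ →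
                      Agree 3 (‖ x ‖) (‖ x′ ‖) (‖ y ‖) (‖ y′ ‖)
  corresponds-agree S c d with T , S⊑T ← drop z≤n S =
    State.good T (final T (S⊑T c)) (final T (S⊑T d))

  corresponds-ε : ∀ {r} (S : St r) {x′} → Corresponds S ε x′ → x′ ≈ ε
  corresponds-ε S c with T , S⊑T ← drop z≤n S =
    ‖‖≡0 (≡.trans (≡.sym (agree-≡ (s≤s z≤n) (State.good T (W-ε {i = 3}) (final T (S⊑T c))) ≡.refl))
        ‖ε‖)

  corresponds-∙ : ∀ {r} (S : St r) {x x′ y y′ z′} → Corresponds S x x′ → Corresponds S y y′ →
                  Corresponds S (x ∙ y) z′ → x′ ∙ y′ ≈ z′
  corresponds-∙ S {x} {x′} {y} {y′} {z′} c d e with T , S⊑T ← drop z≤n S =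
    x∙y⁻¹≈ε⇒x≈y (x′ ∙ y′) z′ (‖‖≡0 (≡.trans (agree-≡ (s≤s z≤n)
      (State.good T combination (W-ε {i = 3})) (‖‖-cong (inverseʳ (x ∙ y)))) ‖ε‖))
    where
    combination : W (State.X T) 3 3 ((x ∙ y) - (x ∙ y)) ((x′ ∙ y′) - z′)
    combination = sub (W-∙ {i = 0} (final T (S⊑T c)) (final T (S⊑T d))) (final T (S⊑T e))

  private
    mutual
      -- Each function symbol is allotted a round, because a term is evaluated on both sides by
      -- playing the values of its subterms.
      weight : ∀ {Δ s} → Term 𝓛vg Δ s → ℕ
      weight (var _)    = 0
      weight (app _ ts) = suc (weights ts)

      weights : ∀ {Δ Θ} → All (Term 𝓛vg Δ) Θ → ℕ
      weights []       = 0
      weights (t ∷ ts) = weight t + weights ts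

    rank : ∀ {Δ} → Formula 𝓛vg Δ → ℕ
    rank (t ≐ u)     = weight t + weight u
    rank (atom _ ts) = weights ts
    rank (neg φ)     = rank φ
    rank (φ ∧ ψ)     = rank φ ⊔ rank ψ
    rank (ex _ φ)    = suc (rank φ)

  record MatchesEnv {r Δ} (S : St r) (ρ ρ′ : Env Δ) : Set a where
    constructor env
    field at : ∀ {s} (i : s ∈ Δ) → Matches S s (All.lookup ρ i) (All.lookup ρ′ i)

  open MatchesEnv

  matches-fun : ∀ {Δ s} (F : VgFun Δ s) {r} (S : St (suc r)) {xs xs′} → MatchesEnv S xs xs′ →
    Σ (St r) λ T → S ⊑ T × Matches T s (Structure.fun 𝓜 F xs) (Structure.fun 𝓜 F xs′)
  matches-fun plus S {x ∷ y ∷ []} {x′ ∷ y′ ∷ []} m with z′ , T , c , S⊑T ← forth S (x ∙ y) =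
    T , S⊑T , corresponds-resp T refl
      (sym (corresponds-∙ T (S⊑T (at m (here ≡.refl))) (S⊑T (at m (there (here ≡.refl)))) c)) c
  matches-fun zero S {[]} {[]} m with z′ , T , c , S⊑T ← forth S ε =
    T , S⊑T , corresponds-resp T refl (corresponds-ε T c) c
  matches-fun val S {x ∷ []} {x′ ∷ []} m with T , S⊑T ← drop (n≤1+n _) S =
    T , S⊑T , x , x′ , S⊑T (at m (here ≡.refl)) , Eq.refl , Eq.refl
  matches-fun infinity S {[]} {[]} m with z′ , T , c , S⊑T ← forth S ε =
    T , S⊑T , ε , ε , corresponds-resp T refl (corresponds-ε T c) c , Eq.sym (v-ε V) ,
        Eq.sym (v-ε V)

  matches-env : ∀ {r r′ Δ} {S : St r} {T : St r′} → S ⊑ T → {ρ ρ′ : Env Δ} → MatchesEnv S ρ ρ′ →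
      MatchesEnv T ρ ρ′
  matches-env {S = S} {T} S⊑T m = env λ i → matches-⊑ {S = S} {T} S⊑T (at m i)

  mutual
    matches-term : ∀ {Δ s} (t : Term 𝓛vg Δ s) {r} (S : St (weight t + r)) {ρ ρ′} →
        MatchesEnv S ρ ρ′ →
      Σ (St r) λ T → S ⊑ T × Matches T s (eval 𝓜 ρ t) (eval 𝓜 ρ′ t)
    matches-term (var i) S m = S , (λ c → c) , at m i
    matches-term (app F ts) {r} S m
      with S′ , S⊑S′ ← drop (≤-reflexive (+-suc (weights ts) r)) S
      with T , S′⊑T , m′ ← matches-terms ts {suc r} S′ (matches-env {S = S} {S′} S⊑S′ m)
      with T′ , T⊑T′ , m″ ← matches-fun F T m′ =
      T′ , (λ c → T⊑T′ (S′⊑T (S⊑S′ c))) , m″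

    matches-terms : ∀ {Δ Θ} (ts : All (Term 𝓛vg Δ) Θ) {r} (S : St (weights ts + r)) {ρ ρ′} →
        MatchesEnv S ρ ρ′ →
      Σ (St r) λ T → S ⊑ T × MatchesEnv T (evals 𝓜 ρ ts) (evals 𝓜 ρ′ ts)
    matches-terms [] S m = S , (λ c → c) , env λ ()
    matches-terms (t ∷ ts) {r} S m
      with S′ , S⊑S′ ← drop (≤-reflexive (≡.sym (+-assoc (weight t) (weights ts) r))) S
      with T , S′⊑T , m′ ← matches-term t {weights ts + r} S′ (matches-env {S = S} {S′} S⊑S′ m)
      with T′ , T⊑T′ , m″ ← matches-terms ts T
             (matches-env {S = S′} {T} S′⊑T (matches-env {S = S} {S′} S⊑S′ m)) =
      T′ , (λ c → T⊑T′ (S′⊑T (S⊑S′ c))) ,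
      env λ { (here ≡.refl) → matches-⊑ {S = T} {T′} T⊑T′ m′ ; (there i) → at m″ i }

  matches-≈ : ∀ s {r} (S : St r) {x x′ y y′} → Matches S s x x′ → Matches S s y y′ →
              Setoid._≈_ (Dom s) x y → Setoid._≈_ (Dom s) x′ y′
  matches-≈ group S {x} {x′} {y} {y′} c d x≈y with T , S⊑T ← drop z≤n S =
    x∙y⁻¹≈ε⇒x≈y x′ y′ (‖‖≡0 (≡.trans (agree-≡ (s≤s z≤n)
      (State.good T (sub {i = 2} (final T (S⊑T c)) (final T (S⊑T d))) (W-ε {i = 3}))
      (‖‖-cong (x≈y⇒x∙y⁻¹≈ε x≈y))) ‖ε‖))
  matches-≈ value S (x , x′ , c , e , e′) (y , y′ , d , h , h′) γ≈δ =
    Eq.trans e′ (Eq.trans (δ-injective (agree-≡ (s≤s z≤n) (corresponds-agree S c d)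
      (δ-cong (Eq.trans (Eq.sym e) (Eq.trans γ≈δ h))))) (Eq.sym h′))

  matches-rel : ∀ {Θ} (P : VgRel Θ) {r} (S : St r) {xs xs′} → MatchesEnv S xs xs′ →
                Structure.rel 𝓜 P xs → Structure.rel 𝓜 P xs′
  matches-rel leq S {γ ∷ η ∷ []} {γ′ ∷ η′ ∷ []} m γ≤η
    with x , x′ , c , e , e′ ← at m (here ≡.refl) | y , y′ , d , h , h′ ← at m (there (here ≡.refl))
        =
    Γ.≤-respˡ-≈ (Eq.sym e′) (Γ.≤-respʳ-≈ (Eq.sym h′) (δ-cancel
      (agree-≤ (s≤s z≤n) (corresponds-agree S d c) (δ-anti (Γ.≤-respˡ-≈ e (Γ.≤-respʳ-≈ h γ≤η))))))

  matches-forth : ∀ s {r} (S : St (suc r)) (x : Sort⟦ s ⟧) →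
                  ∃ λ x′ → Σ (St r) λ T → S ⊑ T × Matches T s x x′
  matches-forth group S x with x′ , T , c , S⊑T ← forth S x = x′ , T , S⊑T , c
  matches-forth value S γ with x , vx≈ ← ValuedAbelianGroup.surjective V γ with x′ , T , c , S⊑T ←
      forth S x =
    v x′ , T , S⊑T , x , x′ , c , Eq.sym (vx≈ refl) , Eq.refl

  transfer : ∀ {Δ} (φ : Formula 𝓛vg Δ) {r} (S : St r) → rank φ ≤ r → {ρ ρ′ : Env Δ} →
      MatchesEnv S ρ ρ′ →
             _⊨_ 𝓜 ρ φ → _⊨_ 𝓜 ρ′ φ
  transfer (_≐_ {s} t u) S rk {ρ} {ρ′} m eq
    with S₀ , S⊑S₀ ← drop rk S
    with S₁ , S₀⊑S₁ , mt ← matches-term t {weight u} S₀ (matches-env {S = S} {S₀} S⊑S₀ m)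
    with S₂ , S₁⊑S₂ ← drop {weight u + 0} (≤-reflexive (+-identityʳ (weight u))) S₁
    with S₃ , S₂⊑S₃ , mu ← matches-term u {0} S₂ (matches-env {S = S₀} {S₂} (λ c → S₁⊑S₂ (S₀⊑S₁ c))
        (matches-env {S = S} {S₀} S⊑S₀ m)) =
    matches-≈ s S₃ (matches-⊑ {S = S₁} {S₃} (λ c → S₂⊑S₃ (S₁⊑S₂ c)) mt) mu eq
  transfer (atom P ts) S rk m h
    with S₀ , S⊑S₀ ← drop {weights ts + 0} (≤-trans (≤-reflexive (+-identityʳ (weights ts))) rk) S
    with S₁ , _ , m′ ← matches-terms ts {0} S₀ (matches-env {S = S} {S₀} S⊑S₀ m) =
    matches-rel P S₁ m′ h
  -- Truth is carried in one direction only, so a negation exchanges the two sides.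
  transfer (neg φ) S rk m ¬h h′ = ¬h (transfer φ (flip S) rk (env λ i → matches-flip S (at m i)) h′)
  transfer (φ ∧ ψ) S rk m (h , h′) =
    transfer φ S (m⊔n≤o⇒m≤o (rank φ) (rank ψ) rk) m h ,
        transfer ψ S (m⊔n≤o⇒n≤o (rank φ) (rank ψ) rk) m h′
  transfer (ex s φ) S (s≤s rk) m (x , h) with x′ , T , S⊑T , mx ← matches-forth s S x =
    x′ , transfer φ T rk (env λ { (here ≡.refl) → mx ; (there i) →
        matches-⊑ {S = S} {T} S⊑T (at m i) }) h

  Names : ∀ s → Carrier → Sort⟦ s ⟧ → Set a
  Names group p x = p ≈ x
  Names value p γ = v p Γ.≈ γ

  name : ∀ s (x : Sort⟦ s ⟧) → ∃ λ p → Names s p x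
  name group x = x , refl
  name value γ with p , vp≈ ← ValuedAbelianGroup.surjective V γ = p , vp≈ refl

  parameters : ∀ {Δ} (ρ : Env Δ) → ∃ λ ps → ∀ {s} (i : s ∈ Δ) → ∃ λ p →
      p ∈ ps × Names s p (All.lookup ρ i)
  parameters [] = [] , λ ()
  parameters {s ∷ Δ} (x ∷ ρ) with ps , named ← parameters ρ | p , p-names ← name s x =
    p ∷ ps , λ { (here ≡.refl) → p , here ≡.refl , p-names
               ; (there i) → let q , q∈ , n = named i in q , there q∈ , n }

  named-matches : ∀ s {r} (S : St r) {p x} → Names s p x → Corresponds S p p → Matches S s x x
  named-matches group S n c = corresponds-resp S n n c
  named-matches value S {p} n c = p , p , c , Eq.sym n , Eq.sym n

  minimal : IsMinimalValuedGroup V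
  minimal = infinite , dichotomy
    where
    dichotomy : ∀ {Δ} (φ : Formula 𝓛vg (group ∷ Δ)) (ρ : Env Δ) →
      Finite setoid (DefinedBy 𝓜 φ ρ) ⊎ Finite setoid (∁ (DefinedBy 𝓜 φ ρ))
    dichotomy φ ρ with ps , named ← parameters ρ
      with em {P = ∃ λ x → Start.depth 3 (rank φ) ps ≤ ‖ x ‖ × DefinedBy 𝓜 φ ρ x}
    ... | yes (x , x≥ , φx) = inj₂ (within λ y ¬φy → ≰⇒> λ y≥ → ¬φy (move x≥ y≥ φx))
      where
      within : (∀ y → ¬ DefinedBy 𝓜 φ ρ y → ‖ y ‖ < Start.depth 3 (rank φ) ps) →
               Finite setoid (∁ (DefinedBy 𝓜 φ ρ))
      within small with ys , cover ← depth-balls (Start.depth 3 (rank φ) ps) =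
        ys , λ y ¬φy → cover y (<⇒≤ (small y ¬φy))
      move : ∀ {x y} → Start.depth 3 (rank φ) ps ≤ ‖ x ‖ → Start.depth 3 (rank φ) ps ≤ ‖ y ‖ →
             DefinedBy 𝓜 φ ρ x → DefinedBy 𝓜 φ ρ y
      move x≥ y≥ with S , c , fixed ← Start.state 3 (rank φ) ps x≥ y≥ =
        transfer φ S ≤-refl $ env λ { (here ≡.refl) → c
          ; {s} (there i) → named-matches s S (proj₂ (proj₂ (named i)))
              (fixed (proj₁ (proj₂ (named i)))) }
    ... | no ¬deep with ys , cover ← depth-balls (Start.depth 3 (rank φ) ps) =
      inj₁ (ys , λ y φy → cover y (≰⇒≥ λ y≥ → ¬deep (y , y≥ , φy)))

-- Minimality of Γ

module ValueFunctions (em : ∀ {ℓ} → ExcludedMiddle ℓ) {a} (V : ValuedAbelianGroup a)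
  (ω* : HasOrderTypeω* V) (fibres : HasFiniteFibres V) where
  open ValuedAbelianGroup V hiding (surjective)
  open Γ using (module Eq) renaming (_≈_ to _≈ᵛ_; _≉_ to _≉ᵛ_; _≤_ to _≤ᵛ_)
  open AbelianGroup G
  open Depth V ω* fibres
  open UltraNorm ultraNorm using (‖_‖; ‖‖-cong; ‖ε‖; ‖‖≡0)
  open UltraNormProperties ultraNorm
  open Multiples G
  open Scalars ultraNorm

  fⁿ : ℕ → Γ.Carrier → Γ.Carrier
  fⁿ = f⟨_⟩ V em

  atValue : ∀ γ → ∃ λ x → v x ≈ᵛ γ
  atValue γ with x , vx≈ ← ValuedAbelianGroup.surjective V γ = x , vx≈ refl

  fⁿ-≈ : ∀ n {γ η} → (∀ x → v x ≈ᵛ γ → v (n · x) ≈ᵛ η) → fⁿ n γ ≈ᵛ η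
  fⁿ-≈ n {γ} {η} w with em {P = WellDefinedAt V n γ}
  ... | no ¬w = ⊥-elim (¬w (η , w))
  ... | yes (η′ , w′) with x , vx≈γ ← atValue γ = Eq.trans (Eq.sym (w′ x vx≈γ)) (w x vx≈γ)

  fⁿ-cases : ∀ n γ → (∀ x → v x ≈ᵛ γ → v (n · x) ≈ᵛ fⁿ n γ) ⊎ (¬ WellDefinedAt V n γ × fⁿ n γ ≈ᵛ ∞)
  fⁿ-cases n γ with em {P = WellDefinedAt V n γ}
  ... | yes (_ , w) = inj₁ w
  ... | no ¬w       = inj₂ (¬w , Eq.refl)

  fⁿ-bound : ∀ n γ → δ (fⁿ n γ) ≤ δ γ
  fⁿ-bound n γ with fⁿ-cases n γ
  ... | inj₂ (_ , e) = subst (_≤ δ γ) (≡.sym (≡.trans (δ-cong e) δ∞)) z≤n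
  ... | inj₁ w with x , vx≈γ ← atValue γ =
    ≤-trans (≤-reflexive (δ-cong (Eq.sym (w x vx≈γ))))
        (≤-trans (‖‖-· n x) (≤-reflexive (δ-cong vx≈γ)))

  fⁿ-kills : ∀ n → Kills n → ∀ γ → δ (fⁿ n γ) ≡ 0
  fⁿ-kills n kills γ = ≡.trans (δ-cong (fⁿ-≈ n λ x _ → Eq.trans (v-cong (kills x)) (v-ε V))) δ∞

  -- A shift determines the norm of `n · x` from that of `x`, so `f n` is well-defined at large
  -- depth and its default value does not interfere.
  fⁿ-shift : ∀ n {o N} → ShiftsBy n o N → ∀ γ → N ≤ δ γ → δ (fⁿ n γ) + o ≡ δ γ
  fⁿ-shift n {o} {N} shift γ N≤ with x , vx≈γ ← atValue γ =
    ≡.trans (cong (_+ o) (δ-cong (fⁿ-≈ n {γ} {v (n · x)} λ y vy≈γ → δ-injective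
      (+-cancelʳ-≡ o _ _ (≡.trans (moved y vy≈γ) (≡.sym (moved x vx≈γ)))))))
      (moved x vx≈γ)
    where
    moved : ∀ y → v y ≈ᵛ γ → ‖ n · y ‖ + o ≡ δ γ
    moved y vy≈γ = ≡.trans (shift y (subst (N ≤_) (δ-cong (Eq.sym vy≈γ)) N≤)) (δ-cong vy≈γ)

  <⇒OpenBall : ∀ {γ x} → ‖ x ‖ < δ γ → OpenBall V γ x
  <⇒OpenBall {γ} {x} lt = δ-cancel (<⇒≤ lt) , λ e → <⇒≢ lt (≡.sym (δ-cong e))

  OpenBall⇒< : ∀ {γ x} → OpenBall V γ x → ‖ x ‖ < δ γ
  OpenBall⇒< {γ} {x} (γ≤ , γ≉) = ≤∧≢⇒< (δ-anti γ≤) (λ e → γ≉ (δ-injective (≡.sym e)))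

  large⇒wide : ∀ m {γ} → LargeQuotient V m γ → Wide m (δ γ)
  large⇒wide m {γ} (_ , inj) = (λ i → proj₁ (to i)) , (λ i → δ-anti (proj₂ (to i))) ,
    λ {i} {j} i≢j → ≮⇒≥ λ lt →
      i≢j (injective (<⇒OpenBall {γ} {proj₁ (to i) - proj₁ (to j)} lt))
    where open Injection inj

  wide⇒large : ∀ m {γ} → γ ≉ᵛ ∞ → Wide m (δ γ) → LargeQuotient V m γ
  wide⇒large m {γ} γ≉∞ (F , F≤ , sep) = γ≉∞ , record
    { to = to ; cong = λ { {i} ≡.refl → Q.refl {to i} } ; injective = injective }
    where
    module Q = AbelianGroup (ballQuotient V γ γ≉∞)
    to : Fin (suc m) → Q.Carrier
    to i = F i , δ-cancel (F≤ i)
    injective : ∀ {i j} → to i Q.≈ to j → i ≡ j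
    injective {i} {j} close with i Fin.≟ j
    ... | yes i≡j = i≡j
    ... | no i≢j  = ⊥-elim (<⇒≱ (OpenBall⇒< {γ} {F i - F j} close) (sep i≢j))

  0<δ⇒≉∞ : ∀ {γ} → 0 < δ γ → γ ≉ᵛ ∞
  0<δ⇒≉∞ 0<δ γ≈∞ = <⇒≢ 0<δ (≡.sym (≡.trans (δ-cong γ≈∞) δ∞))

module ValueMinimality (em : ∀ {ℓ} → ExcludedMiddle ℓ) {a} (V : ValuedAbelianGroup a)
  (ω* : HasOrderTypeω* V) (fibres : HasFiniteFibres V)
  (stable : UltraNormProperties.WideStable (Depth.ultraNorm V ω* fibres))
  (scalars : Scalars.Scalars (Depth.ultraNorm V ω* fibres)) where
  open ValuedAbelianGroup V hiding (surjective)
  open Γ using (module Eq) renaming (_≈_ to _≈ᵛ_)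
  open Depth V ω* fibres
  open UltraNormProperties ultraNorm
  open Scalars ultraNorm
  open ValueFunctions em V ω* fibres

  private
    𝓝 : Structure 𝓛v a
    𝓝 = valueStructure V em
    open Structure 𝓝 using (Env)

  -- The game on Γ is played with depths, that is, natural numbers. The pair of zeros is always
  -- present: small depths, and the default value `∞` of `f n`, are measured from it.
  record Position (S : ℕ) : Set₁ where
    field
      Pair  : ℕ → ℕ → Set
      zero₂ : Pair 0 0
      agree : ∀ {m m′ n n′} → Pair m m′ → Pair n n′ → Agree S m m′ n n′

    DisplacedPair : ℕ → ℕ → ℕ → Set
    DisplacedPair O = Displaced O Pair

    displacedPairs-agree : ∀ {T O} → T + (O + O) ≤ S → ∀ {m m′ n n′} →
      DisplacedPair O m m′ → DisplacedPair O n n′ → Agree T m m′ n n′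
    displacedPairs-agree ≤S = displaced-agree (λ p q → agree-mono ≤S (agree p q))

    displacedZero : ∀ {O} → DisplacedPair O 0 0
    displacedZero = displaced 0 0 zero₂ ≡.refl ≡.refl z≤n z≤n

    -- Distances from 0 are known exactly below `N`, so the finitely many depths at which a function
    -- or a relation may be irregular are matched with themselves.
    deepOrEqual : ∀ {O} N → suc N + (O + O) ≤ S → ∀ {m m′} → DisplacedPair O m m′ →
                  (N ≤ m × N ≤ m′) ⊎ (m ≡ m′ × m < N)
    deepOrEqual N ≤S {m} {m′} d with N ≤? m | N ≤? m′
    ... | yes N≤m | yes N≤m′ = inj₁ (N≤m , N≤m′)
    ... | no N≰m | _ = inj₂ (agree-small (displacedPairs-agree ≤S d displacedZero)
        (m≤n⇒m≤1+n (≰⇒> N≰m)) , ≰⇒> N≰m)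
    ... | _ | no N≰m′ = inj₂ (≡.sym m′≡m , subst (_< N) m′≡m (≰⇒> N≰m′))
      where
      m′≡m : m′ ≡ m
      m′≡m = agree-small (agree-flip (displacedPairs-agree ≤S d displacedZero))
          (m≤n⇒m≤1+n (≰⇒> N≰m′))

  open Position

  MatchesEnv : ∀ {S Δ} → Position S → Env Δ → Env Δ → Set
  MatchesEnv {Δ = Δ} P ρ ρ′ = ∀ {s} (i : s ∈ Δ) → Pair P (δ (All.lookup ρ i)) (δ (All.lookup ρ′ i))

  scalarOffset scalarFrom : ℕ → ℕ
  scalarOffset n with scalars n
  ... | inj₁ _ = 0
  ... | inj₂ (_ , o , _) = o
  scalarFrom n with scalars n
  ... | inj₁ _ = 0
  ... | inj₂ (_ , _ , N , _) = N

  -- Bounds how far the value of a term is displaced from an entry of the position or from 0, and at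
  -- the same time the precision needed to tell whether the argument of `f n` lies below
  -- `scalarFrom n`.
  offset : ∀ {Δ} → Term 𝓛v Δ tt → ℕ
  offset (var _)            = 0
  offset (app (f n) (t ∷ [])) = suc (scalarFrom n) + (offset t + offset t) + scalarOffset n

  fⁿ-displaced : ∀ n {S O} (P : Position S) {γ γ′} → suc (scalarFrom n) + (O + O) + scalarOffset n ≤
      S →
    DisplacedPair P O (δ γ) (δ γ′) →
    DisplacedPair P (suc (scalarFrom n) + (O + O) + scalarOffset n) (δ (fⁿ n γ)) (δ (fⁿ n γ′))
  fⁿ-displaced n {S} {O} P {γ} {γ′} ≤S d with scalars n
  ... | inj₁ kills = displaced 0 0 (zero₂ P) (cong (_+ 0) (fⁿ-kills n kills γ))
      (cong (_+ 0) (fⁿ-kills n kills γ′)) z≤n z≤n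
  ... | inj₂ (_ , o , N , shift) with deepOrEqual P N (m+n≤o⇒m≤o _ ≤S) d
  ...   | inj₂ (same , <N) = displaced 0 (δ (fⁿ n γ)) (zero₂ P) (+-identityʳ _)
    (≡.trans (+-identityʳ _) (δ-cong (f-cong V em n (δ-injective (≡.sym same))))) z≤n
    (≤-trans (fⁿ-bound n γ) (≤-trans (<⇒≤ <N) (≤-trans (n≤1+n N)
        (≤-trans (m≤m+n (suc N) (O + O)) (m≤m+n _ o)))))
  ...   | inj₁ (N≤ , N≤′) = extend d
    where
    extend : DisplacedPair P O (δ γ) (δ γ′) → DisplacedPair P (suc N + (O + O) + o) (δ (fⁿ n γ))
        (δ (fⁿ n γ′))
    extend (displaced q j p e₁ e₂ q≤ j≤) = displaced (o + q) j p (add γ N≤ e₁) (add γ′ N≤′ e₂)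
      (≤-trans (≤-reflexive (+-comm o q)) (+-monoˡ-≤ o (≤-trans q≤ O≤)))
      (≤-trans j≤ (≤-trans O≤ (m≤m+n _ o)))
      where
      O≤ : O ≤ suc N + (O + O)
      O≤ = ≤-trans (m≤m+n O O) (m≤n+m (O + O) (suc N))
      add : ∀ γ → N ≤ δ γ → ∀ {e} → δ γ + q ≡ e + j → δ (fⁿ n γ) + (o + q) ≡ e + j
      add γ N≤ e = ≡.trans (≡.sym (+-assoc (δ (fⁿ n γ)) o q))
        (≡.trans (cong (_+ q) (fⁿ-shift n shift γ N≤)) e)

  offset-≤ : ∀ {N O S o} → suc N + (O + O) + o ≤ S → O ≤ S
  offset-≤ {N} {O} {S} {o} ≤S = ≤-trans (m≤m+n O O)
      (≤-trans (m≤n+m (O + O) (suc N)) (m+n≤o⇒m≤o _ ≤S))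

  term-displaced : ∀ {Δ} (t : Term 𝓛v Δ tt) {S} (P : Position S) → offset t ≤ S → ∀ {ρ ρ′} →
      MatchesEnv P ρ ρ′ →
    DisplacedPair P (offset t) (δ (eval 𝓝 ρ t)) (δ (eval 𝓝 ρ′ t))
  term-displaced (var i) P _ m = displaced 0 0 (m i) ≡.refl ≡.refl z≤n z≤n
  term-displaced (app (f n) (t ∷ [])) P ≤S m =
    fⁿ-displaced n P ≤S (term-displaced t P (offset-≤ {scalarFrom n} {offset t} ≤S) m)

  -- One more than the threshold, so that a value beyond it is not `∞`, where `Wide m` holds but
  -- `R m` does not.
  stableRadius : ℕ → ℕ
  stableRadius m = suc (proj₁ (stable m))

  -- The factor of three at a quantifier is the loss of precision in `agree-extend`; one is added
  -- because that lemma works with a positive precision.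
  need : ∀ {Δ} → Formula 𝓛v Δ → ℕ
  need (t ≐ u)                    = 1 + ((offset t + offset u) + (offset t + offset u))
  need (atom leq (t ∷ u ∷ []))    = 1 + ((offset t + offset u) + (offset t + offset u))
  need (atom (R m) (t ∷ []))      = suc (stableRadius m) + (offset t + offset t)
  need (neg φ)                    = need φ
  need (φ ∧ ψ)                    = need φ ⊔ need ψ
  need (ex _ φ)                   = suc (need φ) + (suc (need φ) + suc (need φ))

  flip : ∀ {S} → Position S → Position S
  flip P = record { Pair = λ m m′ → Pair P m′ m ; zero₂ = zero₂ P ; agree = λ p q →
      agree-flip (agree P p q) }

  large-transfer : ∀ m .{{_ : NonZero m}} {O S} (P : Position S) {γ γ′} →
      suc (stableRadius m) + (O + O) ≤ S →
    DisplacedPair P O (δ γ) (δ γ′) → LargeQuotient V m γ → LargeQuotient V m γ′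
  large-transfer m P {γ} {γ′} ≤S d large with deepOrEqual P (stableRadius m) ≤S d
  ... | inj₂ (same , _) = largeQuotient-resp V m (δ-injective same) large
  ... | inj₁ (N<γ , N<γ′) = wide⇒large m (0<δ⇒≉∞ (≤-<-trans z≤n N<γ′))
    (proj₂ (stable m) (<⇒≤ N<γ) (<⇒≤ N<γ′) (large⇒wide m large))

  two-terms : ∀ {Δ} (t u : Term 𝓛v Δ tt) {S} (P : Position S) →
    1 + ((offset t + offset u) + (offset t + offset u)) ≤ S → ∀ {ρ ρ′} → MatchesEnv P ρ ρ′ →
    Agree 1 (δ (eval 𝓝 ρ t)) (δ (eval 𝓝 ρ′ t)) (δ (eval 𝓝 ρ u)) (δ (eval 𝓝 ρ′ u))
  two-terms t u {S} P ≤S m = displacedPairs-agree P ≤S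
    (displaced-mono (m≤m+n (offset t) (offset u)) (term-displaced t P (≤-trans (m≤m+n _ _) sum≤S)
        m))
    (displaced-mono (m≤n+m (offset u) (offset t))
        (term-displaced u P (≤-trans (m≤n+m _ (offset t)) sum≤S) m))
    where
    sum≤S : offset t + offset u ≤ S
    sum≤S = ≤-trans (m≤m+n _ _) (≤-trans (n≤1+n _) ≤S)

  transfer : ∀ {Δ} (φ : Formula 𝓛v Δ) {S} (P : Position S) → need φ ≤ S → {ρ ρ′ : Env Δ} →
             MatchesEnv P ρ ρ′ → _⊨_ 𝓝 ρ φ → _⊨_ 𝓝 ρ′ φ
  transfer (t ≐ u) P ≤S m h = δ-injective (agree-≡ ≤-refl (two-terms t u P ≤S m) (δ-cong h))
  transfer (atom leq (t ∷ u ∷ [])) P ≤S m h =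
    δ-cancel (agree-≤ ≤-refl (agree-swap (two-terms t u P ≤S m)) (δ-anti h))
  transfer (atom (R k) (t ∷ [])) {S} P ≤S m h = large-transfer k P ≤S
    (term-displaced t P (≤-trans (m≤m+n _ _) (m+n≤o⇒n≤o (suc (stableRadius k)) ≤S)) m) h
  transfer (neg φ) P ≤S m ¬h h = ¬h (transfer φ (flip P) ≤S m h)
  transfer (φ ∧ ψ) P ≤S m (h , h′) =
    transfer φ P (m⊔n≤o⇒m≤o (need φ) (need ψ) ≤S) m h ,
        transfer ψ P (m⊔n≤o⇒n≤o (need φ) (need ψ) ≤S) m h′
  transfer (ex tt φ) P ≤S {ρ} {ρ′} m (γ , h) with e′ , ag ← agree-extend em (Pair P) (suc (need φ))
      (s≤s z≤n) (zero₂ P)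
      (λ p q → agree-mono ≤S (agree P p q)) (δ γ) =
    g e′ , transfer φ Q (n≤1+n _) m′ h
    where
    S′ = suc (need φ)
    Extended : ℕ → ℕ → Set
    Extended m m′ = Pair P m m′ ⊎ (m ≡ δ γ × m′ ≡ e′)
    Q : Position S′
    Q = record
      { Pair = Extended ; zero₂ = inj₁ (zero₂ P)
      ; agree = λ { (inj₁ p) (inj₁ q) → agree-mono (≤-trans (m≤m+n S′ _) ≤S) (agree P p q)
                  ; (inj₁ p) (inj₂ (≡.refl , ≡.refl)) → agree-swap (ag p)
                  ; (inj₂ (≡.refl , ≡.refl)) (inj₁ q) → ag q
                  ; (inj₂ (≡.refl , ≡.refl)) (inj₂ (≡.refl , ≡.refl)) → agree-self } }
    m′ : MatchesEnv Q (γ ∷ ρ) (g e′ ∷ ρ′)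
    m′ (here ≡.refl) = inj₂ (≡.refl , δg e′)
    m′ (there i)     = inj₁ (m i)

  bound : ∀ {Δ} (ρ : Env Δ) → ∃ λ b → ∀ {s} (i : s ∈ Δ) → δ (All.lookup ρ i) ≤ b
  bound []      = 0 , λ ()
  bound (γ ∷ ρ) with b , bd ← bound ρ = δ γ ⊔ b , λ
    { (here ≡.refl) → m≤m⊔n (δ γ) b ; (there i) → m≤n⇒m≤o⊔n (δ γ) (bd i) }

  move : ∀ {Δ} (φ : Formula 𝓛v (tt ∷ Δ)) (ρ : Env Δ) {γ γ′} →
         proj₁ (bound ρ) + need φ ≤ δ γ → proj₁ (bound ρ) + need φ ≤ δ γ′ →
         DefinedBy 𝓝 φ ρ γ → DefinedBy 𝓝 φ ρ γ′
  move φ ρ {γ} {γ′} γ≥ γ′≥ = transfer φ P ≤-refl λ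
    { (here ≡.refl) → inj₂ (≡.refl , ≡.refl) ; (there i) → inj₁ (≡.refl , proj₂ (bound ρ) i) }
    where
    b = proj₁ (bound ρ)
    Pairs : ℕ → ℕ → Set
    Pairs m m′ = (m ≡ m′ × m ≤ b) ⊎ (m ≡ δ γ × m′ ≡ δ γ′)
    P : Position (need φ)
    P = record
      { Pair = Pairs ; zero₂ = inj₁ (≡.refl , z≤n)
      ; agree = λ { (inj₁ (≡.refl , _)) (inj₁ (≡.refl , _)) → agree-refl
                  ; (inj₁ (≡.refl , m≤b)) (inj₂ (≡.refl , ≡.refl)) →
                      below (≤-trans (+-monoˡ-≤ _ m≤b) γ≥) (≤-trans (+-monoˡ-≤ _ m≤b) γ′≥)
                  ; (inj₂ (≡.refl , ≡.refl)) (inj₁ (≡.refl , m≤b)) →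
                      above (≤-trans (+-monoˡ-≤ _ m≤b) γ≥) (≤-trans (+-monoˡ-≤ _ m≤b) γ′≥)
                  ; (inj₂ (≡.refl , ≡.refl)) (inj₂ (≡.refl , ≡.refl)) → agree-self } }

  minimal : Infinite valueSetoid → IsMinimalValueSet V em
  minimal infiniteΓ = infiniteΓ , dichotomy
    where
    dichotomy : ∀ {Δ} (φ : Formula 𝓛v (tt ∷ Δ)) (ρ : Env Δ) →
      Finite valueSetoid (DefinedBy 𝓝 φ ρ) ⊎ Finite valueSetoid (∁ (DefinedBy 𝓝 φ ρ))
    dichotomy φ ρ with ys , cover ← upset (proj₁ (bound ρ) + need φ)
      with em {P = ∃ λ γ → proj₁ (bound ρ) + need φ ≤ δ γ × DefinedBy 𝓝 φ ρ γ}
    ... | yes (γ , γ≥ , φγ) = inj₂ (ys , λ η ¬φη → cover η (≰⇒≥ λ η≥ → ¬φη (move φ ρ γ≥ η≥ φγ)))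
    ... | no ¬deep = inj₁ (ys , λ η φη → cover η (≰⇒≥ λ η≥ → ¬deep (η , η≥ , φη)))

-- Torsion and divisibility

module _ {p} (p-prime : Prime p) where

  prime∤⇒coprime : ∀ {c} → ¬ p ∣ c → Coprime c p
  prime∤⇒coprime p∤c {d} (d∣c , d∣p) with prime⇒irreducible p-prime d∣p
  ... | inj₁ d≡1    = d≡1
  ... | inj₂ ≡.refl = ⊥-elim (p∤c d∣c)

  prime∣^ : ∀ {q} k → Prime q → q ∣ p ^ k → q ≡ p
  prime∣^ {q} zero q-prime q∣1 = ⊥-elim (¬prime[1] (subst Prime (∣1⇒≡1 q∣1) q-prime))
  prime∣^ {q} (suc k) q-prime q∣ with euclidsLemma p (p ^ k) q-prime q∣
  ... | inj₂ q∣pᵏ = prime∣^ k q-prime q∣pᵏ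
  ... | inj₁ q∣p with prime⇒irreducible p-prime q∣p
  ...   | inj₁ ≡.refl = ⊥-elim (¬prime[1] q-prime)
  ...   | inj₂ q≡p    = q≡p

  prime≢⇒coprime : ∀ {q} k → Prime q → q ≢ p → Coprime q (p ^ k)
  prime≢⇒coprime {q} k q-prime q≢p {d} (d∣q , d∣pᵏ) with prime⇒irreducible q-prime d∣q
  ... | inj₁ d≡1    = d≡1
  ... | inj₂ ≡.refl = ⊥-elim (q≢p (prime∣^ k q-prime d∣pᵏ))

module Torsion {c ℓ} (G : AbelianGroup c ℓ) where
  open AbelianGroup G
  open AbelianGroupProperties G
  open Multiples G
  open SetoidReasoning setoid

  invert : ∀ {b m} → Coprime b m → ∃ λ i → ∀ x → m · x ≈ ε → i · (b · x) ≈ x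
  invert {b} {m} b⊥m with coprime-Bézout b⊥m
  ... | Bézout.+- i j 1+jm≡ib = i , λ x mx≈ε → begin
    i · (b · x)       ≈⟨ ×-assocˡ x i b ⟩
    (i * b) · x       ≡⟨ cong (_· x) 1+jm≡ib ⟨
    x ∙ (j * m) · x   ≈⟨ ∙-congˡ (×-assocˡ x j m) ⟨
    x ∙ j · (m · x)   ≈⟨ ∙-congˡ (trans (×-congʳ j mx≈ε) (×-ε j)) ⟩
    x ∙ ε             ≈⟨ identityʳ x ⟩
    x                 ∎
  ... | Bézout.-+ i j 1+ib≡jm with m
  ...   | zero  = ⊥-elim (1+n≢0 (≡.trans 1+ib≡jm (*-zeroʳ j)))
  -- Here `i * b` is -1 modulo `m`, so `i` is multiplied by `n`, which acts as -1 on the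
  -- `m`-torsion.
  ...   | suc n = n * i , λ x mx≈ε → let w = (i * b) · x in begin
    (n * i) · (b · x)  ≈⟨ ×-assocˡ (b · x) n i ⟨
    n · (i · (b · x))  ≈⟨ ×-congʳ n (×-assocˡ x i b) ⟩
    n · w              ≈⟨ inverseʳ-unique w (n · w)
        (trans (×-comm (suc n) (i * b) x) (trans (×-congʳ (i * b) mx≈ε) (×-ε (i * b)))) ⟩
    w ⁻¹               ≈⟨ inverseˡ-unique x w (trans (×-congˡ 1+ib≡jm)
        (trans (sym (×-assocˡ x j (suc n))) (trans (×-congʳ j mx≈ε) (×-ε j)))) ⟨
    x                  ∎

  PowerTorsion : ℕ → Set (c Level.⊔ ℓ)
  PowerTorsion p = ∀ x → ∃ λ k → (p ^ k) · x ≈ ε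

module TorsionScalars {a} {G : AbelianGroup a a} (U : UltraNorm G) where
  open AbelianGroup G
  open UltraNorm U
  open UltraNormProperties U
  open Multiples G
  open Torsion G
  open Scalars U

  -- No multiplication raises the norm, so one that is undone by another preserves it.
  unit-norm : ∀ {i b x} → i · (b · x) ≈ x → ‖ b · x ‖ + 0 ≡ ‖ x ‖
  unit-norm {i} {b} {x} eq = ≡.trans (+-identityʳ _) (≤-antisym (‖‖-· b x)
    (subst (_≤ ‖ b · x ‖) (‖‖-cong eq) (‖‖-· i (b · x))))

  elementary-scalars : ∀ {p} → Prime p → Kills p → Scalars
  elementary-scalars {p} p-prime kills c with p ∣? c
  ... | yes (divides j ≡.refl) = inj₁ λ x →
    trans (sym (×-assocˡ x j p)) (trans (×-congʳ j (kills x)) (×-ε j))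
  ... | no p∤c with i , inv ← invert (prime∤⇒coprime p-prime p∤c) = inj₂
    ( (λ x → i · x , trans (×-comm c i x) (inv x (kills x)))
    , 0 , 0 , λ x _ → unit-norm {i} {c} (inv x (kills x)))

  shifts-* : ∀ {b c o o′ N N′} → ShiftsBy b o N → ShiftsBy c o′ N′ →
      ShiftsBy (b * c) (o + o′) (N + o′ + N′)
  shifts-* {b} {c} {o} {o′} {N} {N′} sb sc x x≥ = ≡.trans (≡.sym (+-assoc _ o o′)) (≡.trans
    (cong (_+ o′) (≡.trans (cong (_+ o) (‖‖-cong (sym (×-assocˡ x b c)))) (sb (c · x) cx≥)))
    cx)
    where
    cx : ‖ c · x ‖ + o′ ≡ ‖ x ‖
    cx = sc x (≤-trans (m≤n+m N′ (N + o′)) x≥)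
    cx≥ : N ≤ ‖ c · x ‖
    cx≥ = +-cancelʳ-≤ o′ N _ (≤-trans (m≤m+n (N + o′) N′) (≤-trans x≥ (≤-reflexive (≡.sym cx))))

  -- A prime other than `p` acts invertibly on each element, whose order is a power of `p`; so it is
  -- onto and preserves norms. A composite scalar is a product of primes, and the shifts add up.
  primary-scalars : ∀ {p} → Prime p → PowerTorsion p → Onto p → ∃₂ (ShiftsBy p) → Scalars
  primary-scalars {p} p-prime torsion onto-p shift-p zero = inj₁ λ _ → refl
  primary-scalars {p} p-prime torsion onto-p shift-p c@(suc _) with factorise c
  ... | record { factors = ps ; isFactorisation = eq ; factorsPrime = primes } =
    inj₂ (subst (λ c → Onto c × ∃₂ (ShiftsBy c)) (≡.sym eq) (go ps primes))
    where
    prime-case : ∀ q → Prime q → Onto q × ∃₂ (ShiftsBy q)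
    prime-case q q-prime with q ≟ p
    ... | yes ≡.refl = onto-p , shift-p
    ... | no q≢p = onto , 0 , 0 , λ x _ → unit-norm {proj₁ (undo x)} {q} (proj₂ (undo x))
      where
      undo : ∀ x → ∃ λ i → i · (q · x) ≈ x
      undo x with k , pᵏx≈ε ← torsion x with i , inv ← invert (prime≢⇒coprime p-prime k q-prime q≢p)
          =
        i , inv x pᵏx≈ε
      onto : Onto q
      onto x with i , eq ← undo x = i · x , trans (×-comm q i x) eq

    go : ∀ ps → All Prime ps → Onto (product ps) × ∃₂ (ShiftsBy (product ps))
    go [] [] = onto-1 , 0 , 0 , λ x _ → ≡.trans (+-identityʳ _) (‖‖-cong (×-homo-1 x))
    go (q ∷ qs) (q-prime ∷ primes) with prime-case q q-prime | go qs primes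
    ... | onto , o , N , shift | onto′ , o′ , N′ , shift′ =
      onto-* {q} {product qs} onto onto′ , o + o′ , N + o′ + N′ , shifts-* {q} {product qs} shift
          shift′

-- Prüfer groups and their powers

-- All that is used of the Prüfer group is a chain of generators; rational numbers enter only in the
-- proof that `Prüfer p` has one.
record Quasicyclic {c ℓ} (p : ℕ) (P : AbelianGroup c ℓ) : Set (c Level.⊔ ℓ) where
  open AbelianGroup P
  open Multiples P
  field
    u         : ℕ → Carrier
    u₀≈ε      : u 0 ≈ ε
    step      : ∀ k → p · u (suc k) ≈ u k
    u₁≉ε      : ¬ (u 1 ≈ ε)
    generates : ∀ x → ∃₂ λ n k → n · u k ≈ x

module PrüferGenerators {p} (p-prime : Prime p) where
  open AbelianGroup (Prüfer p) using (_≈_; Carrier; ε)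
  open Multiples (Prüfer p)

  instance
    p≢0 : NonZero p
    p≢0 = prime⇒nonZero p-prime

  pᵏ≢0 : ∀ k → NonZero (p ^ k)
  pᵏ≢0 k = m^n≢0 p k

  1/ : (n : ℕ) .{{_ : NonZero n}} → ℚ
  1/ n = + 1 ℚ./ n

  ι : ℕ → ℚ
  ι n = fromℤ (+ n)

  inverse-1/ : ∀ n .{{_ : NonZero n}} → (ι n) ℚ.* 1/ n ≡ ℚ.1ℚ
  inverse-1/ (suc n) = ℚ.toℚᵘ-injective (begin-equality
    ℚ.toℚᵘ ((ι (suc n)) ℚ.* 1/ (suc n))               ≃⟨ ℚ.toℚᵘ-homo-* (ι (suc n)) (1/ (suc n)) ⟩
    ℚ.toℚᵘ (ι (suc n)) ℚᵘ.* ℚ.toℚᵘ (1/ (suc n))       ≃⟨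
        ℚᵘ.*-cong (ℚ.toℚᵘ-fromℚᵘ (mkℚᵘ (+ suc n) 0)) (ℚ.toℚᵘ-fromℚᵘ (mkℚᵘ (+ 1) n)) ⟩
    mkℚᵘ (+ suc n) 0 ℚᵘ.* mkℚᵘ (+ 1) n              ≃⟨
        *≡* (≡.trans (ℤ.*-identityʳ _) (≡.trans (ℤ.*-comm (+ suc n) (+ 1))
        (cong (+ 1 ℤ.*_) (cong (λ m → + suc m) (≡.sym (+-identityʳ n)))))) ⟩
    ℚᵘ.1ℚᵘ                                          ∎)
    where open ℚᵘ.≤-Reasoning

  open ≡.≡-Reasoning

  fromℤ-injective : ∀ {y z} → fromℤ y ≡ fromℤ z → y ≡ z
  fromℤ-injective {y} {z} eq = unpack (ℚᵘ.≃-trans (ℚᵘ.≃-sym (ℚ.toℚᵘ-fromℚᵘ (mkℚᵘ y 0)))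
    (ℚᵘ.≃-trans (ℚ.toℚᵘ-cong eq) (ℚ.toℚᵘ-fromℚᵘ (mkℚᵘ z 0))))
    where
    unpack : mkℚᵘ y 0 ℚᵘ.≃ mkℚᵘ z 0 → y ≡ z
    unpack (*≡* e) = ≡.trans (≡.sym (ℤ.*-identityʳ y)) (≡.trans e (ℤ.*-identityʳ z))

  ι-* : ∀ m n → (ι (m * n)) ≡ (ι m) ℚ.* (ι n)
  ι-* m n = ≡.trans (cong fromℤ (ℤ.pos-* m n)) (fromℤ-homo-* (+ m) (+ n))

  1/-* : ∀ m n .{{_ : NonZero m}} .{{_ : NonZero n}} .{{_ : NonZero (m * n)}} →
      (ι m) ℚ.* 1/ (m * n) ≡ 1/ n
  1/-* m n = begin
    (ι m) ℚ.* r                          ≡⟨ ℚ.*-identityˡ _ ⟨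
    ℚ.1ℚ ℚ.* ((ι m) ℚ.* r)               ≡⟨ cong (ℚ._* ((ι m) ℚ.* r))
        (≡.trans (ℚ.*-comm (1/ n) (ι n)) (inverse-1/ n)) ⟨
    1/ n ℚ.* (ι n) ℚ.* ((ι m) ℚ.* r)     ≡⟨ ℚ.*-assoc (1/ n) (ι n) ((ι m) ℚ.* r) ⟩
    1/ n ℚ.* ((ι n) ℚ.* ((ι m) ℚ.* r))   ≡⟨ cong (1/ n ℚ.*_) (ℚ.*-assoc (ι n) (ι m) r) ⟨
    1/ n ℚ.* ((ι n) ℚ.* (ι m) ℚ.* r)     ≡⟨ cong (λ q → 1/ n ℚ.* (q ℚ.* r))
        (≡.trans (ℚ.*-comm (ι n) (ι m)) (≡.sym (ι-* m n))) ⟩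
    1/ n ℚ.* ((ι (m * n)) ℚ.* r)           ≡⟨ cong (1/ n ℚ.*_) (inverse-1/ (m * n)) ⟩
    1/ n ℚ.* ℚ.1ℚ                        ≡⟨ ℚ.*-identityʳ _ ⟩
    1/ n                                 ∎
    where r = 1/ (m * n)

  proj₁-· : ∀ n (x : Carrier) → proj₁ (n · x) ≡ (ι n) ℚ.* proj₁ x
  proj₁-· zero    (q , _) = ≡.sym (ℚ.*-zeroˡ q)
  proj₁-· (suc n) x@(q , _) = begin
    q ℚ.+ proj₁ (n · x)              ≡⟨ cong₂ ℚ._+_ (≡.sym (ℚ.*-identityˡ q)) (proj₁-· n x) ⟩
    ℚ.1ℚ ℚ.* q ℚ.+ (ι n) ℚ.* q       ≡⟨ ℚ.*-distribʳ-+ q ℚ.1ℚ (ι n) ⟨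
    (ℚ.1ℚ ℚ.+ (ι n)) ℚ.* q           ≡⟨ cong (ℚ._* q) (fromℤ-homo-+ (+ 1) (+ n)) ⟨
    (ι (suc n)) ℚ.* q                  ∎

  ≡⇒≈ : ∀ {x y : Carrier} → proj₁ x ≡ proj₁ y → x ≈ y
  ≡⇒≈ {q , _} {r , _} ≡.refl = + 0 , ℚ.+-inverseʳ q

  1/p^ : ℕ → ℚ
  1/p^ k = 1/ (p ^ k) {{pᵏ≢0 k}}

  inverse-1/p^ : ∀ k → (ι (p ^ k)) ℚ.* 1/p^ k ≡ ℚ.1ℚ
  inverse-1/p^ k = inverse-1/ (p ^ k) {{pᵏ≢0 k}}

  generator : ℕ → Carrier
  generator k = 1/p^ k , k , + 1 , inverse-1/p^ k

  generator-step : ∀ k → p · generator (suc k) ≈ generator k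
  generator-step k = ≡⇒≈ {p · generator (suc k)} {generator k}
    (≡.trans (proj₁-· p (generator (suc k))) (1/-* p (p ^ k) {{p≢0}} {{pᵏ≢0 k}} {{pᵏ≢0 (suc k)}}))

  1≢p*n : ∀ n → 1 ≢ p * n
  1≢p*n n eq = ¬prime[1] (subst Prime (m*n≡1⇒m≡1 p n (≡.sym eq)) p-prime)

  generator₁≉ε : ¬ (generator 1 ≈ ε)
  generator₁≉ε (z , eq) = 1≢p*n ℤ.∣ z ∣ (≡.trans (cong ℤ.∣_∣ 1≡pz) (ℤ.abs-* (+ p) z))
    where
    1/p≡z : 1/p^ 1 ≡ fromℤ z
    1/p≡z = ≡.trans (≡.sym (ℚ.+-identityʳ _)) eq
    1≡pz : + 1 ≡ + p ℤ.* z
    1≡pz = fromℤ-injective (begin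
      ℚ.1ℚ                       ≡⟨ inverse-1/p^ 1 ⟨
      (ι (p ^ 1)) ℚ.* 1/p^ 1   ≡⟨ cong₂ (λ n r → (ι n) ℚ.* r) (*-identityʳ p) 1/p≡z ⟩
      (ι p) ℚ.* fromℤ z          ≡⟨ fromℤ-homo-* (+ p) z ⟨
      fromℤ (+ p ℤ.* z)          ∎)

  -- An element is a fraction `z / p ^ k`. Coefficients are natural numbers, so `z` is replaced by
  -- its remainder modulo `p ^ k`, which changes the fraction by an integer.
  generators-generate : ∀ x → ∃₂ λ n k → n · generator k ≈ x
  generators-generate (q , k , z , Pq≡z) = n , k , ℤ.- t , (begin
    proj₁ (n · generator k) ℚ.- q                ≡⟨ cong₂ ℚ._-_ (proj₁-· n (generator k)) q≡ ⟩
    (ι n) ℚ.* r ℚ.- ((ι n) ℚ.* r ℚ.+ fromℤ t)    ≡⟨ cancel ((ι n) ℚ.* r) (fromℤ t) ⟩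
    ℚ.- fromℤ t                                  ≡⟨ fromℤ-homo-neg t ⟨
    fromℤ (ℤ.- t)                                ∎)
    where
    d = p ^ k
    n = z %ℕ d
    t = z /ℕ d
    r = 1/p^ k
    instance
      d≢0 : NonZero (p ^ k)
      d≢0 = pᵏ≢0 k
    open AbelianGroupSolver ℚ.+-0-abelianGroup
    cancel : ∀ a b → a ℚ.- (a ℚ.+ b) ≡ ℚ.- b
    cancel a b = solve (a ∷ b ∷ []) (x₀ ⊟ (x₀ ⊞ x₁)) (⊖ x₁) ≡.refl
    q≡ : q ≡ (ι n) ℚ.* r ℚ.+ fromℤ t
    q≡ = begin
      q                                          ≡⟨ ℚ.*-identityʳ q ⟨
      q ℚ.* ℚ.1ℚ                                 ≡⟨ cong (q ℚ.*_) (inverse-1/p^ k) ⟨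
      q ℚ.* ((ι d) ℚ.* r)                        ≡⟨ ℚ.*-assoc q (ι d) r ⟨
      q ℚ.* (ι d) ℚ.* r                          ≡⟨ cong (ℚ._* r) (≡.trans (ℚ.*-comm q (ι d)) Pq≡z)
          ⟩
      fromℤ z ℚ.* r                              ≡⟨ cong (λ z → fromℤ z ℚ.* r) (a≡a%ℕn+[a/ℕn]*n z d)
          ⟩
      fromℤ (+ n ℤ.+ t ℤ.* + d) ℚ.* r            ≡⟨
          cong (ℚ._* r) (≡.trans (fromℤ-homo-+ (+ n) (t ℤ.* + d))
          (cong ((ι n) ℚ.+_) (fromℤ-homo-* t (+ d)))) ⟩
      ((ι n) ℚ.+ fromℤ t ℚ.* (ι d)) ℚ.* r        ≡⟨ ℚ.*-distribʳ-+ r (ι n) (fromℤ t ℚ.* (ι d)) ⟩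
      (ι n) ℚ.* r ℚ.+ fromℤ t ℚ.* (ι d) ℚ.* r    ≡⟨
          cong ((ι n) ℚ.* r ℚ.+_) (≡.trans (ℚ.*-assoc (fromℤ t) (ι d) r)
          (≡.trans (cong (fromℤ t ℚ.*_) (inverse-1/p^ k)) (ℚ.*-identityʳ _))) ⟩
      (ι n) ℚ.* r ℚ.+ fromℤ t                    ∎

  prüfer-quasicyclic : Quasicyclic p (Prüfer p)
  prüfer-quasicyclic = record
    { u = generator ; u₀≈ε = + 1 , ≡.refl ; step = generator-step
    ; u₁≉ε = generator₁≉ε ; generates = generators-generate }

Power : ∀ {c ℓ} → AbelianGroup c ℓ → ℕ → AbelianGroup c ℓ
Power P k = Pointwise.abelianGroup (Fin k) P

module Chain (p : ℕ) {c ℓ} (G : AbelianGroup c ℓ) (e : ℕ → AbelianGroup.Carrier G)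
  (e₀≈ε : AbelianGroup._≈_ G (e 0) (AbelianGroup.ε G))
  (step : ∀ k → AbelianGroup._≈_ G (Multiples._·_ G p (e (suc k))) (e k)) where
  open AbelianGroup G
  open Multiples G
  open Torsion G

  lower : ∀ j k → (p ^ j) · e (j + k) ≈ e k
  lower zero    k = ×-homo-1 (e k)
  lower (suc j) k = trans (sym (trans (×-assocˡ _ (p ^ j) p) (×-congˡ (*-comm (p ^ j) p))))
    (trans (×-congʳ (p ^ j) (step (j + k))) (lower j k))

  raise : ∀ n j k → n · e k ≈ (n * p ^ j) · e (j + k)
  raise n j k = trans (×-congʳ n (sym (lower j k))) (×-assocˡ _ n (p ^ j))

  raise′ : ∀ n j k → n · e k ≈ (n * p ^ j) · e (k + j)
  raise′ n j k = trans (raise n j k) (×-congʳ (n * p ^ j) (reflexive (cong e (+-comm j k))))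

  killed : ∀ k → (p ^ k) · e k ≈ ε
  killed k = trans (×-congʳ (p ^ k) (reflexive (cong e (≡.sym (+-identityʳ k)))))
      (trans (lower k 0) e₀≈ε)

  p·e₁≈ε : p · e 1 ≈ ε
  p·e₁≈ε = trans (step 0) e₀≈ε

  descend : ∀ n k → (n * p ^ k) · e (suc k) ≈ n · e 1
  descend n k = trans (×-congʳ (n * p ^ k) (reflexive (cong e (≡.sym (+-comm k 1)))))
      (sym (raise n k 1))

  -- By induction `m` is `j * p ^ k`, since multiplication by `p` carries the relation down to
  -- `e k`. Then `j` kills `e 1`; if `p` did not divide `j`, it would also act invertibly on `e 1`.
  order : Prime p → ¬ (e 1 ≈ ε) → ∀ m k → m · e k ≈ ε → p ^ k ∣ m
  order p-prime e₁≉ε m zero    _ = divides m (≡.sym (*-identityʳ m))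
  order p-prime e₁≉ε m (suc k) eq
    with divides j ≡.refl ← order p-prime e₁≉ε m k (trans (×-congʳ m (sym (step k)))
           (trans (×-comm m p _) (trans (×-congʳ p eq) (×-ε p))))
    with p ∣? j
  ... | yes (divides i ≡.refl) = divides i (*-assoc i p (p ^ k))
  ... | no p∤j with i , inv ← invert (prime∤⇒coprime p-prime p∤j) = ⊥-elim (e₁≉ε
    (trans (sym (inv (e 1) p·e₁≈ε)) (trans (×-congʳ i (trans (sym (descend j k)) eq)) (×-ε i))))

module QuasicyclicProperties {c ℓ} {p} {P : AbelianGroup c ℓ} (Q : Quasicyclic p P) where
  open AbelianGroup P
  open Multiples P
  open Torsion P
  open Quasicyclic Q

  onto : Onto p
  onto x with n , k , eq ← generates x =
    n · u (suc k) , trans (×-comm p n (u (suc k))) (trans (×-congʳ n (step k)) eq)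

  open Chain p P u u₀≈ε step using (killed)

  torsion : PowerTorsion p
  torsion x with n , k , eq ← generates x =
    k , trans (×-congʳ (p ^ k) (sym eq)) (trans (×-comm (p ^ k) n (u k))
        (trans (×-congʳ n (killed k)) (×-ε n)))

module PowerProperties {c ℓ} (P : AbelianGroup c ℓ) (k : ℕ) where
  private
    module P = AbelianGroup P
    module MP = Multiples P
    module M = Multiples (Power P k)

  ·-pointwise : ∀ n x i → (n M.· x) i P.≈ n MP.· x i
  ·-pointwise zero    x i = P.refl
  ·-pointwise (suc n) x i = P.∙-congˡ (·-pointwise n x i)

  onto-power : ∀ {n} → MP.Onto n → M.Onto n
  onto-power {n} onto x = (λ i → proj₁ (onto (x i))) ,
    λ i → P.trans (·-pointwise n _ i) (proj₂ (onto (x i)))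

  common : ∀ {k} (w : Fin k → ℕ) → ∃ λ K → ∀ i → w i ≤ K
  common {zero}  w = 0 , λ ()
  common {suc k} w with K , bound ← common (w ∘ Fin.suc) =
    w Fin.zero ⊔ K , λ { Fin.zero → m≤m⊔n _ K ; (Fin.suc i) → m≤n⇒m≤o⊔n _ (bound i) }

  higher : ∀ {p j K x} → j ≤ K → (p ^ j) MP.· x P.≈ P.ε → (p ^ K) MP.· x P.≈ P.ε
  higher {p} {j} {K} {x} j≤K eq with m , ≡.refl ← m≤n⇒∃[o]m+o≡n j≤K =
    P.trans (MP.×-congˡ (≡.trans (^-distribˡ-+-* p j m) (*-comm (p ^ j) (p ^ m))))
      (P.trans (P.sym (MP.×-assocˡ x (p ^ m) (p ^ j)))
          (P.trans (MP.×-congʳ (p ^ m) eq) (MP.×-ε (p ^ m))))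

  torsion-power : ∀ {p} → Torsion.PowerTorsion P p → Torsion.PowerTorsion (Power P k) p
  torsion-power {p} torsion x with K , kills ← common (λ i → proj₁ (torsion (x i))) =
    K , λ i → P.trans (·-pointwise (p ^ K) x i) (higher {p} (kills i) (proj₂ (torsion (x i))))

module Transport {c ℓ a h} {G : AbelianGroup c ℓ} {H : AbelianGroup a h} (iso : G ≅ H) where
  private
    module G = AbelianGroup G
    module H = AbelianGroup H
    module MG = Multiples G
    module MH = Multiples H
    φ = proj₁ iso
  open GroupMorphisms.IsGroupIsomorphism (proj₂ iso)

  ·-homo : ∀ n x → φ (n MG.· x) H.≈ n MH.· φ x
  ·-homo zero    x = ε-homo
  ·-homo (suc n) x = H.trans (∙-homo x (n MG.· x)) (H.∙-congˡ (·-homo n x))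

  onto : ∀ {n} → MH.Onto n → MG.Onto n
  onto {n} onto-H x with y , ny≈ ← onto-H (φ x) with z , φz≈ ← surjective y =
    z , injective (H.trans (·-homo n z) (H.trans (MH.×-congʳ n (φz≈ G.refl)) ny≈))

  torsion : ∀ {p} → Torsion.PowerTorsion H p → Torsion.PowerTorsion G p
  torsion {p} torsion-H x with k , eq ← torsion-H (φ x) =
    k , injective (H.trans (·-homo (p ^ k) x) (H.trans eq (H.sym ε-homo)))

record Embedding {c ℓ a h} (P : AbelianGroup c ℓ) (G : AbelianGroup a h) : Set (c Level.⊔ ℓ Level.⊔ a Level.⊔ h) where
  private
    module P = AbelianGroup P
    module G = AbelianGroup G
    module MP = Multiples P
    module MG = Multiples G
  field
    map-to  : P.Carrier → G.Carrier
    cong-to : ∀ {x y} → x P.≈ y → map-to x G.≈ map-to y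
    homo    : ∀ x y → map-to (x P.∙ y) G.≈ map-to x G.∙ map-to y
    kernel  : ∀ x → map-to x G.≈ G.ε → x P.≈ P.ε

  open AbelianGroupProperties G

  homo-ε : map-to P.ε G.≈ G.ε
  homo-ε = identityˡ-unique (map-to P.ε) (map-to P.ε)
    (G.trans (G.sym (homo P.ε P.ε)) (cong-to (P.identityˡ P.ε)))

  homo-⁻¹ : ∀ x → map-to (x P.⁻¹) G.≈ map-to x G.⁻¹
  homo-⁻¹ x = inverseˡ-unique _ _ (G.trans (G.sym (homo (x P.⁻¹) x))
      (G.trans (cong-to (P.inverseˡ x)) homo-ε))

  homo-· : ∀ n x → map-to (n MP.· x) G.≈ n MG.· map-to x
  homo-· zero    x = homo-ε
  homo-· (suc n) x = G.trans (homo x (n MP.· x)) (G.∙-congˡ (homo-· n x))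

  injective : ∀ {x y} → map-to x G.≈ map-to y → x P.≈ y
  injective {x} {y} eq = AbelianGroupProperties.x∙y⁻¹≈ε⇒x≈y P x y
      (kernel _ (G.trans (homo x (y P.⁻¹))
    (G.trans (G.∙-cong eq (homo-⁻¹ y)) (G.inverseʳ (map-to y)))))

  Image : G.Carrier → Set (c Level.⊔ h)
  Image x = ∃ λ y → map-to y G.≈ x

  image-minus : ∀ {x y} → Image x → Image y → Image (x G.- y)
  image-minus (x , φx≈) (y , φy≈) = x P.- y ,
    G.trans (homo x (y P.⁻¹)) (G.∙-cong φx≈ (G.trans (homo-⁻¹ y) (G.⁻¹-cong φy≈)))

  image-· : ∀ n {x} → Image x → Image (n MG.· x)
  image-· n (y , φy≈) = n MP.· y , G.trans (homo-· n y) (MG.×-congʳ n φy≈)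

  image-resp : ∀ {x y} → x G.≈ y → Image x → Image y
  image-resp x≈y (z , φz≈) = z , G.trans φz≈ x≈y

inverse-≅ : ∀ {c ℓ a h} {P : AbelianGroup c ℓ} {G : AbelianGroup a h} (E : Embedding P G) →
            (∀ x → Embedding.Image E x) → G ≅ P
inverse-≅ {P = P} {G} E onto = (λ x → proj₁ (onto x)) , record
  { isGroupMonomorphism = record
    { isGroupHomomorphism = record
      { isMonoidHomomorphism = record
        { isMagmaHomomorphism = record
          { isRelHomomorphism = record { cong = λ {x} {y} x≈y →
              injective (G.trans (φψ x) (G.trans x≈y (G.sym (φψ y)))) }
          ; homo = λ x y → injective (G.trans (φψ _)
              (G.sym (G.trans (homo _ _) (G.∙-cong (φψ x) (φψ y)))))
          }
        ; ε-homo = injective (G.trans (φψ _) (G.sym homo-ε))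
        }
      ; ⁻¹-homo = λ x → injective (G.trans (φψ _) (G.sym (G.trans (homo-⁻¹ _) (G.⁻¹-cong (φψ x)))))
      }
    ; injective = λ {x} {y} eq → G.trans (G.sym (φψ x)) (G.trans (cong-to eq) (φψ y))
    }
  ; surjective = λ y → map-to y , λ {z} z≈ → injective (G.trans (φψ z) z≈)
  }
  where
  module G = AbelianGroup G
  open Embedding E
  φψ : ∀ x → map-to (proj₁ (onto x)) G.≈ x
  φψ x = proj₂ (onto x)

module QuasicyclicEmbedding (em : ∀ {ℓ} → ExcludedMiddle ℓ) {c ℓ a h p} (p-prime : Prime p)
  {P : AbelianGroup c ℓ} (Q : Quasicyclic p P) (G : AbelianGroup a h) where
  private
    module P = AbelianGroup P
    module G = AbelianGroup G
    module MP = Multiples P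
    module MG = Multiples G
  open Quasicyclic Q
  open QuasicyclicProperties Q using (onto)
  private module U = Chain p P u u₀≈ε step

  -- The element `u 1` generates the least nonzero subgroup of `P`.
  multiple-u₁ : ∀ n k → ¬ (n MP.· u k P.≈ P.ε) → ∃ λ i → i MP.· (n MP.· u k) P.≈ u 1
  multiple-u₁ n zero    nu≉ε = ⊥-elim (nu≉ε (P.trans (MP.×-congʳ n u₀≈ε) (MP.×-ε n)))
  multiple-u₁ n (suc k) nu≉ε with em {P = n MP.· u k P.≈ P.ε}
  ... | no nu≉ε′ with i , eq ← multiple-u₁ n k nu≉ε′ = i * p ,
    P.trans (P.sym (MP.×-assocˡ _ i p)) (P.trans
        (MP.×-congʳ i (P.trans (MP.×-comm p n _) (MP.×-congʳ n (step k)))) eq)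
  ... | yes nu≈ε with divides j ≡.refl ← U.order p-prime u₁≉ε n k nu≈ε =
    proj₁ inv , P.trans (MP.×-congʳ (proj₁ inv) (U.descend j k)) (proj₂ inv (u 1) U.p·e₁≈ε)
    where
    p∤j : ¬ p ∣ j
    p∤j (divides i ≡.refl) = nu≉ε (P.trans (U.descend (i * p) k)
        (P.trans (P.sym (MP.×-assocˡ (u 1) i p))
      (P.trans (MP.×-congʳ i U.p·e₁≈ε) (MP.×-ε i))))
    inv = Torsion.invert P (prime∤⇒coprime p-prime p∤j)

  module Extend (e : ℕ → G.Carrier) (e₀≈ε : e 0 G.≈ G.ε) (step-e : ∀ k → p MG.· e (suc k) G.≈ e k) where
    private module E = Chain p G e e₀≈ε step-e

    comparable-≤ : ∀ m n k → m ≤ n → m MP.· u k P.≈ n MP.· u k → m MG.· e k G.≈ n MG.· e k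
    comparable-≤ m n k m≤n eq with d , ≡.refl ← m≤n⇒∃[o]m+o≡n m≤n
      with divides j ≡.refl ← U.order p-prime u₁≉ε d k (AbelianGroupProperties.identityʳ-unique P
             (m MP.· u k) (d MP.· u k) (P.trans (P.sym (MP.×-homo-+ (u k) m d)) (P.sym eq))) =
      G.sym (G.trans (MG.×-homo-+ (e k) m (j * p ^ k))
          (G.trans (G.∙-congˡ (G.trans (G.sym (MG.×-assocˡ (e k) j (p ^ k)))
        (G.trans (MG.×-congʳ j (E.killed k)) (MG.×-ε j)))) (G.identityʳ _)))

    comparable-level : ∀ m n k → m MP.· u k P.≈ n MP.· u k → m MG.· e k G.≈ n MG.· e k
    comparable-level m n k eq with ≤-total m n
    ... | inj₁ m≤n = comparable-≤ m n k m≤n eq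
    ... | inj₂ n≤m = G.sym (comparable-≤ n m k n≤m (P.sym eq))

    -- Relations between the `u k` pass to the `e k`: on a common level `u k` has order exactly
    -- `p ^ k`, which kills `e k`. This makes `ψ` well-defined.
    comparable : ∀ m n j k → m MP.· u j P.≈ n MP.· u k → m MG.· e j G.≈ n MG.· e k
    comparable m n j k eq = G.trans (E.raise m k j) (G.trans
      (comparable-level (m * p ^ k) (n * p ^ j) (k + j)
          (P.trans (P.sym (U.raise m k j)) (P.trans eq (U.raise′ n j k))))
      (G.sym (E.raise′ n j k)))

    ψ : P.Carrier → G.Carrier
    ψ x = proj₁ (generates x) MG.· e (proj₁ (proj₂ (generates x)))

    ψ-· : ∀ {x} n k → n MP.· u k P.≈ x → ψ x G.≈ n MG.· e k
    ψ-· {x} n k eq = comparable (proj₁ (generates x)) n (proj₁ (proj₂ (generates x))) k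
        (P.trans (proj₂ (proj₂ (generates x))) (P.sym eq))

    ψ-cong : ∀ {x y} → x P.≈ y → ψ x G.≈ ψ y
    ψ-cong {y = y} x≈y = ψ-· (proj₁ (generates y)) (proj₁ (proj₂ (generates y)))
        (P.trans (proj₂ (proj₂ (generates y))) (P.sym x≈y))

    ψ-homo : ∀ x y → ψ (x P.∙ y) G.≈ ψ x G.∙ ψ y
    ψ-homo x y with m , j , mu≈x ← generates x | n , k , nu≈y ← generates y =
      G.trans (ψ-· (m * p ^ k + n * p ^ j) (k + j) (P.trans (MP.×-homo-+ _ (m * p ^ k) (n * p ^ j))
          (P.∙-cong (P.trans (P.sym (U.raise m k j)) mu≈x)
              (P.trans (P.sym (U.raise′ n j k)) nu≈y))))
        (G.trans (MG.×-homo-+ _ (m * p ^ k) (n * p ^ j))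
            (G.∙-cong (G.sym (E.raise m k j)) (G.sym (E.raise′ n j k))))

    ψ-u₁ : ψ (u 1) G.≈ e 1
    ψ-u₁ = G.trans (ψ-· 1 1 (MP.×-homo-1 (u 1))) (MG.×-homo-1 (e 1))

    ψ-ε : ψ P.ε G.≈ G.ε
    ψ-ε = G.trans (ψ-· 0 0 P.refl) G.refl

    ψ-multiple : ∀ {x} → ¬ (x P.≈ P.ε) → ∃ λ i → i MG.· ψ x G.≈ e 1
    ψ-multiple {x} x≉ε with n , k , nu≈x ← generates x
      with i , eq ← multiple-u₁ n k (λ nu≈ε → x≉ε (P.trans (P.sym nu≈x) nu≈ε)) =
      i , G.trans (MG.×-assocˡ _ i n) (G.trans (comparable (i * n) 1 k 1
        (P.trans (P.sym (MP.×-assocˡ _ i n)) (P.trans eq (P.sym (MP.×-homo-1 (u 1))))))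
            (MG.×-homo-1 (e 1)))

    -- If the new copy of `P` met the old image in a nonzero element, some multiple of that element
    -- would be `e 1`, which lies outside.
    extend : ∀ {k} (E : Embedding (Power P k) G) → ¬ Embedding.Image E (e 1) →
        Embedding (Power P (suc k)) G
    extend E e₁∉ = record
      { map-to  = λ x → ψ (x Fin.zero) G.∙ map-to (x ∘ Fin.suc)
      ; cong-to = λ x≈y → G.∙-cong (ψ-cong (x≈y Fin.zero)) (cong-to (x≈y ∘ Fin.suc))
      ; homo    = λ x y → G.trans (G.∙-cong (ψ-homo (x Fin.zero) (y Fin.zero))
          (homo (x ∘ Fin.suc) (y ∘ Fin.suc)))
                            (interchange _ _ _ _)
      ; kernel  = trivial
      }
      where
      open Embedding E
      open CommutativeSemigroupProperties G.commutativeSemigroup using (interchange)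
      trivial : ∀ x → ψ (x Fin.zero) G.∙ map-to (x ∘ Fin.suc) G.≈ G.ε → ∀ i → x i P.≈ P.ε
      trivial x eq with em {P = x Fin.zero P.≈ P.ε}
      ... | no x₀≉ε with i , iψ≈e₁ ← ψ-multiple x₀≉ε = ⊥-elim (e₁∉ (image-resp
              (G.trans (MG.×-congʳ i (G.trans (G.identityˡ _)
                  (G.sym (AbelianGroupProperties.inverseˡ-unique G _ _ eq)))) iψ≈e₁)
              (image-· i (image-minus (_ , homo-ε) (x ∘ Fin.suc , G.refl)))))
      ... | yes x₀≈ε = λ { Fin.zero → x₀≈ε ; (Fin.suc i) → kernel (x ∘ Fin.suc)
              (G.trans (G.sym (G.trans (G.∙-congʳ (G.trans (ψ-cong x₀≈ε) ψ-ε)) (G.identityˡ _))) eq)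
                  i }

  module _ (G-onto : MG.Onto p) (G-torsion : Torsion.PowerTorsion G p) where

    chain : G.Carrier → ℕ → G.Carrier
    chain x zero          = G.ε
    chain x (suc zero)    = x
    chain x (suc (suc k)) = proj₁ (G-onto (chain x (suc k)))

    Basis : List G.Carrier → Set _
    Basis xs = ∃ λ k → Σ (Embedding (Power P k) G) λ E →
      ∀ {x} → p MG.· x G.≈ G.ε → Any (x G.≈_) xs → Embedding.Image E x

    -- Each element of order `p` not yet in the image is divided by `p` again and again, and the
    -- resulting chain embeds a further copy of `P`.
    basis : ∀ xs → Basis xs
    basis [] = 0 , record { map-to = λ _ → G.ε ; cong-to = λ _ → G.refl
      ; homo = λ _ _ → G.sym (G.identityˡ G.ε) ; kernel = λ _ _ () } , λ _ ()
    basis (x ∷ xs) with k , E , covers ← basis xs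
      with em {P = p MG.· x G.≈ G.ε × ¬ Embedding.Image E x}
    ... | no ¬new = k , E , λ
          { py≈ε (there y∈) → covers py≈ε y∈
          ; py≈ε (here y≈x) → Embedding.image-resp E (G.sym y≈x)
              (already (G.trans (MG.×-congʳ p (G.sym y≈x)) py≈ε)) }
      where
      already : p MG.· x G.≈ G.ε → Embedding.Image E x
      already px≈ε with em {P = Embedding.Image E x}
      ... | yes x∈ = x∈
      ... | no x∉  = ⊥-elim (¬new (px≈ε , x∉))
    ... | yes (px≈ε , x∉) = suc k , E′ , λ
          { py≈ε (there y∈) → old (covers py≈ε y∈)
          ; py≈ε (here y≈x) → Embedding.image-resp E′ (G.sym y≈x) new }
      where
      steps : ∀ k → p MG.· chain x (suc k) G.≈ chain x k
      steps zero    = px≈ε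
      steps (suc k) = proj₂ (G-onto (chain x (suc k)))
      module X = Extend (chain x) G.refl steps
      open Embedding E
      E′ : Embedding (Power P (suc k)) G
      E′ = X.extend E x∉
      cons : P.Carrier → (Fin k → P.Carrier) → Fin (suc k) → P.Carrier
      cons z w Fin.zero    = z
      cons z w (Fin.suc i) = w i
      old : ∀ {y} → Image y → Embedding.Image E′ y
      old (w , φw≈y) = cons P.ε w , G.trans (G.∙-congʳ X.ψ-ε) (G.trans (G.identityˡ _) φw≈y)
      new : Embedding.Image E′ x
      new = cons (u 1) (λ _ → P.ε) , G.trans (G.∙-cong X.ψ-u₁ homo-ε) (G.identityʳ x)

    -- A divisible subgroup containing all elements killed by `p` exhausts a `p`-group: if `p · x`
    -- lies in the image, divide its preimage by `p`; the image of the quotient differs from `x` by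
    -- an element killed by `p`.
    isPower : Finite G.setoid (λ x → p MG.· x G.≈ G.ε) → ∃ λ k → G ≅ Power P k
    isPower (xs , cover) with k , E , covers ← basis xs = k ,
        inverse-≅ E (λ x → all (proj₁ (G-torsion x)) x (proj₂ (G-torsion x)))
      where
      open Embedding E
      all : ∀ n x → (p ^ n) MG.· x G.≈ G.ε → Image x
      all zero x eq = image-resp (G.sym (G.trans (G.sym (MG.×-homo-1 x)) eq)) (_ , homo-ε)
      all (suc n) x eq with y , φy≈px ← all n (p MG.· x)
            (G.trans (MG.×-assocˡ x (p ^ n) p) (G.trans (MG.×-congˡ (*-comm (p ^ n) p)) eq))
        with z , pz≈y ← PowerProperties.onto-power P k {p} onto y =
        image-resp (solve (x ∷ map-to z ∷ []) ((x₀ ⊟ x₁) ⊟ (⊖ x₁)) x₀ ≡.refl)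
          (image-minus (covers killed-difference (cover _ killed-difference))
            (_ , homo-⁻¹ z))
        where
        open AbelianGroupSolver G
        killed-difference : p MG.· (x G.- map-to z) G.≈ G.ε
        killed-difference = G.trans (MG.×-distrib-- p x (map-to z))
            (AbelianGroupProperties.x≈y⇒x∙y⁻¹≈ε G
          (G.sym (G.trans (G.sym (homo-· p z)) (G.trans (cong-to pz≈y) φy≈px))))

-- Consequences of the minimality of G

module FiniteSubsets {c ℓ} (S : Setoid c ℓ) where
  open Setoid S

  finite-⊆ : ∀ {h h′} {P : Carrier → Set h} {Q : Carrier → Set h′} → (∀ {x} → Q x → P x) →
      Finite S P → Finite S Q
  finite-⊆ Q⊆P (xs , cover) = xs , λ x Qx → cover x (Q⊆P Qx)

  no-injection : ∀ {h} {P : Carrier → Set h} → Finite S P → (s : ℕ → Carrier) → (∀ n → P (s n)) →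
                 ¬ (∀ {m n} → m < n → ¬ (s m ≈ s n))
  no-injection (xs , cover) s Ps distinct
    with i , j , i<j , eq ← Fin.pigeonhole ≤-refl (λ (i : Fin (suc (length xs))) →
        index (cover (s (Fin.toℕ i)) (Ps (Fin.toℕ i))))
    = distinct i<j (trans (lookup-index (cover _ (Ps (Fin.toℕ i))))
        (trans (reflexive (cong (lookup xs) eq)) (sym (lookup-index (cover _ (Ps (Fin.toℕ j)))))))

module MinimalOrder (em : ∀ {ℓ} → ExcludedMiddle ℓ) {a} (V : ValuedAbelianGroup a)
  (infiniteΓ : Infinite (ValuedAbelianGroup.valueSetoid V)) (min : IsMinimalValuedGroup V) where
  open ValuedAbelianGroup V
  open Γ using (module Eq) renaming (_≈_ to _≈ᵛ_; _≉_ to _≉ᵛ_; _≤_ to _≤ᵛ_)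
  open TotalOrderProperties Γ using () renaming (_<_ to _<ᵛ_; ≰⇒> to ≰⇒>ᵛ; <-respˡ-≈ to <ᵛ-respˡ-≈;
      <-trans to <ᵛ-trans; <⇒≉ to <⇒≉ᵛ)
  open AbelianGroup G hiding (group)
  open AbelianGroupProperties G
  open AbelianGroupSolver G
  open FiniteSubsets setoid

  private
    𝓜 : Structure 𝓛vg a
    𝓜 = valuedGroupStructure V

  atValue : ∀ γ → ∃ λ x → v x ≈ᵛ γ
  atValue γ with x , vx≈ ← surjective γ = x , vx≈ refl

  -- The cosets of a proper subgroup lie in its complement.
  proper-finite : ∀ {h} {H : Carrier → Set h} → IsSubgroup G H → Finite setoid H ⊎ Finite setoid
      (∁ H) →
                  (∃ λ x → ¬ H x) → Finite setoid H
  proper-finite H≤ (inj₁ finite) _ = finite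
  proper-finite {H = H} H≤ (inj₂ (xs , cover)) (x , x∉H) =
      ⊥-elim (proj₁ min (whole , λ y _ → covers y))
    where
    open IsSubgroup H≤
    whole = xs ++ map (_- x) xs
    covers : ∀ y → Any (y ≈_) whole
    covers y with em {P = H y}
    ... | no y∉H  = ++⁺ˡ (cover y y∉H)
    ... | yes y∈H = ++⁺ʳ xs (Any.map⁺ (Any.map (λ {z} xy≈z →
            trans (solve (x ∷ y ∷ []) x₁ (x₀ ⊞ x₁ ⊟ x₀) ≡.refl) (∙-congʳ xy≈z))
            (cover (x ∙ y) λ xy∈H → x∉H (resp (solve (x ∷ y ∷ []) (x₀ ⊞ x₁ ⊟ x₁) x₀ ≡.refl)
              (-‿closed xy∈H y∈H)))))

  private
    valueOf : ∀ {Δ} → group ∈ Δ → Term 𝓛vg Δ value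
    valueOf i = app val (var i ∷ [])

  finiteValues : ∀ {h} {P : Carrier → Set h} → Finite setoid P → ∃ λ γs → ∀ x → P x →
      Any (v x ≈ᵛ_) γs
  finiteValues (xs , cover) = map v xs , λ x Px → Any.map⁺ (Any.map v-cong (cover x Px))

  -- A ball that is all of G makes `γ` the least value. Then either `γ` is `∞` and the only value,
  -- or the open ball at `γ` is proper, hence finite, and leaves only finitely many values.
  closedBall-finite : ∀ γ → Finite setoid (ClosedBall V γ)
  closedBall-finite γ with em {P = ∃ λ x → ¬ ClosedBall V γ x}
  ... | yes outside = proper-finite (closedBall-isSubgroup V γ)
    (proj₂ min (atom leq (var (there (here ≡.refl)) ∷ valueOf (here ≡.refl) ∷ [])) (γ ∷ [])) outside
  ... | no everything = ⊥-elim (contradiction (em {P = γ ≈ᵛ ∞}))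
    where
    bottom : ∀ η → γ ≤ᵛ η
    bottom η with x , vx≈η ← atValue η with em {P = γ ≤ᵛ v x}
    ... | yes γ≤vx = Γ.≤-respʳ-≈ vx≈η γ≤vx
    ... | no γ≰vx  = ⊥-elim (everything (x , γ≰vx))

    contradiction : Dec (γ ≈ᵛ ∞) → ⊥
    contradiction (yes γ≈∞) = infiniteΓ (γ ∷ [] , λ η _ →
        here (Γ.antisym (Γ.≤-respʳ-≈ (Eq.sym γ≈∞) (∞-maximum η)) (bottom η)))
    contradiction (no γ≉∞) = exhausted (finiteValues (proper-finite (openBall-isSubgroup V γ≉∞)
        open-definable
                               (proj₁ (atValue γ) , λ γ<vx → <⇒≉ᵛ γ<vx
                                   (Eq.sym (proj₂ (atValue γ))))))
      where
      open-definable : Finite setoid (OpenBall V γ) ⊎ Finite setoid (∁ (OpenBall V γ))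
      open-definable with proj₂ min (neg (atom leq
          (valueOf (here ≡.refl) ∷ var (there (here ≡.refl)) ∷ []))) (γ ∷ [])
      ... | inj₁ finite   = inj₁ (finite-⊆ (λ γ<vx vx≤γ → <⇒≉ᵛ γ<vx (Γ.antisym (proj₁ γ<vx) vx≤γ))
          finite)
      ... | inj₂ cofinite = inj₂ (finite-⊆ (λ γ≮vx vx≰γ → γ≮vx (≰⇒>ᵛ vx≰γ)) cofinite)
      covers : ∀ {xs} → (∀ x → OpenBall V γ x → Any (v x ≈ᵛ_) xs) → ∀ η → Any (η ≈ᵛ_) (γ ∷ xs)
      covers cover η with x , vx≈η ← atValue η with em {P = γ ≈ᵛ η}
      ... | yes γ≈η = here (Eq.sym γ≈η)
      ... | no γ≉η  = there (Any.map (Eq.trans (Eq.sym vx≈η))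
              (cover x (Γ.≤-respʳ-≈ (Eq.sym vx≈η) (bottom η) , λ γ≈vx → γ≉η (Eq.trans γ≈vx vx≈η))))
      exhausted : ¬ (∃ λ xs → ∀ x → OpenBall V γ x → Any (v x ≈ᵛ_) xs)
      exhausted (xs , cover) = infiniteΓ (γ ∷ xs , λ η _ → covers cover η)

  upset-finite : ∀ γ → Finite valueSetoid (γ ≤ᵛ_)
  upset-finite γ with ηs , cover ← finiteValues (closedBall-finite γ) =
    ηs , λ η γ≤η → let x , vx≈η = atValue η in
      Any.map (Eq.trans (Eq.sym vx≈η)) (cover x (Γ.≤-respʳ-≈ (Eq.sym vx≈η) γ≤η))

  fibres-finite : HasFiniteFibres V
  fibres-finite γ = finite-⊆ (λ vx≈γ → Γ.reflexive (Eq.sym vx≈γ)) (closedBall-finite γ)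

  unbounded : ∀ γ → ∃ λ η → η <ᵛ γ
  unbounded γ with em {P = ∃ λ η → η <ᵛ γ}
  ... | yes b = b
  ... | no ¬b with ηs , cover ← upset-finite γ = ⊥-elim (infiniteΓ (ηs , λ η _ → cover η (¬<⇒≤ η)))
    where
    ¬<⇒≤ : ∀ η → γ ≤ᵛ η
    ¬<⇒≤ η with em {P = γ ≤ᵛ η}
    ... | yes γ≤η = γ≤η
    ... | no γ≰η  = ⊥-elim (¬b (η , ≰⇒>ᵛ γ≰η))

  largest : ∀ {γ η} → η <ᵛ γ → ∀ ηs → ∃ λ m → m <ᵛ γ × η ≤ᵛ m × (∀ {ζ} → ζ <ᵛ γ → Any (ζ ≈ᵛ_) ηs →
      ζ ≤ᵛ m)
  largest {γ} {η} η<γ [] = η , η<γ , Γ.refl , λ _ ()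
  largest {γ} {η} η<γ (θ ∷ ηs) with m , m<γ , η≤m , best ←
      largest η<γ ηs with em {P = θ <ᵛ γ × m ≤ᵛ θ}
  ... | yes (θ<γ , m≤θ) = θ , θ<γ , Γ.trans η≤m m≤θ , λ
    { ζ<γ (here ζ≈θ) → Γ.reflexive ζ≈θ ; ζ<γ (there ζ∈) → Γ.trans (best ζ<γ ζ∈) m≤θ }
  ... | no ¬better = m , m<γ , η≤m , λ
    { {ζ} ζ<γ (here ζ≈θ) → [ (λ ζ≤m → ζ≤m) , (λ m≤ζ →
        ⊥-elim (¬better (<ᵛ-respˡ-≈ ζ≈θ ζ<γ , Γ.≤-respʳ-≈ ζ≈θ m≤ζ))) ]′ (Γ.total ζ m)
    ; ζ<γ (there ζ∈) → best ζ<γ ζ∈ }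

  predecessor : ∀ γ → ∃ λ η → η <ᵛ γ × (∀ ζ → ζ <ᵛ γ → ζ ≤ᵛ η)
  predecessor γ with η , η<γ ← unbounded γ with ηs , cover ← upset-finite η
    with m , m<γ , η≤m , best ← largest η<γ ηs =
    m , m<γ , λ ζ ζ<γ → [ (λ ζ≤η → Γ.trans ζ≤η η≤m) , (λ η≤ζ → best ζ<γ (cover ζ η≤ζ)) ]′
        (Γ.total ζ η)

  enumerate : ℕ → Γ.Carrier
  enumerate zero    = ∞
  enumerate (suc n) = proj₁ (predecessor (enumerate n))

  enumerate-< : ∀ {m n} → m < n → enumerate n <ᵛ enumerate m
  enumerate-< {m} {suc n} (s≤s m≤n) with m≤n⇒m<n∨m≡n m≤n
  ... | inj₂ ≡.refl = proj₁ (proj₂ (predecessor (enumerate m)))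
  ... | inj₁ m<n    = <ᵛ-trans (proj₁ (proj₂ (predecessor (enumerate n)))) (enumerate-< m<n)

  -- A value never reached would lie below the whole enumeration, but only finitely many values lie
  -- above a given one.
  enumerate-surjective : ∀ γ → ∃ λ n → enumerate n ≈ᵛ γ
  enumerate-surjective γ with em {P = ∃ λ n → enumerate n ≈ᵛ γ}
  ... | yes found = found
  ... | no ¬found = ⊥-elim (FiniteSubsets.no-injection valueSetoid (upset-finite γ) enumerate
          (λ n → proj₁ (all-above n)) (λ m<n e → <⇒≉ᵛ (enumerate-< m<n) (Eq.sym e)))
    where
    all-above : ∀ n → γ <ᵛ enumerate n
    all-above zero    = ∞-maximum γ , λ γ≈∞ → ¬found (0 , Eq.sym γ≈∞)
    all-above (suc n) = proj₂ (proj₂ (predecessor (enumerate n))) γ (all-above n) , λ e →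
        ¬found (suc n , Eq.sym e)

  orderType : HasOrderTypeω* V
  orderType = enumerate , record
    { isOrderMonomorphism = record
      { isOrderHomomorphism = record
        { cong = λ { ≡.refl → Eq.refl }
        ; mono = λ {m} {n} n≤m → [ (λ n<m → proj₁ (enumerate-< n<m)) , (λ { ≡.refl → Γ.refl }) ]′
            (m≤n⇒m<n∨m≡n n≤m)
        }
      ; injective = λ {m} {n} e → ≤-antisym
          (≮⇒≥ λ n<m → <⇒≉ᵛ (enumerate-< n<m) e) (≮⇒≥ λ m<n → <⇒≉ᵛ (enumerate-< m<n) (Eq.sym e))
      ; cancel = λ {m} {n} le → ≮⇒≥ λ m<n →
          <⇒≉ᵛ (enumerate-< m<n) (Γ.antisym (proj₁ (enumerate-< m<n)) le)
      }
    ; surjective = λ γ → proj₁ (enumerate-surjective γ) ,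
        λ { ≡.refl → proj₂ (enumerate-surjective γ) }
    }

module EventualShift (em : ∀ {ℓ} → ExcludedMiddle ℓ) {a} {G : AbelianGroup a a} (U : UltraNorm G)
  {p} (p-onto : Multiples.Onto G p) where
  open AbelianGroup G
  open UltraNorm U
  open UltraNormProperties U
  open Multiples G
  open Scalars U

  -- The first clause, applied between elements of equal norm, makes `‖ p · x ‖` a function of
  -- `‖ x ‖`; the second makes it strictly increasing, so that the difference of the two norms
  -- cannot grow.
  MonotoneAt : Carrier → Set a
  MonotoneAt x = ∀ y → (‖ y ‖ ≤ ‖ x ‖ → ‖ p · y ‖ ≤ ‖ p · x ‖) ×
                       (‖ y ‖ < ‖ x ‖ → ‖ p · y ‖ < ‖ p · x ‖)

  -- Among the elements whose p-multiple has norm ≥ n, take one of least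
  -- norm, and among these one whose p-multiple has greatest norm.
  monotone-unbounded : ∀ n → ∃ λ x → n ≤ ‖ x ‖ × MonotoneAt x
  monotone-unbounded n with z , z≡n ← surjective n with w , pw≈z ← p-onto z
    with m , (x₀ , x₀≡m , n≤px₀) , m≤ ← least em (λ m → ∃ λ x → ‖ x ‖ ≡ m × n ≤ ‖ p · x ‖)
           (‖ w ‖ , w , ≡.refl , ≤-reflexive (≡.trans (≡.sym z≡n) (‖‖-cong (sym pw≈z))))
    with _ , (x , x≡m , n≤px , ≡.refl) , max ←
        greatest em (λ k → ∃ λ x → ‖ x ‖ ≡ m × n ≤ ‖ p · x ‖ × ‖ p · x ‖ ≡ k) m
           (λ { _ (x , x≡m , _ , ≡.refl) → ≤-trans (‖‖-· p x) (≤-reflexive x≡m) })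
           (‖ p · x₀ ‖ , x₀ , x₀≡m , n≤px₀ , ≡.refl) =
    x , ≤-trans n≤px (‖‖-· p x) , λ y →
      (λ y≤x → ≮⇒≥ λ px<py → <⇒≱ px<py (max _ (y ,
        ≤-antisym (≤-trans y≤x (≤-reflexive x≡m)) (m≤ _ (y , ≡.refl , ≤-trans n≤px (<⇒≤ px<py))) ,
        ≤-trans n≤px (<⇒≤ px<py) , ≡.refl))) ,
      (λ y<x → ≰⇒> λ px≤py → <⇒≱ y<x (≤-trans (≤-reflexive x≡m)
          (m≤ _ (y , ≡.refl , ≤-trans n≤px px≤py))))

  -- ‖x‖ - ‖p · x‖ is a non-increasing function of ‖x‖, hence eventually constant.
  shift : (∃ λ N → ∀ x → N ≤ ‖ x ‖ → ‖ p · x ‖ < ‖ x ‖) → (∃ λ N → ∀ x → N ≤ ‖ x ‖ → MonotoneAt x) →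
          ∃₂ λ ℓ N → 1 ≤ ℓ × ShiftsBy p ℓ N
  shift (N₁ , descends) (N₂ , mono)
    -- The least difference `ℓ` of the two norms is attained at some `x₀`; beyond it the difference
    -- neither rises, by `bound`, nor falls below `ℓ`.
    with least em (λ d → ∃ λ x → (N₁ ⊔ N₂) ≤ ‖ x ‖ × ‖ p · x ‖ + d ≡ ‖ x ‖)
           (let x , x≡ = surjective (N₁ ⊔ N₂) in
            _ , x , ≤-reflexive (≡.sym x≡) , m+[n∸m]≡n (‖‖-· p x))
  ... | ℓ , (x₀ , N≤x₀ , gap₀) , ℓ≤ = ℓ , ‖ x₀ ‖ , 1≤ℓ gap₀ (descends x₀ (m⊔n≤o⇒m≤o N₁ N₂ N≤x₀)) ,
      shifts
    where
    1≤ℓ : ∀ {ℓ m n} → m + ℓ ≡ n → m < n → 1 ≤ ℓ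
    1≤ℓ {zero} {m} eq m<n = ⊥-elim (<⇒≢ m<n (≡.trans (≡.sym (+-identityʳ m)) eq))
    1≤ℓ {suc ℓ} _ _ = s≤s z≤n

    monotoneAt : ∀ {x} → ‖ x₀ ‖ ≤ ‖ x ‖ → MonotoneAt x
    monotoneAt {x} x₀≤x = mono x (≤-trans (m⊔n≤o⇒n≤o N₁ N₂ N≤x₀) x₀≤x)

    same : ∀ {x y} → ‖ x₀ ‖ ≤ ‖ x ‖ → ‖ x ‖ ≡ ‖ y ‖ → ‖ p · x ‖ ≡ ‖ p · y ‖
    same {x} {y} x₀≤x x≡y = ≤-antisym
      (proj₁ (monotoneAt (≤-trans x₀≤x (≤-reflexive x≡y)) x) (≤-reflexive x≡y))
      (proj₁ (monotoneAt x₀≤x y) (≤-reflexive (≡.sym x≡y)))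

    bound : ∀ d x → ‖ x ‖ ≡ d + ‖ x₀ ‖ → d + ‖ p · x₀ ‖ ≤ ‖ p · x ‖
    bound zero    x x≡ = ≤-reflexive (same ≤-refl (≡.sym x≡))
    bound (suc d) x x≡ with y , y≡ ← surjective (d + ‖ x₀ ‖) = ≤-trans (s≤s (bound d y y≡))
      (proj₂ (monotoneAt (≤-trans (m≤n+m _ (suc d)) (≤-reflexive (≡.sym x≡))) y)
        (≤-reflexive (≡.trans (cong suc y≡) (≡.sym x≡))))

    shifts : ShiftsBy p ℓ (‖ x₀ ‖)
    shifts x x₀≤x with d ← ‖ x ‖ ∸ ‖ x₀ ‖ | d+x₀≡x ← m∸n+n≡m x₀≤x
                     | k , px+k≡x ← m≤n⇒∃[o]m+o≡n (‖‖-· p x) = ≤-antisym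
      (≤-trans (+-monoʳ-≤ _ (ℓ≤ k (x , ≤-trans N≤x₀ x₀≤x , px+k≡x))) (≤-reflexive px+k≡x))
      (≤-trans (≤-reflexive (≡.trans (≡.sym d+x₀≡x) (≡.trans (cong (λ m → d + m) (≡.sym gap₀))
          (≡.sym (+-assoc d _ ℓ)))))
        (+-monoˡ-≤ ℓ (bound d x (≡.sym d+x₀≡x))))

module MinimalGroup (em : ∀ {ℓ} → ExcludedMiddle ℓ) {a} (V : ValuedAbelianGroup a)
  (infiniteΓ : Infinite (ValuedAbelianGroup.valueSetoid V)) (min : IsMinimalValuedGroup V)
  (ω* : HasOrderTypeω* V) (fibres : HasFiniteFibres V) where
  open ValuedAbelianGroup V hiding (surjective)
  open AbelianGroup G hiding (group)
  open AbelianGroupProperties G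
  open AbelianGroupSolver G
  open Multiples G
  open Torsion G
  open Depth V ω* fibres
  open UltraNorm ultraNorm
  open UltraNormProperties ultraNorm
  open Scalars ultraNorm
  open FiniteSubsets setoid
  open MinimalOrder em V infiniteΓ min using (proper-finite)

  private
    𝓜 : Structure 𝓛vg a
    𝓜 = valuedGroupStructure V
    open Structure 𝓜 using (Env)

  group-bounded : ∀ {h} {P : Carrier → Set h} → Finite setoid P → ∃ λ b → ∀ x → P x → ‖ x ‖ ≤ b
  group-bounded finite with b , bound ← Bounds.bounded setoid finite ‖_‖ =
    b , λ x Px → let y , x≈y , y≤b = bound x Px in subst (_≤ b) (≡.sym (‖‖-cong x≈y)) y≤b

  Deep : ∀ {h} → (Carrier → Set h) → Set (a Level.⊔ h)
  Deep P = ∃ λ N → ∀ x → N ≤ ‖ x ‖ → P x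

  Unbounded : ∀ {h} → (Carrier → Set h) → Set (a Level.⊔ h)
  Unbounded P = ∀ n → ∃ λ x → n ≤ ‖ x ‖ × P x

  deep-map : ∀ {h h′} {P : Carrier → Set h} {Q : Carrier → Set h′} → (∀ x → P x → Q x) → Deep P →
      Deep Q
  deep-map P⇒Q (N , deep) = N , λ x N≤x → P⇒Q x (deep x N≤x)

  unbounded-map : ∀ {h h′} {P : Carrier → Set h} {Q : Carrier → Set h′} → (∀ x → P x → Q x) →
      Unbounded P → Unbounded Q
  unbounded-map P⇒Q unb n with x , n≤x , Px ← unb n = x , n≤x , P⇒Q x Px

  dichotomy : ∀ {Δ} (φ : Formula 𝓛vg (group ∷ Δ)) (ρ : Env Δ) →
              Deep (DefinedBy 𝓜 φ ρ) ⊎ Deep (∁ (DefinedBy 𝓜 φ ρ))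
  dichotomy φ ρ with proj₂ min φ ρ
  ... | inj₁ finite with b , bound ← group-bounded finite =
      inj₂ (suc b , λ x b<x φx → <⇒≱ b<x (bound x φx))
  ... | inj₂ cofinite with b , bound ← group-bounded cofinite =
      inj₁ (suc b , λ x b<x → decide x b<x em)
    where
    decide : ∀ x → b < ‖ x ‖ → Dec (DefinedBy 𝓜 φ ρ x) → DefinedBy 𝓜 φ ρ x
    decide x b<x (yes φx) = φx
    decide x b<x (no ¬φx) = ⊥-elim (<⇒≱ b<x (bound x ¬φx))

  unbounded⇒deep : ∀ {Δ} (φ : Formula 𝓛vg (group ∷ Δ)) (ρ : Env Δ) →
                   Unbounded (DefinedBy 𝓜 φ ρ) → Deep (DefinedBy 𝓜 φ ρ)
  unbounded⇒deep φ ρ unb with dichotomy φ ρ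
  ... | inj₁ deep = deep
  ... | inj₂ (N , ¬φ) with x , N≤x , φx ← unb N = ⊥-elim (¬φ x N≤x φx)

  private
    multiple : ∀ {Δ} → ℕ → group ∈ Δ → Term 𝓛vg Δ group
    multiple zero    i = app zero []
    multiple (suc n) i = app plus (var i ∷ multiple n i ∷ [])

    eval-multiple : ∀ {Δ} n (i : group ∈ Δ) (ρ : Env Δ) → eval 𝓜 ρ (multiple n i) ≡ n · All.lookup ρ
        i
    eval-multiple zero    i ρ = ≡.refl
    eval-multiple (suc n) i ρ = cong (All.lookup ρ i ∙_) (eval-multiple n i ρ)

    _≼_ : ∀ {Δ} → Term 𝓛vg Δ group → Term 𝓛vg Δ group → Formula 𝓛vg Δ
    t ≼ s = atom leq (app val (s ∷ []) ∷ app val (t ∷ []) ∷ [])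

  -- The list holds the elements already chosen by outer quantifiers, so that pairwise separation
  -- can be expressed by recursion on `m`.
  Separated : ℕ → List Carrier → ℕ → Set a
  Separated m bs n = ∃ λ (F : Fin m → Carrier) → (∀ i → ‖ F i ‖ ≤ n) ×
    (∀ {i j} → i ≢ j → n ≤ ‖ F i - F j ‖) × (∀ i → All (λ b → n ≤ ‖ F i - b ‖) bs)

  private
    -- The language has no subtraction, so the difference is introduced as a `z` with `i = z + j`.
    far : ∀ {Δ} → group ∈ Δ → group ∈ Δ → group ∈ Δ → Formula 𝓛vg Δ
    far i j k = ex group ((var (there i) ≐ app plus (var (here ≡.refl) ∷ var (there j) ∷ [])) ∧
                          (var (there k) ≼ var (here ≡.refl)))

    far-all : ∀ {Δ} → group ∈ Δ → List (group ∈ Δ) → group ∈ Δ → Formula 𝓛vg Δ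
    far-all i []       k = var k ≐ var k
    far-all i (j ∷ js) k = far i j k ∧ far-all i js k

    separated : ∀ {Δ} → ℕ → List (group ∈ Δ) → group ∈ Δ → Formula 𝓛vg Δ
    separated zero    js k = var k ≐ var k
    separated (suc m) js k = ex group ((var (here ≡.refl) ≼ var (there k)) ∧
      (far-all (here ≡.refl) (map there js) (there k) ∧ separated m (here ≡.refl ∷ map there js)
          (there k)))

  module _ {Δ : List VgSort} (ρ : Env Δ) where
    private
      ⟦_⟧ᵥ : group ∈ Δ → Carrier
      ⟦ i ⟧ᵥ = All.lookup ρ i

    far⇒ : ∀ i j k → _⊨_ 𝓜 ρ (far i j k) → ‖ ⟦ k ⟧ᵥ ‖ ≤ ‖ ⟦ i ⟧ᵥ - ⟦ j ⟧ᵥ ‖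
    far⇒ i j k (z , i≈z∙j , k≼z) = ≤-trans (δ-anti k≼z)
        (≤-reflexive (‖‖-cong (sym (trans (∙-congʳ i≈z∙j) (//-rightDividesʳ _ z)))))

    ⇒far : ∀ i j k → ‖ ⟦ k ⟧ᵥ ‖ ≤ ‖ ⟦ i ⟧ᵥ - ⟦ j ⟧ᵥ ‖ → _⊨_ 𝓜 ρ (far i j k)
    ⇒far i j k le = ⟦ i ⟧ᵥ - ⟦ j ⟧ᵥ , sym (//-rightDividesˡ _ _) , δ-cancel le

    far-all⇒ : ∀ i js k → _⊨_ 𝓜 ρ (far-all i js k) → All (λ b → ‖ ⟦ k ⟧ᵥ ‖ ≤ ‖ ⟦ i ⟧ᵥ - b ‖)
        (map ⟦_⟧ᵥ js)
    far-all⇒ i []       k _       = []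
    far-all⇒ i (j ∷ js) k (h , h′) = far⇒ i j k h ∷ far-all⇒ i js k h′

    ⇒far-all : ∀ i js k → All (λ b → ‖ ⟦ k ⟧ᵥ ‖ ≤ ‖ ⟦ i ⟧ᵥ - b ‖) (map ⟦_⟧ᵥ js) →
        _⊨_ 𝓜 ρ (far-all i js k)
    ⇒far-all i []       k []       = refl
    ⇒far-all i (j ∷ js) k (h ∷ h′) = ⇒far i j k h , ⇒far-all i js k h′

  lookup-there : ∀ {Δ} (ρ : Env Δ) (x : Carrier) (js : List (group ∈ Δ)) →
                 map (All.lookup {xs = group ∷ Δ} (x ∷ ρ)) (map there js) ≡ map (All.lookup ρ) js
  lookup-there ρ x []       = ≡.refl
  lookup-there ρ x (j ∷ js) = cong (All.lookup ρ j ∷_) (lookup-there ρ x js)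

  separated⇒ : ∀ {Δ} m (ρ : Env Δ) (js : List (group ∈ Δ)) k → _⊨_ 𝓜 ρ (separated m js k) →
               Separated m (map (All.lookup ρ) js) (‖ All.lookup ρ k ‖)
  separated⇒ zero    ρ js k _ = (λ ()) , (λ ()) , (λ { {()} }) , λ ()
  separated⇒ (suc m) ρ js k (x , x≼k , x-far , rest)
    with F , F≤ , sep , away ← subst (λ bs → Separated m (x ∷ bs) _) (lookup-there ρ x js)
           (separated⇒ m (x ∷ ρ) (here ≡.refl ∷ map there js) (there k) rest) =
    F′ , F′≤ , sep′ , away′
    where
    F′ : Fin (suc m) → Carrier
    F′ Fin.zero    = x
    F′ (Fin.suc i) = F i
    F′≤ : ∀ i → ‖ F′ i ‖ ≤ _
    F′≤ Fin.zero    = δ-anti x≼k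
    F′≤ (Fin.suc i) = F≤ i
    sep′ : ∀ {i j} → i ≢ j → _ ≤ ‖ F′ i - F′ j ‖
    sep′ {Fin.zero}  {Fin.zero}  i≢j = ⊥-elim (i≢j ≡.refl)
    sep′ {Fin.zero}  {Fin.suc j} i≢j = ≤-trans (All.head (away j))
      (≤-reflexive (≡.trans (≡.sym (‖⁻¹‖ _)) (‖‖-cong (⁻¹-anti-homo‿- (F j) x))))
    sep′ {Fin.suc i} {Fin.zero}  i≢j = All.head (away i)
    sep′ {Fin.suc i} {Fin.suc j} i≢j = sep (i≢j ∘ cong Fin.suc)
    away′ : ∀ i → All (λ b → _ ≤ ‖ F′ i - b ‖) (map (All.lookup ρ) js)
    away′ Fin.zero    = subst (All _) (lookup-there ρ x js)
        (far-all⇒ (x ∷ ρ) (here ≡.refl) (map there js) (there k) x-far)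
    away′ (Fin.suc i) = All.tail (away i)

  ⇒separated : ∀ {Δ} m (ρ : Env Δ) (js : List (group ∈ Δ)) k →
               Separated m (map (All.lookup ρ) js) (‖ All.lookup ρ k ‖) → _⊨_ 𝓜 ρ (separated m js k)
  ⇒separated zero    ρ js k _ = refl′ k
    where
    refl′ : ∀ k → All.lookup ρ k ≈ All.lookup ρ k
    refl′ k = refl
  ⇒separated (suc m) ρ js k (F , F≤ , sep , away) = x , δ-cancel (F≤ Fin.zero) ,
    ⇒far-all (x ∷ ρ) (here ≡.refl) (map there js) (there k)
      (subst (All _) (≡.sym (lookup-there ρ x js)) (away Fin.zero)) ,
    ⇒separated m (x ∷ ρ) (here ≡.refl ∷ map there js) (there k)
      (subst (λ bs → Separated m (x ∷ bs) _) (≡.sym (lookup-there ρ x js))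
        ( F ∘ Fin.suc , F≤ ∘ Fin.suc , (λ i≢j → sep (i≢j ∘ Fin.suc-injective))
        , λ i → sep {Fin.suc i} {Fin.zero} (λ ()) ∷ away (Fin.suc i) ))
    where x = F Fin.zero

  -- With `x` standing for its norm, `Wide m (‖ x ‖)` is a definable condition on `x`, so it holds
  -- for all deep `x` or fails for all of them.
  wide-stable : WideStable
  wide-stable m with dichotomy (separated (suc m) [] (here ≡.refl)) []
  ... | inj₁ (N , deep) = N , λ {n} {n′} _ N≤n′ _ → let x , x≡ = surjective n′ ; w = wide x (deep x (subst (N ≤_) (≡.sym x≡) N≤n′)) in
          subst (Wide m) x≡ w
    where
    wide : ∀ x → DefinedBy 𝓜 (separated (suc m) [] (here ≡.refl)) [] x → Wide m (‖ x ‖)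
    wide x h with F , F≤ , sep , _ ← separated⇒ (suc m) (x ∷ []) [] (here ≡.refl) h = F , F≤ , sep
  ... | inj₂ (N , deep) = N , λ {n} {n′} N≤n _ w → let x , x≡ = surjective n in
          ⊥-elim (deep x (subst (N ≤_) (≡.sym x≡) N≤n) (narrow x (subst (Wide m) (≡.sym x≡) w)))
    where
    narrow : ∀ x → Wide m (‖ x ‖) → DefinedBy 𝓜 (separated (suc m) [] (here ≡.refl)) [] x
    narrow x (F , F≤ , sep) = ⇒separated (suc m) (x ∷ []) [] (here ≡.refl) (F , F≤ , sep , λ _ → [])

  -- All multiples of `x` lie in the finite ball of radius `‖ x ‖`, so two of them coincide.
  torsion : ∀ x → ∃ λ n → suc n · x ≈ ε
  torsion x with em {P = ∃ λ n → suc n · x ≈ ε}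
  ... | yes t = t
  ... | no ¬t = ⊥-elim (no-injection (balls (‖ x ‖)) (_· x) (λ n → ‖‖-· n x) distinct)
    where
    distinct : ∀ {m n} → m < n → ¬ (m · x ≈ n · x)
    distinct {m} m<n eq with d , ≡.refl ← m≤n⇒∃[o]m+o≡n m<n =
        ¬t (d , identityʳ-unique (m · x) (suc d · x)
      (trans (sym (trans (×-congˡ (≡.sym (+-suc m d))) (×-homo-+ x m (suc d)))) (sym eq)))

  _-torsion : ℕ → Carrier → Set a
  (n -torsion) x = n · x ≈ ε

  torsion-subgroup : ∀ n → IsSubgroup G (n -torsion)
  torsion-subgroup n = record
    { resp      = λ x≈y nx≈ε → trans (×-congʳ n (sym x≈y)) nx≈ε
    ; ε-closed  = ×-ε n
    ; -‿closed  = λ nx≈ε ny≈ε → trans (×-distrib-- n _ _)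
        (trans (∙-cong nx≈ε (⁻¹-cong ny≈ε)) (inverseʳ ε))
    }

  torsion-definable : ∀ n → Finite setoid (n -torsion) ⊎ Finite setoid (∁ (n -torsion))
  torsion-definable n with proj₂ min (multiple n (here ≡.refl) ≐ app zero []) []
  ... | inj₁ finite   = inj₁ (finite-⊆ (λ {x} nx≈ε →
      trans (reflexive (eval-multiple n (here ≡.refl) (x ∷ []))) nx≈ε) finite)
  ... | inj₂ cofinite = inj₂ (finite-⊆ (λ {x} nx≉ε h →
      nx≉ε (trans (reflexive (≡.sym (eval-multiple n (here ≡.refl) (x ∷ [])))) h)) cofinite)

  multiples-subgroup : ∀ n → IsSubgroup G (λ x → ∃ λ y → n · y ≈ x)
  multiples-subgroup n = record
    { resp      = λ x≈y (z , nz≈x) → z , trans nz≈x x≈y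
    ; ε-closed  = ε , ×-ε n
    ; -‿closed  = λ (z , nz≈x) (w , nw≈y) → z - w ,
        trans (×-distrib-- n z w) (∙-cong nz≈x (⁻¹-cong nw≈y))
    }

  multiples-definable : ∀ n → Finite setoid (λ x → ∃ λ y → n · y ≈ x) ⊎ Finite setoid
      (∁ (λ x → ∃ λ y → n · y ≈ x))
  multiples-definable n with proj₂ min (ex group
      (multiple n (here ≡.refl) ≐ var (there (here ≡.refl)))) []
  ... | inj₁ finite   = inj₁ (finite-⊆ (λ {x} (y , ny≈x) → y ,
      trans (reflexive (eval-multiple n (here ≡.refl) (y ∷ x ∷ []))) ny≈x) finite)
  ... | inj₂ cofinite = inj₂ (finite-⊆ (λ {x} h (y , ny≈x) →
      h (y , trans (reflexive (≡.sym (eval-multiple n (here ≡.refl) (y ∷ x ∷ [])))) ny≈x)) cofinite)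

  torsion-finite : ∀ n → ¬ Kills n → Finite setoid (n -torsion)
  torsion-finite n ¬kills = proper-finite (torsion-subgroup n) (torsion-definable n) (outside em)
    where
    outside : Dec (∃ λ x → ¬ (n -torsion) x) → ∃ λ x → ¬ (n -torsion) x
    outside (yes o) = o
    outside (no ¬o) = ⊥-elim (¬kills λ x → inside x em)
      where
      inside : ∀ x → Dec (n · x ≈ ε) → n · x ≈ ε
      inside x (yes t) = t
      inside x (no ¬t) = ⊥-elim (¬o (x , ¬t))

  -- G is an extension of its image under n by the n-torsion, so the image is infinite.
  divisible : ∀ n → ¬ Kills n → Onto n
  divisible n ¬kills x with em {P = ∃ λ y → n · y ≈ x}
  ... | yes found = found
  ... | no ¬found with xs , cover ← proper-finite (multiples-subgroup n) (multiples-definable n)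
      (x , ¬found)
                     | ts , cover′ ← torsion-finite n ¬kills =
    ⊥-elim (proj₁ min (cartesianProductWith _∙_ (map root xs) ts , λ y _ → covers y))
    where
    root : Carrier → Carrier
    root z with em {P = ∃ λ y → n · y ≈ z}
    ... | yes (y , _) = y
    ... | no _        = ε
    root-· : ∀ {z} → (∃ λ y → n · y ≈ z) → n · root z ≈ z
    root-· {z} has with em {P = ∃ λ y → n · y ≈ z}
    ... | yes (_ , eq) = eq
    ... | no ¬has      = ⊥-elim (¬has has)
    covers : ∀ y → Any (y ≈_) (cartesianProductWith _∙_ (map root xs) ts)
    covers y with z , z∈ , ny≈z ← find (cover (n · y) (y , refl)) =
      ∈ₛ.∈-resp-≈ setoid (//-rightDividesˡ (root z) y |> λ e → trans (comm (root z) (y - root z)) e)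
        (∈ₛ.∈-cartesianProductWith⁺ setoid setoid setoid ∙-cong
          (∈⇒∈ₛ (∈-map⁺ root z∈)) (cover′ (y - root z) killed))
      where
      killed : n · (y - root z) ≈ ε
      killed = trans (×-distrib-- n y (root z)) (x≈y⇒x∙y⁻¹≈ε (trans ny≈z (sym (root-· (y , ny≈z)))))
      ∈⇒∈ₛ : ∀ {w ws} → w ∈ ws → Any (w ≈_) ws
      ∈⇒∈ₛ = Any.map reflexive

  module NonElementary (¬elementary : ¬ IsElementaryAbelian G) where

    nonKilling : ∀ {q} → Prime q → ¬ Kills q
    nonKilling {q} q-prime kills = ¬elementary (q , q-prime , kills)

    PowerTorsionElement : ℕ → Carrier → Set a
    PowerTorsionElement q x = ∃ λ k → (q ^ k) · x ≈ ε

    -- Dividing `y` by `q` repeatedly gives elements of order `q ^ k`, all distinct, which a finite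
    -- ball cannot hold.
    chain-unbounded : ∀ {q y} → Prime q → q · y ≈ ε → ¬ (y ≈ ε) → Unbounded (PowerTorsionElement q)
    chain-unbounded {q} {y} q-prime qy≈ε y≉ε n with em {P = ∃ λ x → n ≤ ‖ x ‖ × PowerTorsionElement
        q x}
    ... | yes found = found
    ... | no ¬found = ⊥-elim (no-injection (balls n) e
            (λ k → ≰⇒≥ λ n≤ → ¬found (e k , n≤ , k , killed k)) distinct)
      where
      e : ℕ → Carrier
      e zero          = ε
      e (suc zero)    = y
      e (suc (suc k)) = proj₁ (divisible q (nonKilling q-prime) (e (suc k)))
      step : ∀ k → q · e (suc k) ≈ e k
      step zero    = qy≈ε
      step (suc k) = proj₂ (divisible q (nonKilling q-prime) (e (suc k)))
      open Chain q G e refl step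
      distinct : ∀ {i j} → i < j → ¬ (e i ≈ e j)
      distinct {i} {j} i<j eᵢ≈eⱼ = <⇒≱ (^-monoʳ-< q (nonTrivial⇒n>1 q {{prime⇒nonTrivial q-prime}})
          i<j)
        (∣⇒≤ {{m^n≢0 q i {{prime⇒nonZero q-prime}}}}
            (order q-prime y≉ε (q ^ i) j (trans (×-congʳ (q ^ i) (sym eᵢ≈eⱼ)) (killed i))))

    somePrime : ∃ λ p → Prime p × ∃ λ y → p · y ≈ ε × ¬ (y ≈ ε)
    somePrime with x , x≡1 ← surjective 1 with n , nx≈ε ← torsion x with factorise (suc n)
    ... | record { factors = ps ; isFactorisation = eq ; factorsPrime = primes } =
      go ps primes (trans (×-congˡ (≡.sym eq)) nx≈ε)
      where
      go : ∀ ps → All Prime ps → product ps · x ≈ ε → ∃ λ p → Prime p × ∃ λ y →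
          p · y ≈ ε × ¬ (y ≈ ε)
      go [] [] x≈ε = ⊥-elim (1+n≢0 (≡.trans (≡.sym x≡1)
          (≡.trans (‖‖-cong (trans (sym (×-homo-1 x)) x≈ε)) ‖ε‖)))
      go (q ∷ qs) (q-prime ∷ primes) eq with em {P = product qs · x ≈ ε}
      ... | yes eq′ = go qs primes eq′
      ... | no y≉ε  = q , q-prime , product qs · x , trans (×-assocˡ x q (product qs)) eq , y≉ε

    module AtPrime {p} (p-prime : Prime p) {y₁} (py₁≈ε : p · y₁ ≈ ε) (y₁≉ε : ¬ (y₁ ≈ ε)) where

      p-onto : Onto p
      p-onto = divisible p (nonKilling p-prime)

      -- The norm drops below any given n on the way from an element of order pᵏ
      -- to 0 by repeated multiplication by p.
      descending : Deep (λ x → ‖ p · x ‖ < ‖ x ‖)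
      descending with unbounded⇒deep (neg (var (here ≡.refl) ≼ multiple p (here ≡.refl))) [] drops
        where
        descend : ∀ n k x → suc n ≤ ‖ x ‖ → (p ^ k) · x ≈ ε → ∃ λ z → suc n ≤ ‖ z ‖ × ‖ p · z ‖ < ‖
            z ‖
        descend n zero x n<x x≈ε = ⊥-elim (n≮0
            (subst (n <_) (≡.trans (‖‖-cong (trans (sym (×-homo-1 x)) x≈ε)) ‖ε‖) n<x))
        descend n (suc k) x n<x eq with suc n ≤? ‖ p · x ‖
        ... | yes n<px = descend n k (p · x) n<px
            (trans (×-assocˡ x (p ^ k) p) (trans (×-congˡ (*-comm (p ^ k) p)) eq))
        ... | no px≤n  = x , n<x , <-≤-trans (≰⇒> px≤n) n<x
        drops : Unbounded (DefinedBy 𝓜 (neg (var (here ≡.refl) ≼ multiple p (here ≡.refl))) [])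
        drops n with x , n<x , k , eq ← chain-unbounded p-prime py₁≈ε y₁≉ε (suc n)
          with z , n<z , pz<z ← descend n k x n<x eq =
          z , <⇒≤ n<z , λ h → <⇒≱ pz<z (≤-trans (δ-anti h)
              (≤-reflexive (cong ‖_‖ (eval-multiple p (here ≡.refl) (z ∷ [])))))
      ... | N , deep = N , λ x N≤x → ≰⇒> λ le → deep x N≤x (δ-cancel (≤-trans le
              (≤-reflexive (cong ‖_‖ (≡.sym (eval-multiple p (here ≡.refl) (x ∷ [])))))))

      no-other-torsion : ∀ {q} → Prime q → q ≢ p → ∀ {y} → q · y ≈ ε → y ≈ ε
      no-other-torsion {q} q-prime q≢p {y} qy≈ε with em {P = y ≈ ε}
      ... | yes y≈ε = y≈ε
      ... | no y≉ε with N , deep ← descending with x , N≤x , k , eq ← chain-unbounded q-prime qy≈ε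
          y≉ε N
        with i , inv ← invert (prime≢⇒coprime q-prime k p-prime (q≢p ∘ ≡.sym)) =
        ⊥-elim (<⇒≱ (deep x N≤x) (subst (_≤ ‖ p · x ‖) (‖‖-cong (inv x eq)) (‖‖-· i (p · x))))

      p-torsion : PowerTorsion p
      p-torsion x with n , nx≈ε ← torsion x with factorise (suc n)
      ... | record { factors = ps ; isFactorisation = eq ; factorsPrime = primes } =
        go ps primes x (trans (×-congˡ (≡.sym eq)) nx≈ε)
        where
        go : ∀ ps → All Prime ps → ∀ x → product ps · x ≈ ε → ∃ λ k → (p ^ k) · x ≈ ε
        go [] [] x eq = 0 , eq
        go (q ∷ qs) (q-prime ∷ primes) x eq with q ≟ p
        ... | no q≢p = go qs primes x (no-other-torsion q-prime q≢p
            (trans (×-assocˡ x q (product qs)) eq))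
        ... | yes ≡.refl with k , eq′ ← go qs primes (q · x)
            (trans (×-assocˡ x (product qs) q) (trans (×-congˡ (*-comm (product qs) q)) eq)) =
          suc k , trans (sym (trans (×-assocˡ x (q ^ k) q) (×-congˡ (*-comm (q ^ k) q)))) eq′

      open EventualShift em ultraNorm {p} p-onto using (MonotoneAt; monotone-unbounded)

      private
        py px : Term 𝓛vg (group ∷ group ∷ []) group
        py = multiple p (here ≡.refl)
        px = multiple p (there (here ≡.refl))

        monotone : Formula 𝓛vg (group ∷ [])
        monotone = neg (ex group ((var (here ≡.refl) ≼ var (there (here ≡.refl))) ∧ neg (py ≼ px)))
            ∧
                   neg (ex group (neg (var (there (here ≡.refl)) ≼ var (here ≡.refl)) ∧ (px ≼ py)))

        ‖py‖ : ∀ x y → ‖ eval 𝓜 (y ∷ x ∷ []) py ‖ ≡ ‖ p · y ‖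
        ‖py‖ x y = cong ‖_‖ (eval-multiple p (here ≡.refl) (y ∷ x ∷ []))

        ‖px‖ : ∀ x y → ‖ eval 𝓜 (y ∷ x ∷ []) px ‖ ≡ ‖ p · x ‖
        ‖px‖ x y = cong ‖_‖ (eval-multiple p (there (here ≡.refl)) (y ∷ x ∷ []))

        monotone⇒ : ∀ x → DefinedBy 𝓜 monotone [] x → MonotoneAt x
        monotone⇒ x (h , h′) y =
          (λ y≤x → ≮⇒≥ λ lt → h (y , δ-cancel y≤x , λ le →
            <⇒≱ lt (≤-trans (≤-reflexive (≡.sym (‖py‖ x y)))
                (≤-trans (δ-anti le) (≤-reflexive (‖px‖ x y)))))) ,
          (λ y<x → ≰⇒> λ le → h′ (y , (λ x≤y → <⇒≱ y<x (δ-anti x≤y)) , δ-cancel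
            (≤-trans (≤-reflexive (‖px‖ x y)) (≤-trans le (≤-reflexive (≡.sym (‖py‖ x y)))))))

        ⇒monotone : ∀ x → MonotoneAt x → DefinedBy 𝓜 monotone [] x
        ⇒monotone x m =
          (λ (y , y≤x , ¬le) → ¬le (δ-cancel (≤-trans (≤-reflexive (‖py‖ x y))
            (≤-trans (proj₁ (m y) (δ-anti y≤x)) (≤-reflexive (≡.sym (‖px‖ x y))))))) ,
          (λ (y , x≰y , le) → <⇒≱ (proj₂ (m y) (≰⇒> λ x≤y → x≰y (δ-cancel x≤y)))
            (≤-trans (≤-reflexive (≡.sym (‖px‖ x y)))
                (≤-trans (δ-anti le) (≤-reflexive (‖py‖ x y)))))

      monotone-deep : Deep MonotoneAt
      monotone-deep = deep-map monotone⇒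
        (unbounded⇒deep monotone [] (unbounded-map ⇒monotone monotone-unbounded))

      shift : ∃₂ λ ℓ N → 1 ≤ ℓ × ShiftsBy p ℓ N
      shift = EventualShift.shift em ultraNorm {p} p-onto descending monotone-deep

-- Right shifts, and the theorem

module RightShift (em : ∀ {ℓ} → ExcludedMiddle ℓ) {a} (V : ValuedAbelianGroup a)
  (ω* : HasOrderTypeω* V) (fibres : HasFiniteFibres V) where
  open ValuedAbelianGroup V hiding (surjective)
  open Γ using (module Eq) renaming (_≈_ to _≈ᵛ_; _≉_ to _≉ᵛ_; _≤_ to _≤ᵛ_)
  open TotalOrderProperties Γ using () renaming (_<_ to _<ᵛ_)
  open AbelianGroup G
  open Depth V ω* fibres
  open UltraNorm ultraNorm
  open UltraNormProperties ultraNorm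
  open Multiples G
  open Scalars ultraNorm
  open ValueFunctions em V ω* fibres

  δ-< : ∀ {γ η} → γ <ᵛ η → δ η < δ γ
  δ-< (γ≤η , γ≉η) = ≤∧≢⇒< (δ-anti γ≤η) (λ e → γ≉η (δ-injective (≡.sym e)))

  <-δ : ∀ {γ η} → δ η < δ γ → γ <ᵛ η
  <-δ lt = δ-cancel (<⇒≤ lt) , λ e → <⇒≢ lt (≡.sym (δ-cong e))

  successor : ∀ {γ η} → suc (δ η) ≡ δ γ → IsSuccessor V γ η
  successor {γ} {η} eq = <-δ (≤-reflexive eq) , λ θ γ<θ →
      δ-cancel (s≤s⁻¹ (≤-trans (δ-< γ<θ) (≤-reflexive (≡.sym eq))))

  successor⁻ : ∀ {γ η} → IsSuccessor V γ η → suc (δ η) ≡ δ γ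
  successor⁻ {γ} {η} (γ<η , least-above) = ≤-antisym (δ-< γ<η) (≮⇒≥ λ lt → n≮n (suc (δ η))
    (≤-trans (s≤s (≤-reflexive (≡.sym (δg (suc (δ η)))))) (s≤s (δ-anti (least-above (g (suc (δ η)))
      (<-δ (subst (_< δ γ) (≡.sym (δg (suc (δ η)))) lt)))))))

  iterated : ∀ k {γ η} → δ η + k ≡ δ γ → IsIteratedSuccessor V k γ η
  iterated zero    eq = δ-injective (≡.trans (≡.sym eq) (+-identityʳ _))
  iterated (suc k) {γ} {η} eq = g (δ η + k) ,
    successor (≡.trans (cong suc (δg (δ η + k))) (≡.trans (≡.sym (+-suc (δ η) k)) eq)) ,
    iterated k (≡.sym (δg (δ η + k)))

  iterated⁻ : ∀ k {γ η} → IsIteratedSuccessor V k γ η → δ η + k ≡ δ γ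
  iterated⁻ zero    γ≈η = ≡.trans (+-identityʳ _) (≡.sym (δ-cong γ≈η))
  iterated⁻ (suc k) {γ} {η} (θ , γ⋖θ , it) =
    ≡.trans (+-suc (δ η) k) (≡.trans (cong suc (iterated⁻ k it)) (successor⁻ γ⋖θ))

  shiftsBy : ∀ {p} (E : IsEventuallyRightShift V em p) → ∃₂ (ShiftsBy p)
  shiftsBy {p} E with value-bounded (IsEventuallyRightShift.cofinite E)
  ... | b , bound = steps , suc b , λ x b<x → shifted x (inside x b<x em)
    where
    open IsEventuallyRightShift E
    inside : ∀ x → b < ‖ x ‖ → Dec (I (v x)) → I (v x)
    inside x b<x (yes i) = i
    inside x b<x (no ¬i) = ⊥-elim (<⇒≱ b<x (bound (v x) ¬i))
    shifted : ∀ x → I (v x) → ‖ p · x ‖ + steps ≡ ‖ x ‖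
    shifted x i with η , w ← wellDefined i =
      ≡.trans (cong (_+ steps) (δ-cong (Eq.trans (w x Eq.refl) (Eq.sym (fⁿ-≈ p w)))))
          (iterated⁻ steps (shift i))

  module _ {p s N} (onto : Onto p) (shifts : ShiftsBy p s N) (1≤s : 1 ≤ s) where

    -- After a descent by `s` the depth must still exceed `N`, so that the shift can be read
    -- backwards, and differ from 0, so that `f p` does not reach `∞`.
    radius : ℕ
    radius = suc (N + s)

    Initial : Γ.Carrier → Set a
    Initial γ = γ ≤ᵛ g radius

    radius≤ : ∀ {γ} → Initial γ → radius ≤ δ γ
    radius≤ i = ≤-trans (≤-reflexive (≡.sym (δg radius))) (δ-anti i)

    N≤ : ∀ {γ} → Initial γ → N ≤ δ γ
    N≤ i = ≤-trans (≤-trans (m≤m+n N s) (n≤1+n _)) (radius≤ i)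

    fᵖ : Γ.Carrier → Γ.Carrier
    fᵖ = fⁿ p

    fᵖ-shift : ∀ {γ} → Initial γ → δ (fᵖ γ) + s ≡ δ γ
    fᵖ-shift {γ} i = fⁿ-shift p shifts γ (N≤ i)

    N<fᵖ : ∀ {γ} → Initial γ → N < δ (fᵖ γ)
    N<fᵖ {γ} i = +-cancelʳ-≤ s (suc N) _ (≤-trans (radius≤ i) (≤-reflexive (≡.sym (fᵖ-shift i))))

    p·-norm : ∀ {x} → N < ‖ p · x ‖ → ‖ p · x ‖ + s ≡ ‖ x ‖
    p·-norm {x} N<px = shifts x (<⇒≤ (<-≤-trans N<px (‖‖-· p x)))

    p·-value : ∀ {γ x} → Initial γ → v (p · x) ≈ᵛ fᵖ γ → v x ≈ᵛ γ
    p·-value {γ} {x} i e = δ-injective (≡.trans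
        (≡.sym (p·-norm (subst (N <_) (≡.sym (δ-cong e)) (N<fᵖ i))))
      (≡.trans (cong (_+ s) (δ-cong e)) (fᵖ-shift i)))

    value-p· : ∀ {γ x} → Initial γ → v x ≈ᵛ γ → v (p · x) ≈ᵛ fᵖ γ
    value-p· {γ} {x} i e = δ-injective (+-cancelʳ-≡ s _ _ (≡.trans
      (shifts x (subst (N ≤_) (≡.sym (δ-cong e)) (N≤ i)))
          (≡.trans (δ-cong e) (≡.sym (fᵖ-shift i)))))

    fᵖ-cancel : ∀ {γ η} → Initial γ → Initial η → δ (fᵖ γ) ≤ δ (fᵖ η) → δ γ ≤ δ η
    fᵖ-cancel i j le = ≤-trans (≤-reflexive (≡.sym (fᵖ-shift i)))
      (≤-trans (+-monoˡ-≤ s le) (≤-reflexive (fᵖ-shift j)))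

    fᵖ-mono : ∀ {γ η} → Initial γ → Initial η → δ γ ≤ δ η → δ (fᵖ γ) ≤ δ (fᵖ η)
    fᵖ-mono i j le = +-cancelʳ-≤ s _ _ (≤-trans (≤-reflexive (fᵖ-shift i))
        (≤-trans le (≤-reflexive (≡.sym (fᵖ-shift j)))))

    ≉∞ : ∀ {γ} → Initial γ → γ ≉ᵛ ∞
    ≉∞ i = 0<δ⇒≉∞ (≤-trans (s≤s z≤n) (radius≤ i))

    fᵖ≉∞ : ∀ {γ} → Initial γ → fᵖ γ ≉ᵛ ∞
    fᵖ≉∞ i = 0<δ⇒≉∞ (≤-<-trans z≤n (N<fᵖ i))

    -- The value `∞` is ambiguous, being also the default of `f n`; any other value certifies that
    -- `f n` is well-defined there.
    atWellDefined : ∀ n {γ η} → η ≉ᵛ ∞ → fⁿ n γ ≈ᵛ η → ∀ x → v x ≈ᵛ γ → v (n · x) ≈ᵛ η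
    atWellDefined n {γ} η≉∞ e x vx≈γ with fⁿ-cases n γ
    ... | inj₁ w       = Eq.trans (w x vx≈γ) e
    ... | inj₂ (_ , ∞≈) = ⊥-elim (η≉∞ (Eq.trans (Eq.sym e) ∞≈))

    -- Multiplications by `n` and `p` commute, and since `p` is onto, each element of value `fᵖ γ`
    -- is `p · x` with `x` of value `γ`.
    fⁿ-forward : ∀ n {γ η} → Initial γ → Initial η → fⁿ n γ ≈ᵛ η → fⁿ n (fᵖ γ) ≈ᵛ fᵖ η
    fⁿ-forward n {γ} {η} i j e = fⁿ-≈ n λ y vy≈ → let x , px≈y = onto y in
      Eq.trans (v-cong (trans (×-congʳ n (sym px≈y)) (×-comm n p x)))
        (value-p· j (atWellDefined n (≉∞ j) e x (p·-value i (Eq.trans (v-cong px≈y) vy≈))))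

    fⁿ-backward : ∀ n {γ η} → Initial γ → Initial η → fⁿ n (fᵖ γ) ≈ᵛ fᵖ η → fⁿ n γ ≈ᵛ η
    fⁿ-backward n {γ} {η} i j e = fⁿ-≈ n λ x vx≈γ →
      p·-value j (Eq.trans (v-cong (×-comm p n x))
          (atWellDefined n (fᵖ≉∞ j) e (p · x) (value-p· i vx≈γ)))

    wide-forward : ∀ m {e e′} → N ≤ e′ → e′ + s ≡ e → Wide m e → Wide m e′
    wide-forward m {e} {e′} N≤e′ eq (F , F≤ , sep) = (λ i → p · F i) , norm , λ {i} {j} i≢j →
      +-cancelʳ-≤ s e′ _ (≤-trans (≤-reflexive eq) (≤-trans (sep i≢j) (≤-reflexive (≡.trans
        (≡.sym (shifts (F i - F j) (≤-trans N≤e′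
            (≤-trans (m≤m+n e′ s) (≤-trans (≤-reflexive eq) (sep i≢j))))))
        (cong (_+ s) (‖‖-cong (×-distrib-- p (F i) (F j))))))))
      where
      norm : ∀ i → ‖ p · F i ‖ ≤ e′
      norm i with N ≤? ‖ F i ‖
      ... | yes N≤ = +-cancelʳ-≤ s _ e′ (≤-trans (≤-reflexive (shifts (F i) N≤))
          (≤-trans (F≤ i) (≤-reflexive (≡.sym eq))))
      ... | no N≰  = ≤-trans (‖‖-· p (F i)) (≤-trans (<⇒≤ (≰⇒> N≰)) N≤e′)

    wide-backward : ∀ m {e e′} → N < e′ → e′ + s ≡ e → Wide m e′ → Wide m e
    wide-backward m {e} {e′} N<e′ eq (Z , Z≤ , sep) = F , norm , λ {i} {j} i≢j →
        separated i j (sep i≢j)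
      where
      F : Fin (suc m) → Carrier
      F i = proj₁ (onto (Z i))
      pF : ∀ i → p · F i ≈ Z i
      pF i = proj₂ (onto (Z i))
      norm : ∀ i → ‖ F i ‖ ≤ e
      norm i with N ≤? ‖ F i ‖
      ... | yes N≤ = ≤-trans (≤-reflexive (≡.sym (shifts (F i) N≤))) (≤-trans (+-monoˡ-≤ s
                       (≤-trans (≤-reflexive (‖‖-cong (pF i))) (Z≤ i))) (≤-reflexive eq))
      ... | no N≰  = ≤-trans (<⇒≤ (≰⇒> N≰)) (≤-trans (<⇒≤ N<e′)
          (≤-trans (m≤m+n e′ s) (≤-reflexive eq)))
      separated : ∀ i j → e′ ≤ ‖ Z i - Z j ‖ → e ≤ ‖ F i - F j ‖
      separated i j e′≤ = ≤-trans (≤-reflexive (≡.sym eq)) (≤-trans (+-monoˡ-≤ s e′≤p)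
          (≤-reflexive (p·-norm (<-≤-trans N<e′ e′≤p))))
        where
        e′≤p : e′ ≤ ‖ p · (F i - F j) ‖
        e′≤p = ≤-trans e′≤ (≤-reflexive (‖‖-cong
            (sym (trans (×-distrib-- p (F i) (F j)) (∙-cong (pF i) (⁻¹-cong (pF j)))))))

    eventuallyRightShift : IsEventuallyRightShift V em p
    eventuallyRightShift = record
      { I           = Initial
      ; initial     = Γ.trans
      ; cofinite    = cofinite
      ; wellDefined = λ {γ} i → fᵖ γ , λ x → value-p· i
      ; steps       = s
      ; steps≥1     = 1≤s
      ; shift       = λ i → iterated s (fᵖ-shift i)
      ; isomorphism = record
        { ≈-⇔   = λ i j → mk⇔ (f-cong V em p) λ e → δ-injective (≤-antisym
                    (fᵖ-cancel i j (≤-reflexive (δ-cong e)))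
                        (fᵖ-cancel j i (≤-reflexive (≡.sym (δ-cong e)))))
        ; fun-⇔ = λ { (f n) {γ ∷ []} i* j → let i = i* (here ≡.refl) in mk⇔ (fⁿ-forward n i j) (fⁿ-backward n i j) }
        ; rel-⇔ = λ { leq {γ ∷ η ∷ []} i* → let i = i* (here ≡.refl) ; j = i* (there (here ≡.refl)) in
                        mk⇔ (λ γ≤η → δ-cancel (fᵖ-mono j i (δ-anti γ≤η)))
                            (λ le → δ-cancel (fᵖ-cancel j i (δ-anti le)))
                    ; (R m) {γ ∷ []} i* → let i = i* (here ≡.refl) in mk⇔
                        (λ large → wide⇒large m (fᵖ≉∞ i) (wide-forward m (<⇒≤ (N<fᵖ i)) (fᵖ-shift i)
                            (large⇒wide m large)))
                        (λ large → wide⇒large m (≉∞ i) (wide-backward m (N<fᵖ i) (fᵖ-shift i)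
                            (large⇒wide m large))) }
        }
      }
      where
      cofinite : Finite valueSetoid (∁ Initial)
      cofinite with γs , cover ← upset radius = γs , λ γ ¬i →
          cover γ (≰⇒≥ λ le → ¬i (δ-cancel (≤-trans (≤-reflexive (δg radius)) le)))

module WideStability (em : ∀ {ℓ} → ExcludedMiddle ℓ) {a} (V : ValuedAbelianGroup a)
  (ω* : HasOrderTypeω* V) (fibres : HasFiniteFibres V) (minimal : IsMinimalValueSet V em) where
  open ValuedAbelianGroup V hiding (surjective)
  open Depth V ω* fibres
  open UltraNormProperties ultraNorm
  open ValueFunctions em V ω* fibres
  open AbelianGroup G using (ε)

  wide-stable : WideStable
  -- `R 0` is not in the language, but `Wide 0` asks for a single element and always holds.
  wide-stable zero = 0 , λ _ _ _ → (λ _ → ε) ,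
      (λ _ → subst (_≤ _) (≡.sym (≡.trans (δ-cong (v-ε V)) δ∞)) z≤n) ,
    λ { {Fin.zero} {Fin.zero} 0≢0 → ⊥-elim (0≢0 ≡.refl) }
  wide-stable m@(suc _) with proj₂ minimal (atom (R m) (var (here ≡.refl) ∷ [])) []
  ... | inj₁ finite with b , bound ← value-bounded finite = suc b , λ {n} {n′} b<n _ wide →
    ⊥-elim (<⇒≱ b<n (subst (_≤ b) (δg n) (bound (g n)
        (wide⇒large m (0<δ⇒≉∞ (subst (0 <_) (≡.sym (δg n)) (≤-<-trans z≤n b<n)))
      (subst (Wide m) (≡.sym (δg n)) wide)))))
  ... | inj₂ cofinite with b , bound ← value-bounded cofinite = suc b , λ {n} {n′} _ b<n′ _ →
      decide b<n′ em
    where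
    decide : ∀ {n} → b < n → Dec (LargeQuotient V m (g n)) → Wide m n
    decide {n} b<n (yes large) = subst (Wide m) (δg n) (large⇒wide m large)
    decide {n} b<n (no ¬large) = ⊥-elim (<⇒≱ b<n (subst (_≤ b) (δg n) (bound (g n) ¬large)))

theorem4 :
    (em : ∀ {ℓ} → ExcludedMiddle ℓ) →
    ∀ {a} (V : ValuedAbelianGroup a) →
    Infinite (ValuedAbelianGroup.valueSetoid V) →
    IsMinimalValuedGroup V ⇔
      ( IsMinimalValueSet V em
      × HasOrderTypeω* V
      × HasFiniteFibres V
      × ( IsElementaryAbelian (ValuedAbelianGroup.G V)
        ⊎ ∃ λ p → Prime p
                × IsFiniteProductOfPrüfer p (ValuedAbelianGroup.G V)
                × IsEventuallyRightShift V em p ) )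
theorem4 em V infiniteΓ = mk⇔ necessary sufficient
  where
  G = ValuedAbelianGroup.G V

  necessary : IsMinimalValuedGroup V → _
  necessary min = decide em
    where
    ω* = MinimalOrder.orderType em V infiniteΓ min
    fibres = MinimalOrder.fibres-finite em V infiniteΓ min
    open Depth V ω* fibres using (ultraNorm)
    open MinimalGroup em V infiniteΓ min ω* fibres
    open TorsionScalars ultraNorm

    -- Γ is not interpreted in G here: the game on depths needs only the stability of `R m` and the
    -- behaviour of the scalars, both obtained from the minimality of G.
    minimalΓ : Scalars.Scalars ultraNorm → IsMinimalValueSet V em
    minimalΓ scalars = ValueMinimality.minimal em V ω* fibres wide-stable scalars infiniteΓ

    decide : Dec (IsElementaryAbelian G) → _
    decide (yes elementary@(p , p-prime , kills)) =
      minimalΓ (elementary-scalars p-prime kills) , ω* , fibres , inj₁ elementary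
    decide (no ¬elementary)
      with p , p-prime , y , py≈ε , y≉ε ← NonElementary.somePrime ¬elementary =
      minimalΓ (primary-scalars p-prime p-torsion p-onto
        (proj₁ shift , proj₁ (proj₂ shift) , proj₂ (proj₂ (proj₂ shift)))) , ω* , fibres ,
      inj₂ (p , p-prime ,
        QuasicyclicEmbedding.isPower em p-prime (PrüferGenerators.prüfer-quasicyclic p-prime) G
          p-onto p-torsion (torsion-finite p (nonKilling p-prime)) ,
        RightShift.eventuallyRightShift em V ω* fibres p-onto (proj₂ (proj₂ (proj₂ shift)))
            (proj₁ (proj₂ (proj₂ shift))))
      where
      open NonElementary ¬elementary
      open AtPrime p-prime py≈ε y≉ε

  sufficient : _ → IsMinimalValuedGroup V
  sufficient (minimalΓ , ω* , fibres , structure) = GroupMinimality.minimal em V ω* fibres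
    (WideStability.wide-stable em V ω* fibres minimalΓ) (scalars structure)
    where
    open Depth V ω* fibres using (ultraNorm)
    open TorsionScalars ultraNorm

    scalars : _ → Scalars.Scalars ultraNorm
    scalars (inj₁ (p , p-prime , kills)) = elementary-scalars p-prime kills
    scalars (inj₂ (p , p-prime , (k , iso) , eventually)) = primary-scalars p-prime
      (Transport.torsion {G = G} {H = Power (Prüfer p) k} iso {p}
          (PowerProperties.torsion-power (Prüfer p) k {p} (QuasicyclicProperties.torsion prüfer)))
      (Transport.onto {G = G} {H = Power (Prüfer p) k} iso {p}
          (PowerProperties.onto-power (Prüfer p) k {p} (QuasicyclicProperties.onto prüfer)))
      (RightShift.shiftsBy em V ω* fibres eventually)
      where
      prüfer : Quasicyclic p (Prüfer p)
      prüfer = PrüferGenerators.prüfer-quasicyclic p-prime
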